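{- Let $m_{\mathcal{X}}(n)$ be the number of matroids on ground set $[n]$ having no minor isomorphic to $\mathcal{W}^3$ or $M(K_4)$, and let $s(n)$ be the number of sparse paving matroids on ground set $[n]$. Then $m_{\mathcal{X}}(n)=o(s(n))$ as $n\to\infty$.
   Context: A matroid is sparse paving if every nonspanning circuit is also a hyperplane. $\mathcal{W}^3$ is the rank-3 matroid on $\{a,b,c,d,e,f\}$ whose only dependent 3-sets are $\{a,b,c\},\{c,d,e\},\{e,f,a\}$; $M(K_4)$ (the cycle matroid of $K_4$) is the rank-3 matroid on $\{a,b,c,d,e,f\}$ whose only dependent 3-sets are $\{a,b,c\},\{c,d,e\},\{e,f,a\},\{b,d,f\}$. Matroids are counted as labelled matroids on $[n]$. -}

module Defs where

open import Data.Bool.Base as Bool using (Bool; true; false; T)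
import Data.Bool.Properties as Bool
open import Data.Fin.Base using (Fin)
open import Data.Fin.Patterns
import Data.Fin.Properties as Fin
open import Data.Fin.Subset
open import Data.Fin.Subset.Properties
  using (_∈?_; _⊆?_; _⊂?_; nonempty?; anySubset?)
open import Data.Integer.Base using (+_)
open import Data.List.Base
  using (List; []; _∷_; length; map; filter; cartesianProductWith)
open import Data.List.Extrema.Nat using (max)
import Data.List.Membership.Setoid as Membership
import Data.List.Membership.Setoid.Properties as Membership
import Data.List.Membership.DecPropositional as DecMembership
open import Data.List.Relation.Unary.All using ([]; _∷_)
open import Data.List.Relation.Unary.AllPairs using ([]; _∷_)
open import Data.List.Relation.Unary.Any using (Any; here; there)
open import Data.List.Relation.Unary.Enumerates.Setoid using (IsEnumeration)
open import Data.List.Relation.Unary.Unique.Setoid using (Unique)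
import Data.List.Relation.Unary.Unique.Setoid.Properties as Unique
open import Data.Nat.Base as ℕ using (ℕ; zero; suc)
import Data.Nat.Properties as ℕ
open import Data.Product.Base using (∃; ∃₂; _×_; _,_)
open import Data.Rational.Base as ℚ using (ℚ; 0ℚ; _/_)
open import Data.Vec.Base using (Vec; []; _∷_; lookup; tabulate)
import Data.Vec.Properties as Vec
open import Function.Base using (_∘_)
open import Function.Bundles using (_⇔_; mk⇔)
open import Level using (0ℓ)
open import Relation.Binary.Bundles using (Setoid)
open import Relation.Binary.PropositionalEquality
  using (_≡_; refl; _→-setoid_)
open import Relation.Nullary.Decidable
  using (Dec; does; map′; ¬?; T?; _×-dec_; _→-dec_; decidable-stable)
open import Relation.Nullary.Negation using (¬_)
open import Relation.Unary using (Pred; Decidable)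

private variable
  k n : ℕ

------------------------------------------------------------------------
-- Decidability of quantification over finite types

allSubset? : {P : Pred (Subset n) 0ℓ} → Decidable P → Dec (∀ X → P X)
allSubset? P? = map′
  (λ ¬∃ X → decidable-stable (P? X) λ ¬PX → ¬∃ (X , ¬PX))
  (λ ∀P (X , ¬PX) → ¬PX (∀P X))
  (¬? (anySubset? (¬? ∘ P?)))

anyVec? : {P : Pred (Vec (Fin n) k) 0ℓ} → Decidable P → Dec (∃ P)
anyVec? {k = zero}  P? = map′ ([] ,_) (λ where ([] , p) → p) (P? [])
anyVec? {k = suc k} P? = map′
  (λ (x , xs , p) → x ∷ xs , p) (λ where (x ∷ xs , p) → x , xs , p)
  (Fin.any? λ x → anyVec? λ xs → P? (x ∷ xs))

_⇔-dec_ : {A B : Set} → Dec A → Dec B → Dec (A ⇔ B)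
a? ⇔-dec b? = map′ (λ (f , g) → mk⇔ f g) (λ e → to e , from e)
  ((a? →-dec b?) ×-dec (b? →-dec a?))
  where open Function.Bundles.Equivalence

------------------------------------------------------------------------
-- Matroids

-- A family of subsets of Fin n; for a matroid, its independent sets.
Family : ℕ → Set
Family n = Subset n → Bool

-- The ground set is allowed to be a proper subset of Fin n so that
-- minors keep the labels of their elements.
record SetSystem (n : ℕ) : Set where
  field
    ground : Subset n
    indep  : Family n

  Indep : Pred (Subset n) 0ℓ
  Indep X = T (indep X)

  Indep? : Decidable Indep
  Indep? X = T? (indep X)

open SetSystem public using (ground; indep)

onAll : Family n → SetSystem n
onAll F = record { ground = ⊤ ; indep = F }

subsets : ∀ n → List (Subset n)
subsets zero    = [] ∷ []
subsets (suc n) = cartesianProductWith _∷_ (outside ∷ inside ∷ []) (subsets n)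

module _ (M : SetSystem n) where
  open SetSystem M using (Indep; Indep?)

  record IsMatroid : Set where
    field
      support    : ∀ X → Indep X → X ⊆ ground M
      empty      : Indep ⊥
      hereditary : ∀ X Y → X ⊆ Y → Indep Y → Indep X
      augment    : ∀ X Y → Indep X → Indep Y → ∣ X ∣ ℕ.< ∣ Y ∣ →
                   ∃ λ e → e ∈ Y × e ∉ X × Indep (X ∪ ⁅ e ⁆)

  rank : Subset n → ℕ
  rank X = max 0 (map ∣_∣ (filter (λ Y → Y ⊆? X ×-dec Indep? Y) (subsets n)))

  IsSpanning : Pred (Subset n) 0ℓ
  IsSpanning X = rank X ≡ rank (ground M)

  IsCircuit : Pred (Subset n) 0ℓ
  IsCircuit C = C ⊆ ground M × ¬ Indep C × (∀ X → X ⊂ C → Indep X)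

  IsFlat : Pred (Subset n) 0ℓ
  IsFlat X = X ⊆ ground M ×
    (∀ e → e ∈ ground M → e ∉ X → rank X ℕ.< rank (X ∪ ⁅ e ⁆))

  IsHyperplane : Pred (Subset n) 0ℓ
  IsHyperplane H = IsFlat H × suc (rank H) ≡ rank (ground M)

  IsSparsePaving : Set
  IsSparsePaving = ∀ C → IsCircuit C → ¬ IsSpanning C → IsHyperplane C

  isMatroid? : Dec IsMatroid
  isMatroid? = map′
    (λ (s , e , h , a) →
      record { support = s ; empty = e ; hereditary = h ; augment = a })
    (λ m → let open IsMatroid m in support , empty , hereditary , augment)
    ( (allSubset? λ X → Indep? X →-dec X ⊆? ground M)
    ×-dec Indep? ⊥
    ×-dec (allSubset? λ X → allSubset? λ Y →
             X ⊆? Y →-dec (Indep? Y →-dec Indep? X))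
    ×-dec (allSubset? λ X → allSubset? λ Y →
             Indep? X →-dec (Indep? Y →-dec (∣ X ∣ ℕ.<? ∣ Y ∣ →-dec
               (Fin.any? λ e → e ∈? Y ×-dec (¬? (e ∈? X)
                 ×-dec Indep? (X ∪ ⁅ e ⁆))))))
    )

  isSpanning? : Decidable IsSpanning
  isSpanning? X = rank X ℕ.≟ rank (ground M)

  isCircuit? : Decidable IsCircuit
  isCircuit? C = C ⊆? ground M ×-dec (¬? (Indep? C)
    ×-dec (allSubset? λ X → X ⊂? C →-dec Indep? X))

  isFlat? : Decidable IsFlat
  isFlat? X = X ⊆? ground M ×-dec (Fin.all? λ e → e ∈? ground M →-dec
    (¬? (e ∈? X) →-dec (rank X ℕ.<? rank (X ∪ ⁅ e ⁆))))

  isHyperplane? : Decidable IsHyperplane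
  isHyperplane? H = isFlat? H ×-dec (suc (rank H) ℕ.≟ rank (ground M))

  isSparsePaving? : Dec IsSparsePaving
  isSparsePaving? = allSubset? λ C →
    isCircuit? C →-dec (¬? (isSpanning? C) →-dec isHyperplane? C)

------------------------------------------------------------------------
-- Minors

delete : SetSystem n → Subset n → SetSystem n
delete M D = record
  { ground = ground M ─ D
  ; indep  = λ X → does (X ⊆? (ground M ─ D) ×-dec SetSystem.Indep? M X)
  }

-- X is independent in M / C when r(X ∪ C) − r(C) = |X|.
contract : SetSystem n → Subset n → SetSystem n
contract M C = record
  { ground = ground M ─ C
  ; indep  = λ X → does (X ⊆? (ground M ─ C)
                           ×-dec (rank M (X ∪ C) ℕ.≟ ∣ X ∣ ℕ.+ rank M C))
  }

image : Vec (Fin n) k → Subset k → Subset n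
image φ X = tabulate λ y → does (Fin.any? λ i → i ∈? X ×-dec lookup φ i Fin.≟ y)

-- i ↦ lookup φ i is a bijection from Fin k onto the ground set of M that
-- carries N to M.  (Maps are given as vectors since finitely many of them
-- then exist up to _≡_.)
record IsIsomorphism (N : Family k) (M : SetSystem n) (φ : Vec (Fin n) k) : Set where
  field
    injective : ∀ i j → lookup φ i ≡ lookup φ j → i ≡ j
    onto      : ∀ y → y ∈ ground M ⇔ (∃ λ i → lookup φ i ≡ y)
    preserves : ∀ X → N X ≡ indep M (image φ X)

_≅_ : Family k → SetSystem n → Set
N ≅ M = ∃ λ φ → IsIsomorphism N M φ

HasMinor : Family n → Family k → Set
HasMinor F N = ∃₂ λ C D → Empty (C ∩ D) × N ≅ delete (contract (onAll F) C) D

isIsomorphism? : (N : Family k) (M : SetSystem n) → Decidable (IsIsomorphism N M)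
isIsomorphism? N M φ = map′
  (λ (i , o , p) → record { injective = i ; onto = o ; preserves = p })
  (λ m → let open IsIsomorphism m in injective , onto , preserves)
  ( (Fin.all? λ i → Fin.all? λ j → (lookup φ i Fin.≟ lookup φ j) →-dec (i Fin.≟ j))
  ×-dec (Fin.all? λ y → (y ∈? ground M)
           ⇔-dec (Fin.any? λ i → lookup φ i Fin.≟ y))
  ×-dec (allSubset? λ X → N X Bool.≟ indep M (image φ X))
  )

hasMinor? : (F : Family n) (N : Family k) → Dec (HasMinor F N)
hasMinor? F N = anySubset? λ C → anySubset? λ D →
  ¬? (nonempty? (C ∩ D)) ×-dec
  anyVec? (isIsomorphism? N (delete (contract (onAll F) C) D))

------------------------------------------------------------------------
-- 𝒲³ and M(K₄)

_∈Sets?_ : (X : Subset n) (Xs : List (Subset n)) → Dec (Any (X ≡_) Xs)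
_∈Sets?_ = DecMembership._∈?_ (Vec.≡-dec Bool._≟_)

⟨_,_,_⟩ : Fin n → Fin n → Fin n → Subset n
⟨ x , y , z ⟩ = ⁅ x ⁆ ∪ ⁅ y ⁆ ∪ ⁅ z ⁆

-- The rank-3 matroid whose dependent 3-sets are exactly the given ones:
-- sets of size above 3 are dependent and, for the lists used below, every
-- set of size below 3 lies in an independent 3-set.
rank3 : List (Subset n) → Family n
rank3 lines X = does (∣ X ∣ ℕ.≤? 3 ×-dec ¬? (X ∈Sets? lines))

-- The elements a, b, c, d, e, f are numbered 0, …, 5.
W³ : Family 6
W³ = rank3 (⟨ 0F , 1F , 2F ⟩ ∷ ⟨ 2F , 3F , 4F ⟩ ∷ ⟨ 4F , 5F , 0F ⟩ ∷ [])

MK₄ : Family 6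
MK₄ = rank3 (⟨ 0F , 1F , 2F ⟩ ∷ ⟨ 2F , 3F , 4F ⟩ ∷ ⟨ 4F , 5F , 0F ⟩ ∷
             ⟨ 1F , 3F , 5F ⟩ ∷ [])

------------------------------------------------------------------------
-- Counting

-- The family on Fin (suc n) whose members avoiding 0F are given by F and
-- whose members containing 0F are given by G.
join : Family n → Family n → Family (suc n)
join F G (outside ∷ X) = F X
join F G (inside  ∷ X) = G X

families : ∀ n → List (Family n)
families zero    = (λ _ → false) ∷ (λ _ → true) ∷ []
families (suc n) = cartesianProductWith join (families n) (families n)

count : {P : Pred (Family n) 0ℓ} → Decidable P → ℕ
count {n = n} P? = length (filter P? (families n))

-- Every family is listed in families exactly once, up to pointwise equality.

familySetoid : ℕ → Setoid 0ℓ 0ℓ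
familySetoid n = Subset n →-setoid Bool

families-complete : ∀ n → IsEnumeration (familySetoid n) (families n)
families-complete zero F with F [] in eq
... | false = here λ where [] → eq
... | true  = there (here λ where [] → eq)
families-complete (suc n) F = Membership.∈-resp-≈ (familySetoid (suc n))
  {x = join (F ∘ (outside ∷_)) (F ∘ (inside ∷_))} {y = F}
  (λ where (outside ∷ X) → refl
           (inside  ∷ X) → refl)
  (Membership.∈-cartesianProductWith⁺
    (familySetoid n) (familySetoid n) (familySetoid (suc n))
    (λ F≈F′ G≈G′ → λ where (outside ∷ X) → F≈F′ X
                           (inside  ∷ X) → G≈G′ X)
    (families-complete n (F ∘ (outside ∷_)))
    (families-complete n (F ∘ (inside ∷_))))

families-unique : ∀ n → Unique (familySetoid n) (families n)
families-unique zero    = ((λ f≈t → case-f≡t (f≈t [])) ∷ []) ∷ [] ∷ []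
  where
  case-f≡t : ¬ (false ≡ true)
  case-f≡t ()
families-unique (suc n) = Unique.cartesianProductWith⁺
  (familySetoid n) (familySetoid n) (familySetoid (suc n)) join
  (λ eq → (λ X → eq (outside ∷ X)) , (λ X → eq (inside ∷ X)))
  (families-unique n) (families-unique n)

-- 𝒳 = { 𝒲³ , M(K₄) }
IsXFreeMatroid : Pred (Family n) 0ℓ
IsXFreeMatroid F = IsMatroid (onAll F) × ¬ HasMinor F W³ × ¬ HasMinor F MK₄

isXFreeMatroid? : Decidable (IsXFreeMatroid {n})
isXFreeMatroid? F =
  isMatroid? (onAll F) ×-dec (¬? (hasMinor? F W³) ×-dec ¬? (hasMinor? F MK₄))

IsSparsePavingMatroid : Pred (Family n) 0ℓ
IsSparsePavingMatroid F = IsMatroid (onAll F) × IsSparsePaving (onAll F)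

isSparsePavingMatroid? : Decidable (IsSparsePavingMatroid {n})
isSparsePavingMatroid? F = isMatroid? (onAll F) ×-dec isSparsePaving? (onAll F)

mX : ℕ → ℕ
mX n = count {n} isXFreeMatroid?

s : ℕ → ℕ
s n = count {n} isSparsePavingMatroid?

------------------------------------------------------------------------
-- Asymptotics

infix 4 _=o_

_=o_ : (ℕ → ℕ) → (ℕ → ℕ) → Set
f =o g = ∀ (ε : ℚ) → 0ℚ ℚ.< ε → ∃ λ N → ∀ n → N ℕ.≤ n →
  + f n / 1 ℚ.≤ ε ℚ.* (+ g n / 1)

{-# OPTIONS --safe #-}

-- Choose one circuit for each flat spanned by a circuit. The flats and the
-- chosen circuits determine the matroid: X is dependent iff |X ∩ Y| exceeds the
-- rank of one of these flats Y. Two chosen circuits are never adjacent in a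
-- Johnson graph, and if three of them are adjacent to the same set Z, say
-- Z − xᵢ + yᵢ for i = 1, 2, 3, then contracting Z − x₁ − x₂ − x₃ turns them into
-- the sides of a triangle with corners xᵢ, that is, into a 𝒲³- or M(K₄)-minor.
-- So in a matroid without these minors every set has at most two chosen
-- neighbours, and double counting leaves O(2ⁿ/n²) chosen circuits C, as
-- |C| (n − |C|) is of order n² for all but O(2ⁿ/n²) sets C. Hence there are at
-- most 2^O(2ⁿ log n / n²) such matroids. On the other hand, the Graham–Sloane
-- codes (r-sets with given sum modulo n) give s(n)ⁿ ≥ 2^(n choose r), where
-- n choose r is of order 2ⁿ/√n for r = ⌈n/2⌉.

module Submission where

open import Defs

open import Data.Bool.Base using (Bool; true; false; T; not; _∧_; if_then_else_)
import Data.Bool.Properties as Bool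
open import Data.Bool.Properties using (T?; T-∧; not-involutive)
open import Data.Empty using (⊥-elim)
open import Data.Fin.Base using (Fin; zero; suc; toℕ)
open import Data.Fin.Patterns
import Data.Fin.Properties as Fin
open import Data.Fin.Subset
open import Data.Fin.Subset.Properties
import Data.Integer.Base as ℤ
import Data.Integer.Properties as ℤ
open import Data.List.Base
  using (List; []; _∷_; _++_; length; map; filter; cartesianProductWith; cartesianProduct; allFin; upTo; head)
import Data.List.Extrema.Nat as Extrema
open import Data.List.Membership.Propositional using (find) renaming (_∈_ to _∈ₗ_)
import Data.List.Membership.Propositional.Properties as ∈ₗ
import Data.List.Membership.Setoid as ∈S
import Data.List.Properties as List
open import Data.List.Relation.Unary.All as All using (All; []; _∷_)
import Data.List.Relation.Unary.All.Properties as AllP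
open import Data.List.Relation.Unary.AllPairs using ([]; _∷_)
open import Data.List.Relation.Unary.Any as Any using (Any; here; there; any?)
import Data.List.Relation.Unary.Any.Properties as AnyP
open import Data.List.Relation.Unary.Unique.Propositional using (Unique)
import Data.List.Relation.Unary.Unique.Propositional.Properties as Unique
import Data.List.Relation.Unary.Unique.Setoid as UniqueS
import Data.List.Relation.Unary.Unique.Setoid.Properties as UniqueSP
open import Data.Maybe.Base using (fromMaybe)
open import Data.Nat.Base hiding (∣_-_∣)
open import Data.Nat.DivMod using (m≡m%n+[m/n]*n; m%n<n; /-monoˡ-≤; m*n/n≡m; m/n*n≤m)
open import Data.Nat.Properties
open import Data.Nat.Tactic.RingSolver using (solve-∀)
open import Data.Product.Base using (∃; _×_; _,_; proj₁; proj₂)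
open import Data.Rational.Base as ℚ using (ℚ)
import Data.Rational.Properties as ℚ
import Data.Rational.Unnormalised.Base as ℚᵘ
import Data.Rational.Unnormalised.Properties as ℚᵘ
open import Data.Sum.Base using (_⊎_; inj₁; inj₂; [_,_]′)
open import Data.Vec.Base using (Vec; []; _∷_; lookup; tabulate; _[_]%=_; here; there)
import Data.Vec.Properties as Vec
import Data.Vec.Relation.Unary.All as VecAll
import Data.Vec.Relation.Unary.AllPairs as VecAllPairs
open import Data.Vec.Relation.Unary.Unique.Propositional using () renaming (Unique to VecUnique)
open import Data.Vec.Relation.Unary.Unique.Propositional.Properties using (lookup-injective)
open import Function.Base using (_∘_; id)
open import Function.Bundles using (mk⇔; module Equivalence)
open import Level using (0ℓ)
open import Relation.Binary.Bundles using (Setoid)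
open import Relation.Binary.Definitions using (tri<; tri≈; tri>)
open import Relation.Binary.PropositionalEquality
open import Relation.Nullary.Decidable hiding (map)
open import Relation.Nullary.Negation hiding (Stable; stable)
open import Relation.Unary using (Pred; Decidable)

-- One circuit per flat is chosen because the list of all circuits can be far too long: in a uniform
-- matroid every set of size one above the rank is a circuit, yet all of them span the same flat.
-- The price is that the flats must be recorded as well, since a closure cannot be computed from a
-- circuit without knowing the matroid; this only squares the number of codes. Non-adjacency alone
-- bounds the chosen circuits by O(2ⁿ/n), and codes of that size are too numerous to compete with
-- the exponent 2ⁿ/n^(3/2) of the lower bound. The excluded minors supply a second factor n, and the
-- remaining margin of √n / log n absorbs every constant. Logarithms and roots are kept out by
-- comparing powers of two, squares and n-th powers of natural numbers.

private variable
  n : ℕ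
  A B : Set

does⁺ : {P : Set} (P? : Dec P) → P → T (does P?)
does⁺ (yes _) _ = _
does⁺ (no ¬p) p = contradiction p ¬p

does⁻ : {P : Set} (P? : Dec P) → T (does P?) → P
does⁻ (yes p) _ = p

-- Indicators and finite sums over lists

𝟙 : Bool → ℕ
𝟙 false = 0
𝟙 true  = 1

∑ : List A → (A → ℕ) → ℕ
∑ []       f = 0
∑ (x ∷ xs) f = f x + ∑ xs f

∑-cong : ∀ (xs : List A) {f g} → (∀ x → f x ≡ g x) → ∑ xs f ≡ ∑ xs g
∑-cong []       f≗g = refl
∑-cong (x ∷ xs) f≗g = cong₂ _+_ (f≗g x) (∑-cong xs f≗g)

∑-mono : ∀ (xs : List A) {f g} → (∀ x → f x ≤ g x) → ∑ xs f ≤ ∑ xs g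
∑-mono []       f≤g = z≤n
∑-mono (x ∷ xs) f≤g = +-mono-≤ (f≤g x) (∑-mono xs f≤g)

∑-+ : ∀ (xs : List A) f g → ∑ xs (λ x → f x + g x) ≡ ∑ xs f + ∑ xs g
∑-+ []       f g = refl
∑-+ (x ∷ xs) f g = begin
  f x + g x + ∑ xs (λ x → f x + g x)  ≡⟨ cong (f x + g x +_) (∑-+ xs f g) ⟩
  f x + g x + (∑ xs f + ∑ xs g)       ≡⟨ shuffle (f x) (g x) (∑ xs f) (∑ xs g) ⟩
  f x + ∑ xs f + (g x + ∑ xs g)       ∎
  where
  open ≡-Reasoning
  shuffle : ∀ a b c d → a + b + (c + d) ≡ a + c + (b + d)
  shuffle = solve-∀

∑-*ˡ : ∀ (xs : List A) c f → ∑ xs (λ x → c * f x) ≡ c * ∑ xs f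
∑-*ˡ []       c f = sym (*-zeroʳ c)
∑-*ˡ (x ∷ xs) c f = trans (cong (c * f x +_) (∑-*ˡ xs c f)) (sym (*-distribˡ-+ c (f x) (∑ xs f)))

∑-*ʳ : ∀ (xs : List A) c f → ∑ xs (λ x → f x * c) ≡ ∑ xs f * c
∑-*ʳ []       c f = refl
∑-*ʳ (x ∷ xs) c f = trans (cong (f x * c +_) (∑-*ʳ xs c f)) (sym (*-distribʳ-+ c (f x) (∑ xs f)))

∑-const : ∀ (xs : List A) c → ∑ xs (λ _ → c) ≡ length xs * c
∑-const []       c = refl
∑-const (x ∷ xs) c = cong (c +_) (∑-const xs c)

∑-++ : ∀ (xs ys : List A) f → ∑ (xs ++ ys) f ≡ ∑ xs f + ∑ ys f
∑-++ []       ys f = refl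
∑-++ (x ∷ xs) ys f = trans (cong (f x +_) (∑-++ xs ys f)) (sym (+-assoc (f x) _ _))

∑-map : ∀ (g : A → B) xs f → ∑ (map g xs) f ≡ ∑ xs (f ∘ g)
∑-map g []       f = refl
∑-map g (x ∷ xs) f = cong (f (g x) +_) (∑-map g xs f)

∑-swap : ∀ (xs : List A) (ys : List B) (f : A → B → ℕ) →
         ∑ xs (λ x → ∑ ys (f x)) ≡ ∑ ys (λ y → ∑ xs (λ x → f x y))
∑-swap []       ys f = sym (trans (∑-const ys 0) (*-zeroʳ (length ys)))
∑-swap (x ∷ xs) ys f = trans (cong (∑ ys (f x) +_) (∑-swap xs ys f))
                             (sym (∑-+ ys (f x) (λ y → ∑ xs (λ x → f x y))))

∑-cartesianProductWith : ∀ {C : Set} (g : A → B → C) xs ys f →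
  ∑ (cartesianProductWith g xs ys) f ≡ ∑ xs (λ x → ∑ ys (λ y → f (g x y)))
∑-cartesianProductWith g []       ys f = refl
∑-cartesianProductWith g (x ∷ xs) ys f = trans
  (∑-++ (map (g x) ys) (cartesianProductWith g xs ys) f)
  (cong₂ _+_ (∑-map (g x) ys f) (∑-cartesianProductWith g xs ys f))

∑-𝟙 : ∀ {P : Pred A 0ℓ} (P? : Decidable P) xs → ∑ xs (𝟙 ∘ does ∘ P?) ≡ length (filter P? xs)
∑-𝟙 P? []       = refl
∑-𝟙 P? (x ∷ xs) with does (P? x)
... | true  = cong suc (∑-𝟙 P? xs)
... | false = ∑-𝟙 P? xs

-- Comparing the lengths of duplicate-free lists

module _ (S : Setoid 0ℓ 0ℓ) where
  open Setoid S using (_≈_) renaming (Carrier to X; sym to ≈-sym; trans to ≈-trans)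
  open ∈S S using () renaming (_∈_ to _∈ˢ_)

  private
    remove : ∀ {x} {ys : List X} → x ∈ˢ ys → List X
    remove {ys = y ∷ ys} (here _)  = ys
    remove {ys = y ∷ ys} (there i) = y ∷ remove i

    length-remove : ∀ {x} {ys : List X} (i : x ∈ˢ ys) → length ys ≡ suc (length (remove i))
    length-remove (here _)  = refl
    length-remove (there i) = cong suc (length-remove i)

    ∈-remove : ∀ {x z} {ys : List X} (i : x ∈ˢ ys) → ¬ (x ≈ z) → z ∈ˢ ys → z ∈ˢ remove i
    ∈-remove (here x≈y) x≉z (here z≈y) = contradiction (≈-trans x≈y (≈-sym z≈y)) x≉z
    ∈-remove (here x≈y) x≉z (there j)  = j
    ∈-remove (there i)  x≉z (here z≈y) = here z≈y
    ∈-remove (there i)  x≉z (there j)  = there (∈-remove i x≉z j)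

  -- Each entry of `xs` uses up its own entry of `ys`. The setoid is there because families are
  -- functions, listed only up to pointwise equality.
  unique-length-≤ : ∀ {xs ys : List X} → UniqueS.Unique S xs →
                    (∀ {x} → x ∈ₗ xs → x ∈ˢ ys) → length xs ≤ length ys
  unique-length-≤ {[]}     []         xs⊆ys = z≤n
  unique-length-≤ {x ∷ xs} (x∉ ∷ uxs) xs⊆ys = subst (suc (length xs) ≤_)
    (sym (length-remove i))
    (s≤s (unique-length-≤ uxs λ z∈xs →
      ∈-remove i (All.lookup x∉ z∈xs) (xs⊆ys (there z∈xs))))
    where i = xs⊆ys (here refl)

at-most-two : ∀ {xs : List A} → Unique xs → (b : A → Bool) →
  (∀ x y z → x ≢ y → x ≢ z → y ≢ z → T (b x) → T (b y) → ¬ T (b z)) →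
  ∑ xs (𝟙 ∘ b) ≤ 2
at-most-two {A = A} {xs} uxs b ¬three = subst (_≤ 2) (sym (∑-𝟙 (T? ∘ b) xs))
  (go (filter (T? ∘ b) xs) (Unique.filter⁺ (T? ∘ b) uxs) (AllP.all-filter (T? ∘ b) xs))
  where
  go : (ys : List A) → Unique ys → All (T ∘ b) ys → length ys ≤ 2
  go []          _ _ = z≤n
  go (_ ∷ [])     _ _ = s≤s z≤n
  go (_ ∷ _ ∷ []) _ _ = s≤s (s≤s z≤n)
  go (x ∷ y ∷ z ∷ _) ((x≢y ∷ x≢z ∷ _) ∷ (y≢z ∷ _) ∷ _) (bx ∷ by ∷ bz ∷ _) =
    contradiction bz (¬three x y z x≢y x≢z y≢z bx by)

-- Sums over all subsets

∑-subsets : ∀ (f : Subset (suc n) → ℕ) → ∑ (subsets (suc n)) f ≡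
            ∑ (subsets n) (f ∘ (outside ∷_)) + ∑ (subsets n) (f ∘ (inside ∷_))
∑-subsets {n} f = trans (∑-cartesianProductWith _∷_ (outside ∷ inside ∷ []) (subsets n) f)
  (cong (∑ (subsets n) (f ∘ (outside ∷_)) +_) (+-identityʳ _))

∈-subsets : ∀ (X : Subset n) → X ∈ₗ subsets n
∈-subsets []      = here refl
∈-subsets {suc n} (b ∷ X) = ∈ₗ.∈-cartesianProductWith⁺ _∷_ {xs = outside ∷ inside ∷ []} {ys = subsets n} (side b) (∈-subsets X)
  where
  side : ∀ b → b ∈ₗ (outside ∷ inside ∷ [])
  side false = here refl
  side true  = there (here refl)

subsets-unique : ∀ n → Unique (subsets n)
subsets-unique zero    = [] ∷ []
subsets-unique (suc n) = Unique.cartesianProductWith⁺ _∷_ Vec.∷-injective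
  (((λ ()) ∷ []) ∷ [] ∷ []) (subsets-unique n)

length-subsets : ∀ n → length (subsets n) ≡ 2 ^ n
length-subsets zero    = refl
length-subsets (suc n) = trans (List.length-++ (map (outside ∷_) (subsets n)))
  (cong₂ _+_ (half outside) (trans (List.length-++ (map (inside ∷_) (subsets n))) (cong (_+ 0) (half inside))))
  where
  half : ∀ b → length (map (b ∷_) (subsets n)) ≡ 2 ^ n
  half b = trans (List.length-map (b ∷_) (subsets n)) (length-subsets n)

∑-subsets-flip : ∀ (x : Fin n) (f : Subset n → ℕ) →
  ∑ (subsets n) (λ X → f (X [ x ]%= not)) ≡ ∑ (subsets n) f
∑-subsets-flip {suc n} zero    f = begin
  ∑ (subsets (suc n)) (λ X → f (X [ zero ]%= not))
    ≡⟨ ∑-subsets {n} (λ X → f (X [ zero ]%= not)) ⟩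
  ∑ (subsets n) (f ∘ (inside ∷_)) + ∑ (subsets n) (f ∘ (outside ∷_))
    ≡⟨ +-comm (∑ (subsets n) (f ∘ (inside ∷_))) _ ⟩
  ∑ (subsets n) (f ∘ (outside ∷_)) + ∑ (subsets n) (f ∘ (inside ∷_))
    ≡⟨ ∑-subsets f ⟨
  ∑ (subsets (suc n)) f ∎
  where open ≡-Reasoning
∑-subsets-flip {suc n} (suc x) f = begin
  ∑ (subsets (suc n)) (λ X → f (X [ suc x ]%= not))
    ≡⟨ ∑-subsets {n} (λ X → f (X [ suc x ]%= not)) ⟩
  ∑ (subsets n) (λ X → f (outside ∷ (X [ x ]%= not))) +
  ∑ (subsets n) (λ X → f (inside ∷ (X [ x ]%= not)))
    ≡⟨ cong₂ _+_ (∑-subsets-flip x (f ∘ (outside ∷_))) (∑-subsets-flip x (f ∘ (inside ∷_))) ⟩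
  ∑ (subsets n) (f ∘ (outside ∷_)) + ∑ (subsets n) (f ∘ (inside ∷_))
    ≡⟨ ∑-subsets f ⟨
  ∑ (subsets (suc n)) f ∎
  where open ≡-Reasoning

size : Family n → ℕ
size {n} F = ∑ (subsets n) (𝟙 ∘ F)

size≡length : ∀ (F : Family n) → size F ≡ length (filter (T? ∘ F) (subsets n))
size≡length {n} F = ∑-𝟙 (T? ∘ F) (subsets n)

∑-families : ∀ (f : Family (suc n) → ℕ) → ∑ (families (suc n)) f ≡
             ∑ (families n) (λ F → ∑ (families n) (λ G → f (join F G)))
∑-families {n} = ∑-cartesianProductWith join (families n) (families n)

-- Counting small families

cosize : Family n → ℕ
cosize {n} F = ∑ (subsets n) (𝟙 ∘ not ∘ F)

size+cosize : ∀ (F : Family n) → size F + cosize F ≡ 2 ^ n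
size+cosize {n} F = begin
  size F + cosize F                               ≡⟨ ∑-+ (subsets n) (𝟙 ∘ F) (𝟙 ∘ not ∘ F) ⟨
  ∑ (subsets n) (λ X → 𝟙 (F X) + 𝟙 (not (F X)))  ≡⟨ ∑-cong (subsets n) (λ X → one (F X)) ⟩
  ∑ (subsets n) (λ _ → 1)                         ≡⟨ ∑-const (subsets n) 1 ⟩
  length (subsets n) * 1                          ≡⟨ *-identityʳ _ ⟩
  length (subsets n)                              ≡⟨ length-subsets n ⟩
  2 ^ n                                           ∎
  where
  open ≡-Reasoning
  one : ∀ b → 𝟙 b + 𝟙 (not b) ≡ 1
  one false = refl
  one true  = refl

-- The binomial theorem: each of the 2ⁿ subsets is a member, with weight 1, or a non-member, with
-- weight `q`.
∑-families-cosize : ∀ q n → ∑ (families n) (λ F → q ^ cosize F) ≡ suc q ^ (2 ^ n)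
∑-families-cosize q zero    = lemma q
  where
  lemma : ∀ q → q * 1 + 1 ≡ (1 + q) * 1
  lemma = solve-∀
∑-families-cosize q (suc n) = begin
  ∑ (families (suc n)) (λ F → q ^ cosize F)
    ≡⟨ ∑-families {n} (λ F → q ^ cosize F) ⟩
  ∑ (families n) (λ F → ∑ (families n) (λ G → q ^ cosize (join F G)))
    ≡⟨ ∑-cong (families n) (λ F → trans (∑-cong (families n) (split F)) (∑-*ˡ (families n) (q ^ cosize F) _)) ⟩
  ∑ (families n) (λ F → q ^ cosize F * ∑ (families n) (λ G → q ^ cosize G))
    ≡⟨ ∑-*ʳ (families n) _ (λ F → q ^ cosize F) ⟩
  ∑ (families n) (λ F → q ^ cosize F) * ∑ (families n) (λ G → q ^ cosize G)
    ≡⟨ cong₂ _*_ (∑-families-cosize q n) (∑-families-cosize q n) ⟩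
  suc q ^ (2 ^ n) * suc q ^ (2 ^ n)
    ≡⟨ ^-distribˡ-+-* (suc q) (2 ^ n) (2 ^ n) ⟨
  suc q ^ (2 ^ n + 2 ^ n)
    ≡⟨ cong (λ m → suc q ^ (2 ^ n + m)) (+-identityʳ (2 ^ n)) ⟨
  suc q ^ (2 ^ suc n) ∎
  where
  open ≡-Reasoning
  split : ∀ F G → q ^ cosize (join F G) ≡ q ^ cosize F * q ^ cosize G
  split F G = trans (cong (q ^_) (∑-subsets (𝟙 ∘ not ∘ join F G))) (^-distribˡ-+-* q (cosize F) (cosize G))

smallFamilies : ∀ n k → List (Family n)
smallFamilies n k = filter (λ F → size F ≤? k) (families n)

-- Markov's inequality for the weight `q ^ cosize F`: a family with at most `k` members weighs at
-- least q^(2ⁿ - k), and the total weight is known.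
smallFamilies-weight : ∀ n k q .{{_ : NonZero q}} →
  length (smallFamilies n k) * q ^ (2 ^ n) ≤ suc q ^ (2 ^ n) * q ^ k
smallFamilies-weight n k q = begin
  length (smallFamilies n k) * q ^ (2 ^ n)
    -- Only an inequality, since `k` may exceed 2ⁿ and the subtraction is truncated.
    ≤⟨ *-monoʳ-≤ (length (smallFamilies n k)) (^-monoʳ-≤ q (m≤n+m∸n (2 ^ n) k)) ⟩
  length (smallFamilies n k) * q ^ (k + (2 ^ n ∸ k))
    ≡⟨ cong (_* q ^ (k + (2 ^ n ∸ k))) (∑-𝟙 (λ F → size F ≤? k) (families n)) ⟨
  ∑ (families n) (λ F → 𝟙 (does (size F ≤? k))) * q ^ (k + (2 ^ n ∸ k))
    ≡⟨ ∑-*ʳ (families n) _ _ ⟨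
  ∑ (families n) (λ F → 𝟙 (does (size F ≤? k)) * q ^ (k + (2 ^ n ∸ k)))
    ≤⟨ ∑-mono (families n) term ⟩
  ∑ (families n) (λ F → q ^ cosize F * q ^ k)
    ≡⟨ ∑-*ʳ (families n) (q ^ k) _ ⟩
  ∑ (families n) (λ F → q ^ cosize F) * q ^ k
    ≡⟨ cong (_* q ^ k) (∑-families-cosize q n) ⟩
  suc q ^ (2 ^ n) * q ^ k ∎
  where
  open ≤-Reasoning
  term : ∀ F → 𝟙 (does (size F ≤? k)) * q ^ (k + (2 ^ n ∸ k)) ≤ q ^ cosize F * q ^ k
  when : ∀ {P : Set} (P? : Dec P) {a b} → (P → a ≤ b) → 𝟙 (does P?) * a ≤ b
  when (yes p) {a} a≤b = ≤-trans (≤-reflexive (*-identityˡ a)) (a≤b p)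
  when (no _)      a≤b = z≤n
  term F = when (size F ≤? k) λ F≤k → begin
    q ^ (k + (2 ^ n ∸ k))      ≡⟨ cong (q ^_) (+-comm k _) ⟩
    q ^ (2 ^ n ∸ k + k)        ≡⟨ ^-distribˡ-+-* q (2 ^ n ∸ k) k ⟩
    q ^ (2 ^ n ∸ k) * q ^ k    ≤⟨ *-monoˡ-≤ (q ^ k) (^-monoʳ-≤ q (cosize≥ F F≤k)) ⟩
    q ^ cosize F * q ^ k       ∎
    where
    cosize≥ : ∀ F → size F ≤ k → 2 ^ n ∸ k ≤ cosize F
    cosize≥ F F≤k = m≤n+o⇒m∸n≤o (2 ^ n) k (subst (_≤ k + cosize F) (size+cosize F) (+-monoˡ-≤ (cosize F) F≤k))

-- Bernoulli's inequality (1 − 1/(q + 1))^h ≥ 1 − h/(q + 1) without fractions.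
bernoulli : ∀ q h → suc q * suc q ^ h ≤ suc q * q ^ h + h * suc q ^ h
bernoulli q zero    = ≤-reflexive (sym (+-identityʳ _))
bernoulli q (suc h) = begin
  suc q * (suc q * suc q ^ h)
    ≤⟨ *-monoʳ-≤ (suc q) (bernoulli q h) ⟩
  suc q * (suc q * q ^ h + h * suc q ^ h)
    ≡⟨ expand q (q ^ h) h (suc q ^ h) ⟩
  suc q * (q * q ^ h) + (suc q * q ^ h + h * (suc q * suc q ^ h))
    ≤⟨ +-monoʳ-≤ (suc q * (q * q ^ h))
         (+-monoˡ-≤ (h * (suc q * suc q ^ h)) (*-monoʳ-≤ (suc q) (^-monoˡ-≤ h (n≤1+n q)))) ⟩
  suc q * (q * q ^ h) + suc h * (suc q * suc q ^ h) ∎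
  where
  open ≤-Reasoning
  expand : ∀ q a h b → suc q * (suc q * a + h * b) ≡ suc q * (q * a) + (suc q * a + h * (suc q * b))
  expand = solve-∀

-- (1 + 1/q)^h ≤ 2 for h ≤ (q + 1)/2.
suc^≤2*^ : ∀ q h → 2 * h ≤ suc q → suc q ^ h ≤ 2 * q ^ h
suc^≤2*^ q h 2h≤ = *-cancelˡ-≤ (suc q) (+-cancelʳ-≤ (suc q * suc q ^ h) _ _ (begin
  suc q * suc q ^ h + suc q * suc q ^ h
    ≡⟨ double (suc q * suc q ^ h) ⟩
  2 * (suc q * suc q ^ h)
    ≤⟨ *-monoʳ-≤ 2 (bernoulli q h) ⟩
  2 * (suc q * q ^ h + h * suc q ^ h)
    ≡⟨ expand (suc q) (q ^ h) h (suc q ^ h) ⟩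
  suc q * (2 * q ^ h) + 2 * h * suc q ^ h
    ≤⟨ +-monoʳ-≤ (suc q * (2 * q ^ h)) (*-monoˡ-≤ (suc q ^ h) 2h≤) ⟩
  suc q * (2 * q ^ h) + suc q * suc q ^ h ∎))
  where
  open ≤-Reasoning
  double : ∀ a → a + a ≡ 2 * a
  double = solve-∀
  expand : ∀ a b c d → 2 * (a * b + c * d) ≡ a * (2 * b) + 2 * c * d
  expand = solve-∀

-- Take q = 2^(a + 1) in the weight bound. As (1 + 1/q)^(2^a) ≤ 2, the 2ⁿ factors 1 + 1/q contribute
-- at most 2^(2^(n - a)); the rest is q^k. The parameter `a` balances the two and will be about 2
-- log n.
length-smallFamilies : ∀ n k a → a ≤ n →
  length (smallFamilies n k) ≤ 2 ^ (2 ^ (n ∸ a) + suc a * k)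
length-smallFamilies n k a a≤n = *-cancelʳ-≤ _ _ (q ^ (2 ^ n)) {{m^n≢0 q (2 ^ n) {{q≢0}}}} (begin
  length (smallFamilies n k) * q ^ (2 ^ n)
    ≤⟨ smallFamilies-weight n k q {{q≢0}} ⟩
  suc q ^ (2 ^ n) * q ^ k
    ≡⟨ cong (λ m → suc q ^ m * q ^ k) 2^n≡ ⟩
  suc q ^ (2 ^ a * 2 ^ (n ∸ a)) * q ^ k
    ≡⟨ cong (_* q ^ k) (^-*-assoc (suc q) (2 ^ a) (2 ^ (n ∸ a))) ⟨
  (suc q ^ (2 ^ a)) ^ (2 ^ (n ∸ a)) * q ^ k
    ≤⟨ *-monoˡ-≤ (q ^ k) (^-monoˡ-≤ (2 ^ (n ∸ a)) (suc^≤2*^ q (2 ^ a) (n≤1+n q))) ⟩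
  (2 * q ^ (2 ^ a)) ^ (2 ^ (n ∸ a)) * q ^ k
    ≡⟨ cong (_* q ^ k) (^-distribʳ-* (2 ^ (n ∸ a)) 2 (q ^ (2 ^ a))) ⟩
  2 ^ (2 ^ (n ∸ a)) * (q ^ (2 ^ a)) ^ (2 ^ (n ∸ a)) * q ^ k
    ≡⟨ cong (λ m → 2 ^ (2 ^ (n ∸ a)) * m * q ^ k)
         (trans (^-*-assoc q (2 ^ a) (2 ^ (n ∸ a))) (cong (q ^_) (sym 2^n≡))) ⟩
  2 ^ (2 ^ (n ∸ a)) * q ^ (2 ^ n) * q ^ k
    ≡⟨ shuffle (2 ^ (2 ^ (n ∸ a))) (q ^ (2 ^ n)) (q ^ k) ⟩
  2 ^ (2 ^ (n ∸ a)) * q ^ k * q ^ (2 ^ n)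
    ≡⟨ cong (λ m → 2 ^ (2 ^ (n ∸ a)) * m * q ^ (2 ^ n)) (^-*-assoc 2 (suc a) k) ⟩
  2 ^ (2 ^ (n ∸ a)) * 2 ^ (suc a * k) * q ^ (2 ^ n)
    ≡⟨ cong (_* q ^ (2 ^ n)) (^-distribˡ-+-* 2 (2 ^ (n ∸ a)) (suc a * k)) ⟨
  2 ^ (2 ^ (n ∸ a) + suc a * k) * q ^ (2 ^ n) ∎)
  where
  open ≤-Reasoning
  q = 2 ^ suc a
  q≢0 : NonZero q
  q≢0 = m^n≢0 2 (suc a)
  2^n≡ : 2 ^ n ≡ 2 ^ a * 2 ^ (n ∸ a)
  2^n≡ = trans (cong (2 ^_) (sym (m+[n∸m]≡n a≤n))) (^-distribˡ-+-* 2 a (n ∸ a))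
  shuffle : ∀ a b c → a * b * c ≡ a * c * b
  shuffle = solve-∀
  ^-distribʳ-* : ∀ m x y → (x * y) ^ m ≡ x ^ m * y ^ m
  ^-distribʳ-* zero    x y = refl
  ^-distribʳ-* (suc m) x y = trans (cong (x * y *_) (^-distribʳ-* m x y)) (sh x y (x ^ m) (y ^ m))
    where
    sh : ∀ x y a b → x * y * (a * b) ≡ x * a * (y * b)
    sh = solve-∀

-- Growth rates

m*n≤o⇒m≤o/n : ∀ m n o .{{_ : NonZero n}} → m * n ≤ o → m ≤ o / n
m*n≤o⇒m≤o/n m n o le = subst (_≤ o / n) (m*n/n≡m m n) (/-monoˡ-≤ n le)

m<2^m : ∀ m → m < 2 ^ m
m<2^m zero    = s≤s z≤n
m<2^m (suc m) = +-mono-≤ (m^n>0 2 m) (subst (suc m ≤_) (sym (+-identityʳ (2 ^ m))) (m<2^m m))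

-- With h = ⌊l/4⌋, the bound l ≤ 4 · 2^h makes l² at most 2^(4 + 2h), and the remaining exponent
-- pays for c ≤ 2^c once h ≥ c + 4.
square≤2^ : ∀ c → ∃ λ N → ∀ l → N ≤ l → c * (l * l) ≤ 2 ^ l
square≤2^ c = (c + 4) * 4 , λ l N≤l → let h = l / 4 in begin
  c * (l * l)
    ≤⟨ *-mono-≤ (<⇒≤ (m<2^m c)) (*-mono-≤ (l≤ l) (l≤ l)) ⟩
  2 ^ c * (4 * 2 ^ h * (4 * 2 ^ h))
    ≡⟨ shuffle (2 ^ c) (2 ^ h) ⟩
  2 ^ c * (2 ^ 4 * (2 ^ h * 2 ^ h))
    ≡⟨ cong (λ m → 2 ^ c * (2 ^ 4 * m)) (^-distribˡ-+-* 2 h h) ⟨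
  2 ^ c * (2 ^ 4 * 2 ^ (h + h))
    ≡⟨ cong (2 ^ c *_) (^-distribˡ-+-* 2 4 (h + h)) ⟨
  2 ^ c * 2 ^ (4 + (h + h))
    ≡⟨ ^-distribˡ-+-* 2 c (4 + (h + h)) ⟨
  2 ^ (c + (4 + (h + h)))
    ≤⟨ ^-monoʳ-≤ 2 (exponent l N≤l) ⟩
  2 ^ l ∎
  where
  open ≤-Reasoning
  shuffle : ∀ a b → a * (4 * b * (4 * b)) ≡ a * (16 * (b * b))
  shuffle = solve-∀
  l≤ : ∀ l → l ≤ 4 * 2 ^ (l / 4)
  l≤ l = begin
    l                         ≡⟨ m≡m%n+[m/n]*n l 4 ⟩
    l % 4 + l / 4 * 4         ≤⟨ +-monoˡ-≤ (l / 4 * 4) (<⇒≤ (m%n<n l 4)) ⟩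
    suc (l / 4) * 4           ≤⟨ *-monoˡ-≤ 4 (m<2^m (l / 4)) ⟩
    2 ^ (l / 4) * 4           ≡⟨ *-comm (2 ^ (l / 4)) 4 ⟩
    4 * 2 ^ (l / 4)           ∎
  exponent : ∀ l → (c + 4) * 4 ≤ l → c + (4 + (l / 4 + l / 4)) ≤ l
  exponent l N≤l = begin
    c + (4 + (h + h))      ≡⟨ +-assoc c 4 (h + h) ⟨
    c + 4 + (h + h)        ≤⟨ +-monoˡ-≤ (h + h) (m*n≤o⇒m≤o/n (c + 4) 4 l N≤l) ⟩
    h + (h + h)            ≤⟨ m≤n+m (h + (h + h)) h ⟩
    h + (h + (h + h))      ≡⟨ four h ⟩
    h * 4                  ≤⟨ m/n*n≤m l 4 ⟩
    l                      ∎
    where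
    h = l / 4
    four : ∀ h → h + (h + (h + h)) ≡ h * 4
    four = solve-∀

between-powers : ∀ n .{{_ : NonZero n}} → ∃ λ l → n ≤ 2 ^ l × 2 ^ l ≤ 2 * n
between-powers 1             = 0 , ≤-refl , s≤s z≤n
between-powers (suc n@(suc _)) with between-powers n
... | l , n≤ , ≤2n with suc n ≤? 2 ^ l
...   | yes 1+n≤ = l , 1+n≤ , ≤-trans ≤2n (*-monoʳ-≤ 2 (n≤1+n n))
...   | no  1+n≰ = suc l , +-mono-≤ (m^n>0 2 l) (≤-trans n≤ (m≤m+n (2 ^ l) 0))
                 , *-monoʳ-≤ 2 (<⇒≤ (≰⇒> 1+n≰))

m*m-cancel-≤ : ∀ {a b} → a * a ≤ b * b → a ≤ b
m*m-cancel-≤ a²≤b² = ≮⇒≥ λ b<a → <⇒≱ (*-mono-< b<a b<a) a²≤b²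

^-cancelˡ-≤ : ∀ n .{{_ : NonZero n}} {a b} → a ^ n ≤ b ^ n → a ≤ b
^-cancelˡ-≤ n aⁿ≤bⁿ = ≮⇒≥ λ b<a → <⇒≱ (^-monoˡ-< n b<a) aⁿ≤bⁿ

^-cancelʳ-≤ : ∀ m {a b} → 1 < m → m ^ a ≤ m ^ b → a ≤ b
^-cancelʳ-≤ m 1<m mᵃ≤mᵇ = ≮⇒≥ λ b<a → <⇒≱ (^-monoʳ-< m 1<m b<a) mᵃ≤mᵇ

-- Both sides of the final comparison are powers of two; the exponents are
-- of order 2ⁿ log n / n² and 2ⁿ / n^(3/2), respectively.
module _ (K t D : ℕ) (D≡ : D ≡ 3 + 6 * K) where
  private
    N₁ = proj₁ (square≤2^ (2 * (8 * (D * D))))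
    N₂ = proj₁ (square≤2^ t)

  -- For n ≤ 2^l the first summand yields l > N₁, hence also l ≥ 1; the second yields t n² ≤ 2ⁿ.
  threshold : ℕ
  threshold = 2 ^ suc N₁ + N₂

  code≤labels : ∀ n k x s b → threshold ≤ n → k * (n * n) ≤ K * 2 ^ n →
    (∀ a → a ≤ n → x ≤ 2 ^ (2 ^ (n ∸ a) + suc a * k)) →
    2 ^ b ≤ s ^ n → 2 ^ n * 2 ^ n ≤ 8 * n * (b * b) → t * (x * x) ≤ s
  code≤labels n k x s b N≤n k-small x≤ s-large b-large = ^-cancelˡ-≤ n {{n≢0}} (begin
    (t * (x * x)) ^ n            ≤⟨ ^-monoˡ-≤ n (*-mono-≤ (<⇒≤ (m<2^m t)) (*-mono-≤ x≤2^e x≤2^e)) ⟩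
    (2 ^ t * (2 ^ e * 2 ^ e)) ^ n  ≡⟨ cong (λ m → (2 ^ t * m) ^ n) (^-distribˡ-+-* 2 e e) ⟨
    (2 ^ t * 2 ^ (e + e)) ^ n    ≡⟨ cong (_^ n) (^-distribˡ-+-* 2 t (e + e)) ⟨
    (2 ^ (t + (e + e))) ^ n      ≡⟨ ^-*-assoc 2 (t + (e + e)) n ⟩
    2 ^ ((t + (e + e)) * n)      ≤⟨ ^-monoʳ-≤ 2 exponent ⟩
    2 ^ b                        ≤⟨ s-large ⟩
    s ^ n                        ∎)
    where
    open ≤-Reasoning
    2^N₁≤n : 2 ^ suc N₁ ≤ n
    2^N₁≤n = ≤-trans (m≤m+n _ N₂) N≤n

    n≢0 : NonZero n
    n≢0 = >-nonZero (≤-trans (m^n>0 2 (suc N₁)) 2^N₁≤n)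

    l = proj₁ (between-powers n {{n≢0}})
    n≤2^l = proj₁ (proj₂ (between-powers n {{n≢0}}))
    2^l≤2n = proj₂ (proj₂ (between-powers n {{n≢0}}))

    N₁<l : N₁ < l
    N₁<l = ^-cancelʳ-≤ 2 (s≤s (s≤s z≤n)) (≤-trans 2^N₁≤n n≤2^l)

    1≤l : 1 ≤ l
    1≤l = ≤-trans (s≤s z≤n) N₁<l

    8D²l²≤n : 8 * (D * D) * (l * l) ≤ n
    8D²l²≤n = *-cancelˡ-≤ 2 (begin
      2 * (8 * (D * D) * (l * l))  ≡⟨ *-assoc 2 (8 * (D * D)) (l * l) ⟨
      2 * (8 * (D * D)) * (l * l)  ≤⟨ proj₂ (square≤2^ (2 * (8 * (D * D)))) l (<⇒≤ N₁<l) ⟩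
      2 ^ l                        ≤⟨ 2^l≤2n ⟩
      2 * n                        ∎)

    2l≤n : l + l ≤ n
    2l≤n = begin
      l + l                     ≡⟨ cong (l +_) (+-identityʳ l) ⟨
      2 * l                     ≤⟨ *-mono-≤ 2≤8D² (m≤m*n l l {{>-nonZero 1≤l}}) ⟩
      8 * (D * D) * (l * l)     ≤⟨ 8D²l²≤n ⟩
      n                         ∎
      where
      D≢0 : NonZero D
      D≢0 = subst NonZero (sym D≡) _
      2≤8D² : 2 ≤ 8 * (D * D)
      2≤8D² = ≤-trans (s≤s (s≤s z≤n)) (m≤m*n 8 (D * D) {{m*n≢0 D D {{D≢0}} {{D≢0}}}})

    -- The choice a = 2l makes 2^(n - a) at most 2ⁿ/n², because n ≤ 2^l.
    e = 2 ^ (n ∸ (l + l)) + suc (l + l) * k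

    x≤2^e : x ≤ 2 ^ e
    x≤2^e = x≤ (l + l) 2l≤n

    e-small : e * (n * n) ≤ 2 ^ n * (l * (1 + 3 * K))
    e-small = begin
      e * (n * n)
        ≡⟨ *-distribʳ-+ (n * n) (2 ^ (n ∸ (l + l))) (suc (l + l) * k) ⟩
      2 ^ (n ∸ (l + l)) * (n * n) + suc (l + l) * k * (n * n)
        ≤⟨ +-mono-≤ (*-monoʳ-≤ (2 ^ (n ∸ (l + l))) (*-mono-≤ n≤2^l n≤2^l))
                    (≤-trans (≤-reflexive (*-assoc (suc (l + l)) k (n * n)))
                             (*-monoʳ-≤ (suc (l + l)) k-small)) ⟩
      2 ^ (n ∸ (l + l)) * (2 ^ l * 2 ^ l) + suc (l + l) * (K * 2 ^ n)
        ≡⟨ cong (λ m → 2 ^ (n ∸ (l + l)) * m + suc (l + l) * (K * 2 ^ n)) (^-distribˡ-+-* 2 l l) ⟨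
      2 ^ (n ∸ (l + l)) * 2 ^ (l + l) + suc (l + l) * (K * 2 ^ n)
        ≡⟨ cong (_+ suc (l + l) * (K * 2 ^ n)) (^-distribˡ-+-* 2 (n ∸ (l + l)) (l + l)) ⟨
      2 ^ (n ∸ (l + l) + (l + l)) + suc (l + l) * (K * 2 ^ n)
        ≡⟨ cong (λ m → 2 ^ m + suc (l + l) * (K * 2 ^ n)) (m∸n+n≡m 2l≤n) ⟩
      2 ^ n + suc (l + l) * (K * 2 ^ n)
        ≤⟨ +-mono-≤ (m≤n*m (2 ^ n) l {{>-nonZero 1≤l}}) (*-monoˡ-≤ (K * 2 ^ n) (+-monoˡ-≤ (l + l) 1≤l)) ⟩
      l * 2 ^ n + (l + (l + l)) * (K * 2 ^ n)
        ≡⟨ collect l (2 ^ n) K ⟩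
      2 ^ n * (l * (1 + 3 * K)) ∎
      where
      collect : ∀ l p K → l * p + (l + (l + l)) * (K * p) ≡ p * (l * (1 + 3 * K))
      collect = solve-∀

    -- Compared as squares, because `b-large` bounds only b²: its factor 8n times D² l² is at most
    -- n².
    2ⁿlD≤nb : 2 ^ n * (l * D) ≤ n * b
    2ⁿlD≤nb = m*m-cancel-≤ (begin
      2 ^ n * (l * D) * (2 ^ n * (l * D))       ≡⟨ shuffle₁ (2 ^ n) (l * D) ⟩
      2 ^ n * 2 ^ n * (l * D * (l * D))         ≤⟨ *-monoˡ-≤ (l * D * (l * D)) b-large ⟩
      8 * n * (b * b) * (l * D * (l * D))       ≡⟨ shuffle₂ n b l D ⟩
      n * (b * b) * (8 * (D * D) * (l * l))     ≤⟨ *-monoʳ-≤ (n * (b * b)) 8D²l²≤n ⟩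
      n * (b * b) * n                           ≡⟨ shuffle₃ n b ⟩
      n * b * (n * b)                           ∎)
      where
      shuffle₁ : ∀ p d → p * d * (p * d) ≡ p * p * (d * d)
      shuffle₁ = solve-∀
      shuffle₂ : ∀ n b l D → 8 * n * (b * b) * (l * D * (l * D)) ≡ n * (b * b) * (8 * (D * D) * (l * l))
      shuffle₂ = solve-∀
      shuffle₃ : ∀ n b → n * (b * b) * n ≡ n * b * (n * b)
      shuffle₃ = solve-∀

    -- Multiplied by `n`, the left side is t n² + 2 e n², at most 2ⁿ l (1 + 2 (1 + 3K)); hence D = 3
    -- + 6K.
    exponent : (t + (e + e)) * n ≤ b
    exponent = *-cancelˡ-≤ n {{n≢0}} (begin
      n * ((t + (e + e)) * n)
        ≡⟨ expand n t e ⟩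
      t * (n * n) + 2 * (e * (n * n))
        ≤⟨ +-mono-≤ (proj₂ (square≤2^ t) n (≤-trans (m≤n+m N₂ _) N≤n)) (*-monoʳ-≤ 2 e-small) ⟩
      2 ^ n + 2 * (2 ^ n * (l * (1 + 3 * K)))
        ≤⟨ +-monoˡ-≤ _ (m≤m*n (2 ^ n) l {{>-nonZero 1≤l}}) ⟩
      2 ^ n * l + 2 * (2 ^ n * (l * (1 + 3 * K)))
        ≡⟨ collect (2 ^ n) l K ⟩
      2 ^ n * (l * (3 + 6 * K))
        ≡⟨ cong (λ m → 2 ^ n * (l * m)) D≡ ⟨
      2 ^ n * (l * D)
        ≤⟨ 2ⁿlD≤nb ⟩
      n * b ∎)
      where
      expand : ∀ n t e → n * ((t + (e + e)) * n) ≡ t * (n * n) + 2 * (e * (n * n))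
      expand = solve-∀
      collect : ∀ p l K → p * l + 2 * (p * (l * (1 + 3 * K))) ≡ p * (l * (3 + 6 * K))
      collect = solve-∀

-- Adding and removing single elements

∈-∪⁅⁆⁻ : ∀ {X : Subset n} {e x} → x ∈ X ∪ ⁅ e ⁆ → x ∈ X ⊎ x ≡ e
∈-∪⁅⁆⁻ {X = X} {e} x∈ with x∈p∪q⁻ X ⁅ e ⁆ x∈
... | inj₁ x∈X = inj₁ x∈X
... | inj₂ x∈e = inj₂ (x∈⁅y⁆⇒x≡y e x∈e)

e∈X∪⁅e⁆ : ∀ (X : Subset n) e → e ∈ X ∪ ⁅ e ⁆
e∈X∪⁅e⁆ X e = q⊆p∪q X ⁅ e ⁆ (x∈⁅x⁆ e)

∪⁅⁆-least : ∀ {X Y : Subset n} {e} → X ⊆ Y → e ∈ Y → X ∪ ⁅ e ⁆ ⊆ Y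
∪⁅⁆-least X⊆Y e∈Y x∈ with ∈-∪⁅⁆⁻ x∈
... | inj₁ x∈X  = X⊆Y x∈X
... | inj₂ refl = e∈Y

∣∪⁅⁆∣ : ∀ (X : Subset n) e → e ∉ X → ∣ X ∪ ⁅ e ⁆ ∣ ≡ suc ∣ X ∣
∣∪⁅⁆∣ (outside ∷ X) zero    e∉ = cong (suc ∘ ∣_∣) (∪-identityʳ X)
∣∪⁅⁆∣ (inside  ∷ X) zero    e∉ = contradiction here e∉
∣∪⁅⁆∣ (outside ∷ X) (suc e) e∉ = ∣∪⁅⁆∣ X e (e∉ ∘ there)
∣∪⁅⁆∣ (inside  ∷ X) (suc e) e∉ = cong suc (∣∪⁅⁆∣ X e (e∉ ∘ there))

x∈X-e⁻ : ∀ (X : Subset n) {e x} → x ∈ X - e → x ∈ X × x ≢ e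
x∈X-e⁻ (inside  ∷ X) {zero}  {suc x} (there x∈) = there (subst (x ∈_) (p─⊥≡p X) x∈) , λ ()
x∈X-e⁻ (outside ∷ X) {zero}  {suc x} (there x∈) = there (subst (x ∈_) (p─⊥≡p X) x∈) , λ ()
x∈X-e⁻ (inside  ∷ X) {suc e} {zero}  here       = here , λ ()
x∈X-e⁻ (b ∷ X)       {suc e} {suc x} (there x∈) with x∈X-e⁻ X x∈
... | x∈X , x≢e = there x∈X , x≢e ∘ Fin.suc-injective

∣-∣ : ∀ (X : Subset n) {e} → e ∈ X → suc ∣ X - e ∣ ≡ ∣ X ∣
∣-∣ (inside  ∷ X) {zero}  here      = cong (suc ∘ ∣_∣) (p─⊥≡p X)
∣-∣ (inside  ∷ X) {suc e} (there i) = cong suc (∣-∣ X i)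
∣-∣ (outside ∷ X) {suc e} (there i) = ∣-∣ X i

∃∈∖ : ∀ {X Y : Subset n} → ¬ (Y ⊆ X) → ∃ λ e → e ∈ Y × e ∉ X
∃∈∖ {X = X} {Y} Y⊈X with Fin.any? (λ e → e ∈? Y ×-dec ¬? (e ∈? X))
... | yes found = found
... | no  none  = contradiction (λ {x} x∈Y → decidable-stable (x ∈? X) λ x∉X → none (x , x∈Y , x∉X)) Y⊈X

∣X∣<∣Y∣⇒∃∈∖ : ∀ {X Y : Subset n} → ∣ X ∣ < ∣ Y ∣ → ∃ λ e → e ∈ Y × e ∉ X
∣X∣<∣Y∣⇒∃∈∖ lt = ∃∈∖ λ Y⊆X → <⇒≱ lt (p⊆q⇒∣p∣≤∣q∣ Y⊆X)

⊆∧∣∣≤⇒≡ : ∀ {X Y : Subset n} → X ⊆ Y → ∣ Y ∣ ≤ ∣ X ∣ → X ≡ Y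
⊆∧∣∣≤⇒≡ {X = X} {Y} X⊆Y le = ⊆-antisym X⊆Y λ {x} x∈Y →
  decidable-stable (x ∈? X) λ x∉X → <⇒≱ (p⊂q⇒∣p∣<∣q∣ (X⊆Y , x , x∈Y , x∉X)) le

-- Rank and independence

module _ (M : SetSystem n) where
  open SetSystem M using (Indep; Indep?)

  rank-least : ∀ {X k} → (∀ Y → Y ⊆ X → Indep Y → ∣ Y ∣ ≤ k) → rank M X ≤ k
  rank-least {X} bound = Extrema.max≤v⁺ z≤n (AllP.map⁺ (All.map (λ {Y} (Y⊆X , iY) → bound Y Y⊆X iY)
    (AllP.all-filter (λ Y → Y ⊆? X ×-dec Indep? Y) (subsets n))))

  ∣Y∣≤rank : ∀ {X Y} → Y ⊆ X → Indep Y → ∣ Y ∣ ≤ rank M X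
  ∣Y∣≤rank {X} {Y} Y⊆X iY = All.lookup (AllP.map⁻ (Extrema.xs≤max 0 _))
    (∈ₗ.∈-filter⁺ (λ Y → Y ⊆? X ×-dec Indep? Y) (∈-subsets Y) ((λ {x} → Y⊆X {x}) , iY))

  rank-mono : ∀ {X Y} → X ⊆ Y → rank M X ≤ rank M Y
  rank-mono X⊆Y = rank-least λ Z Z⊆X iZ → ∣Y∣≤rank (⊆-trans Z⊆X X⊆Y) iZ

  rank≤∣∣ : ∀ X → rank M X ≤ ∣ X ∣
  rank≤∣∣ X = rank-least λ Y Y⊆X _ → p⊆q⇒∣p∣≤∣q∣ Y⊆X

  indep⇒rank≡∣∣ : ∀ {X} → Indep X → rank M X ≡ ∣ X ∣
  indep⇒rank≡∣∣ {X} iX = ≤-antisym (rank≤∣∣ X) (∣Y∣≤rank ⊆-refl iX)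

  dep⇒rank<∣∣ : Indep ⊥ → ∀ {X} → ¬ Indep X → rank M X < ∣ X ∣
  dep⇒rank<∣∣ i⊥ {X} dX = ≤-<-trans
    (rank-least λ Y Y⊆X iY → <⇒≤pred (≰⇒> λ le → dX (subst Indep (⊆∧∣∣≤⇒≡ Y⊆X le) iY)))
    (≤-reflexive (suc-pred ∣ X ∣ {{≢-nonZero λ ∣X∣≡0 → dX (subst Indep
      (⊆∧∣∣≤⇒≡ (⊆-min X) (≤-trans (≤-reflexive ∣X∣≡0) z≤n)) i⊥)}}))

-- Sparse paving matroids from stable sets of Johnson graphs

-- Adjacent sets in a Johnson graph are distinct sets X + e and X + f over their intersection X.
Stable : Family n → Set
Stable D = ∀ X e f → e ∉ X → f ∉ X → T (D (X ∪ ⁅ e ⁆)) → T (D (X ∪ ⁅ f ⁆)) → e ≡ f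

-- The independent sets are those of size at most `r` outside `D`. `F` is given by properties and
-- not by a formula, because `families n` lists only some function pointwise equal to a given one.
module _ {r : ℕ} (0<r : 0 < r) (r<n : r < n) (D : Family n)
  (∣D∣ : ∀ X → T (D X) → ∣ X ∣ ≡ r) (stable : Stable D)
  (F : Family n) (⇒F : ∀ X → ∣ X ∣ ≤ r → ¬ T (D X) → T (F X))
  (F⇒≤r : ∀ X → T (F X) → ∣ X ∣ ≤ r) (F⇒∉D : ∀ X → T (F X) → ¬ T (D X)) where

  private
    M = onAll F

    matroid : IsMatroid M
    matroid = record
      { support    = λ _ _ _ → ∈⊤
      ; empty      = ⇒F ⊥ (subst (_≤ r) (sym (∣⊥∣≡0 n)) z≤n)
                       λ D⊥ → <⇒≢ 0<r (trans (sym (∣⊥∣≡0 n)) (∣D∣ ⊥ D⊥))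
      ; hereditary = λ X Y X⊆Y FY → ⇒F X (≤-trans (p⊆q⇒∣p∣≤∣q∣ X⊆Y) (F⇒≤r Y FY)) λ DX →
          F⇒∉D Y FY (subst (T ∘ D) (⊆∧∣∣≤⇒≡ X⊆Y (≤-trans (F⇒≤r Y FY) (≤-reflexive (sym (∣D∣ X DX))))) DX)
      ; augment    = augment
      }
      where
      augment : ∀ X Y → T (F X) → T (F Y) → ∣ X ∣ < ∣ Y ∣ → ∃ λ e → e ∈ Y × e ∉ X × T (F (X ∪ ⁅ e ⁆))
      augment X Y FX FY lt = go (∣X∣<∣Y∣⇒∃∈∖ lt)
        where
        ∣X+e∣≤r : ∀ e → e ∉ X → ∣ X ∪ ⁅ e ⁆ ∣ ≤ r
        ∣X+e∣≤r e e∉X = ≤-trans (≤-reflexive (∣∪⁅⁆∣ X e e∉X)) (≤-trans lt (F⇒≤r Y FY))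
        go : (∃ λ e → e ∈ Y × e ∉ X) → ∃ λ e → e ∈ Y × e ∉ X × T (F (X ∪ ⁅ e ⁆))
        -- If X + e lies in `D`, then Y has another element f outside X + e, as otherwise Y would
        -- equal X + e; stability keeps X + f out of `D`.
        go (e , e∈Y , e∉X) with T? (D (X ∪ ⁅ e ⁆))
        ... | no  ¬DX+e = e , e∈Y , e∉X , ⇒F _ (∣X+e∣≤r e e∉X) ¬DX+e
        ... | yes DX+e  with ∃∈∖ {X = X ∪ ⁅ e ⁆} {Y} (λ Y⊆X+e → F⇒∉D Y FY (subst (T ∘ D)
                               (sym (⊆∧∣∣≤⇒≡ Y⊆X+e (≤-trans (≤-reflexive (∣∪⁅⁆∣ X e e∉X)) lt))) DX+e))
        ...   | f , f∈Y , f∉X+e = f , f∈Y , f∉X , ⇒F _ (∣X+e∣≤r f f∉X) λ DX+f →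
                  f∉X+e (subst (_∈ X ∪ ⁅ e ⁆) (stable X e f e∉X f∉X DX+e DX+f) (e∈X∪⁅e⁆ X e))
          where
          f∉X = f∉X+e ∘ p⊆p∪q ⁅ e ⁆

    rank≤r : ∀ X → rank M X ≤ r
    rank≤r X = rank-least M λ Y _ FY → F⇒≤r Y FY

    -- C − p + e is adjacent to the member C of D, hence not a member itself.
    spans-with : ∀ C e → T (D C) → e ∉ C → r ≤ rank M (C ∪ ⁅ e ⁆)
    spans-with C e DC e∉C = exchange (∣X∣<∣Y∣⇒∃∈∖ {X = ⊥} (subst₂ _<_ (sym (∣⊥∣≡0 n)) (sym (∣D∣ C DC)) 0<r))
      where
      exchange : (∃ λ p → p ∈ C × p ∉ ⊥) → r ≤ rank M (C ∪ ⁅ e ⁆)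
      exchange (p , p∈C , _) = ≤-trans (≤-reflexive (sym ∣C-p+e∣))
        (∣Y∣≤rank M {Y = (C - p) ∪ ⁅ e ⁆} (∪⁅⁆-least (p⊆p∪q ⁅ e ⁆ ∘ p─q⊆p C ⁅ p ⁆) (e∈X∪⁅e⁆ C e))
          (⇒F _ (≤-reflexive ∣C-p+e∣) λ DC-p+e →
            e∉C (subst (_∈ C) (stable (C - p) p e (λ p∈ → proj₂ (x∈X-e⁻ C p∈) refl) e∉C-p
              (subst (T ∘ D) C≡ DC) DC-p+e) p∈C)))
        where
        e∉C-p = e∉C ∘ p─q⊆p C ⁅ p ⁆
        ∣C-p+e∣ : ∣ (C - p) ∪ ⁅ e ⁆ ∣ ≡ r
        ∣C-p+e∣ = trans (∣∪⁅⁆∣ (C - p) e e∉C-p) (trans (∣-∣ C p∈C) (∣D∣ C DC))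
        C≡ : C ≡ (C - p) ∪ ⁅ p ⁆
        C≡ = sym (⊆∧∣∣≤⇒≡ (∪⁅⁆-least (p─q⊆p C ⁅ p ⁆) p∈C) (≤-reflexive (sym
               (trans (∣∪⁅⁆∣ (C - p) p (λ p∈ → proj₂ (x∈X-e⁻ C p∈) refl)) (∣-∣ C p∈C)))))

    sparsePaving : IsSparsePaving M
    sparsePaving C (_ , ¬FC , proper) nonspanning = ((λ _ → ∈⊤) , λ e _ e∉C → <-≤-trans rank<r (spans-with C e DC e∉C))
      , ≤-antisym (≤-trans rank<r r≤rank⊤) (≤-trans (rank≤r ⊤) r≤1+rank)
      where
      -- A circuit with more than `r` elements contains an independent set of size at least `r`, so
      -- it is spanning.
      small : ∣ C ∣ ≤ r
      small = ≮⇒≥ λ r<∣C∣ → nonspanning (≤-antisym (rank-mono M ⊆⊤) (≤-trans (rank≤r ⊤) (large r<∣C∣)))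
        where
        large : r < ∣ C ∣ → r ≤ rank M C
        large r<∣C∣ with ∣X∣<∣Y∣⇒∃∈∖ {X = ⊥} (subst (_< ∣ C ∣) (sym (∣⊥∣≡0 n)) (≤-trans (s≤s z≤n) r<∣C∣))
        ... | p , p∈C , _ = ≤-trans (s≤s⁻¹ (≤-trans r<∣C∣ (≤-reflexive (sym (∣-∣ C p∈C)))))
                              (∣Y∣≤rank M (p─q⊆p C ⁅ p ⁆) (proper (C - p) (x∈p⇒p-x⊂p p∈C)))
      DC : T (D C)
      DC = decidable-stable (T? (D C)) λ ¬DC → ¬FC (⇒F C small ¬DC)
      rank<r : rank M C < r
      rank<r = subst (rank M C <_) (∣D∣ C DC) (dep⇒rank<∣∣ M (IsMatroid.empty matroid) ¬FC)
      r≤rank⊤ : r ≤ rank M ⊤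
      r≤rank⊤ with ∣X∣<∣Y∣⇒∃∈∖ {X = C} {Y = ⊤} (subst₂ _<_ (sym (∣D∣ C DC)) (sym (∣⊤∣≡n n)) r<n)
      ... | e , _ , e∉C = ≤-trans (spans-with C e DC e∉C) (rank-mono M ⊆⊤)
      r≤1+rank : r ≤ suc (rank M C)
      r≤1+rank with ∣X∣<∣Y∣⇒∃∈∖ {X = ⊥} (subst₂ _<_ (sym (∣⊥∣≡0 n)) (sym (∣D∣ C DC)) 0<r)
      ... | p , p∈C , _ = ≤-trans (≤-reflexive (trans (sym (∣D∣ C DC)) (sym (∣-∣ C p∈C))))
                            (s≤s (∣Y∣≤rank M (p─q⊆p C ⁅ p ⁆) (proper (C - p) (x∈p⇒p-x⊂p p∈C))))

  isSparsePavingMatroid : IsSparsePavingMatroid F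
  isSparsePavingMatroid = matroid , sparsePaving

-- Layers of the Boolean lattice

-- The binomial coefficient, written as a sum over subsets so that the layer can be split into
-- codes.
layer : ℕ → ℕ → ℕ
layer n r = ∑ (subsets n) (λ X → 𝟙 (does (∣ X ∣ ≟ r)))

layer-pascal : ∀ n r → layer (suc n) (suc r) ≡ layer n (suc r) + layer n r
layer-pascal n r = ∑-subsets {n} (λ X → 𝟙 (does (∣ X ∣ ≟ suc r)))

layer-0 : ∀ n → layer n 0 ≡ 1
layer-0 zero    = refl
layer-0 (suc n) = trans (∑-subsets {n} (λ X → 𝟙 (does (∣ X ∣ ≟ 0))))
  (cong₂ _+_ (layer-0 n) (trans (∑-const (subsets n) 0) (*-zeroʳ (length (subsets n)))))

layer-overfull : ∀ n r → n < r → layer n r ≡ 0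
layer-overfull zero    (suc r) _         = refl
layer-overfull (suc n) (suc r) (s≤s n<r) = trans (layer-pascal n r)
  (cong₂ _+_ (layer-overfull n (suc r) (m<n⇒m<1+n n<r)) (layer-overfull n r n<r))

layer-! : ∀ n a b → a + b ≡ n → layer n a * (a ! * b !) ≡ n !
layer-! n zero b refl = trans (cong₂ _*_ (layer-0 b) (*-identityˡ (b !))) (*-identityˡ (b !))
layer-! (suc n) (suc a) zero eq rewrite +-identityʳ a with refl ← suc-injective eq = begin
  layer (suc a) (suc a) * (suc a ! * 1)
    ≡⟨ cong (_* (suc a ! * 1)) (layer-pascal a a) ⟩
  (layer a (suc a) + layer a a) * (suc a ! * 1)
    ≡⟨ cong (λ m → (m + layer a a) * (suc a ! * 1)) (layer-overfull a (suc a) ≤-refl) ⟩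
  layer a a * (suc a * a ! * 1)
    ≡⟨ shuffle (layer a a) (suc a) (a !) ⟩
  suc a * (layer a a * (a ! * 1))
    ≡⟨ cong (suc a *_) (layer-! a a 0 (+-identityʳ a)) ⟩
  suc a ! ∎
  where
  open ≡-Reasoning
  shuffle : ∀ l s f → l * (s * f * 1) ≡ s * (l * (f * 1))
  shuffle = solve-∀
layer-! (suc n) (suc a) (suc b) eq = begin
  layer (suc n) (suc a) * (suc a * a ! * (suc b * b !))
    ≡⟨ cong (_* (suc a * a ! * (suc b * b !))) (layer-pascal n a) ⟩
  (layer n (suc a) + layer n a) * (suc a * a ! * (suc b * b !))
    ≡⟨ shuffle (layer n (suc a)) (layer n a) (suc a) (suc b) (a !) (b !) ⟩
  suc b * (layer n (suc a) * (suc a * a ! * b !)) + suc a * (layer n a * (a ! * (suc b * b !)))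
    ≡⟨ cong₂ (λ x y → suc b * x + suc a * y)
         (layer-! n (suc a) b (trans (sym (+-suc a b)) (suc-injective eq)))
         (layer-! n a (suc b) (suc-injective eq)) ⟩
  suc b * n ! + suc a * n !
    ≡⟨ *-distribʳ-+ (n !) (suc b) (suc a) ⟨
  (suc b + suc a) * n !
    ≡⟨ cong (_* n !) (trans (+-comm (suc b) (suc a)) eq) ⟩
  suc n ! ∎
  where
  open ≡-Reasoning
  shuffle : ∀ k l a b f g → (k + l) * (a * f * (b * g)) ≡ b * (k * (a * f * g)) + a * (l * (f * (b * g)))
  shuffle = solve-∀

central-step : ∀ m → layer (suc m + suc m) (suc m) * suc m ≡ 2 * (1 + (m + m)) * layer (m + m) m
central-step m = *-cancelʳ-≡ _ _ (suc m * (m ! * m !)) {{m*n≢0 (suc m) (m ! * m !) {{_}} {{m*n≢0 (m !) (m !) {{m !≢0}} {{m !≢0}}}}}} (begin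
  layer (suc m + suc m) (suc m) * suc m * (suc m * (m ! * m !))
    ≡⟨ shuffle₁ (layer (suc m + suc m) (suc m)) (suc m) (m !) ⟩
  layer (suc m + suc m) (suc m) * (suc m ! * suc m !)
    ≡⟨ layer-! (suc m + suc m) (suc m) (suc m) refl ⟩
  (suc m + suc m) !
    ≡⟨ cong (λ k → suc k !) (+-suc m m) ⟩
  suc (suc (m + m)) * (suc (m + m) * (m + m) !)
    ≡⟨ cong (λ k → suc (suc (m + m)) * (suc (m + m) * k)) (layer-! (m + m) m m refl) ⟨
  suc (suc (m + m)) * (suc (m + m) * (layer (m + m) m * (m ! * m !)))
    ≡⟨ shuffle₂ m (layer (m + m) m) (m !) ⟩
  2 * (1 + (m + m)) * layer (m + m) m * (suc m * (m ! * m !)) ∎)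
  where
  open ≡-Reasoning
  shuffle₁ : ∀ l s f → l * s * (s * (f * f)) ≡ l * (s * f * (s * f))
  shuffle₁ = solve-∀
  shuffle₂ : ∀ m l f → (2 + (m + m)) * ((1 + (m + m)) * (l * (f * f))) ≡
                       2 * (1 + (m + m)) * l * ((1 + m) * (f * f))
  shuffle₂ = solve-∀

-- The estimate 4^m / (2√m) for the central binomial coefficient, squared. Consecutive coefficients
-- have ratio 2(2m + 1)/(m + 1), and the induction comes down to 4m(m + 1) ≤ (2m + 1)².
central-large : ∀ m → 0 < m → 16 ^ m ≤ layer (m + m) m * layer (m + m) m * (4 * m)
central-large 1             _ = ≤-refl
central-large (suc m@(suc _)) _ = *-cancelʳ-≤ _ _ (suc m) (begin
  16 * 16 ^ m * suc m
    ≤⟨ *-monoˡ-≤ (suc m) (*-monoʳ-≤ 16 (central-large m (s≤s z≤n))) ⟩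
  16 * (c * c * (4 * m)) * suc m
    ≡⟨ shuffle₁ m c ⟩
  4 * (2 * c * (2 * c)) * (4 * m * (1 + m))
    ≤⟨ *-monoʳ-≤ (4 * (2 * c * (2 * c))) square ⟩
  4 * (2 * c * (2 * c)) * ((1 + (m + m)) * (1 + (m + m)))
    ≡⟨ shuffle₂ (1 + (m + m)) c ⟩
  4 * (2 * (1 + (m + m)) * c * (2 * (1 + (m + m)) * c))
    ≡⟨ cong (λ k → 4 * (k * k)) (central-step m) ⟨
  4 * (c′ * suc m * (c′ * suc m))
    ≡⟨ shuffle₃ c′ (suc m) ⟩
  c′ * c′ * (4 * suc m) * suc m ∎)
  where
  open ≤-Reasoning
  c = layer (m + m) m
  c′ = layer (suc m + suc m) (suc m)
  square : 4 * m * (1 + m) ≤ (1 + (m + m)) * (1 + (m + m))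
  square = ≤-trans (m≤n+m _ 1) (≤-reflexive (eq m))
    where
    eq : ∀ m → 1 + 4 * m * (1 + m) ≡ (1 + (m + m)) * (1 + (m + m))
    eq = solve-∀
  shuffle₁ : ∀ m c → 16 * (c * c * (4 * m)) * (1 + m) ≡ 4 * (2 * c * (2 * c)) * (4 * m * (1 + m))
  shuffle₁ = solve-∀
  shuffle₂ : ∀ x c → 4 * (2 * c * (2 * c)) * (x * x) ≡ 4 * (2 * x * c * (2 * x * c))
  shuffle₂ = solve-∀
  shuffle₃ : ∀ c s → 4 * (c * s * (c * s)) ≡ c * c * (4 * s) * s
  shuffle₃ = solve-∀

even⊎odd : ∀ n → ∃ λ m → n ≡ m + m ⊎ n ≡ suc (m + m)
even⊎odd zero    = 0 , inj₁ refl
even⊎odd (suc n) with even⊎odd n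
... | m , inj₁ refl = m , inj₂ refl
... | m , inj₂ refl = suc m , inj₁ (cong suc (sym (+-suc m m)))

4^m*4^m : ∀ m → 2 ^ (m + m) * 2 ^ (m + m) ≡ 16 ^ m
4^m*4^m m = begin
  2 ^ (m + m) * 2 ^ (m + m)  ≡⟨ ^-distribˡ-+-* 2 (m + m) (m + m) ⟨
  2 ^ (m + m + (m + m))      ≡⟨ cong (2 ^_) (four m) ⟩
  2 ^ (4 * m)                ≡⟨ ^-*-assoc 2 4 m ⟨
  16 ^ m                     ∎
  where
  open ≡-Reasoning
  four : ∀ m → m + m + (m + m) ≡ 4 * m
  four = solve-∀

-- The constant 8 comes from odd n = 2m + 1: Pascal's rule only gives the middle layer of 2m as a
-- lower bound, while the left side grows by a factor 4.
large-layer : ∀ n → 2 ≤ n → ∃ λ r → 0 < r × r < n × 2 ^ n * 2 ^ n ≤ 8 * n * (layer n r * layer n r)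
large-layer n 2≤n with even⊎odd n
large-layer _ ()               | zero , inj₁ refl
large-layer _ (s≤s ())         | zero , inj₂ refl
... | m@(suc _) , inj₁ refl = m , s≤s z≤n , m<m+n m (s≤s z≤n) , (begin
  2 ^ (m + m) * 2 ^ (m + m)  ≡⟨ 4^m*4^m m ⟩
  16 ^ m                     ≤⟨ central-large m (s≤s z≤n) ⟩
  c * c * (4 * m)            ≤⟨ *-monoʳ-≤ (c * c) (*-mono-≤ {4} {8} (m≤m+n 4 4) (m≤m+n m m)) ⟩
  c * c * (8 * (m + m))      ≡⟨ *-comm (c * c) _ ⟩
  8 * (m + m) * (c * c)      ∎)
  where
  open ≤-Reasoning
  c = layer (m + m) m
... | m@(suc _) , inj₂ refl = suc m , s≤s z≤n , s≤s (m<m+n m (s≤s z≤n)) , (begin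
  2 * 2 ^ (m + m) * (2 * 2 ^ (m + m))    ≡⟨ shuffle₁ (2 ^ (m + m)) ⟩
  4 * (2 ^ (m + m) * 2 ^ (m + m))        ≡⟨ cong (4 *_) (4^m*4^m m) ⟩
  4 * 16 ^ m                             ≤⟨ *-monoʳ-≤ 4 (central-large m (s≤s z≤n)) ⟩
  4 * (c * c * (4 * m))                  ≡⟨ shuffle₂ m c ⟩
  8 * (m + m) * (c * c)                  ≤⟨ *-mono-≤ (*-monoʳ-≤ 8 (n≤1+n (m + m))) (*-mono-≤ c≤ c≤) ⟩
  8 * suc (m + m) * (layer (suc (m + m)) (suc m) * layer (suc (m + m)) (suc m)) ∎)
  where
  open ≤-Reasoning
  c = layer (m + m) m
  c≤ : c ≤ layer (suc (m + m)) (suc m)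
  c≤ = ≤-trans (m≤n+m c _) (≤-reflexive (sym (layer-pascal (m + m) m)))
  shuffle₁ : ∀ p → 2 * p * (2 * p) ≡ 4 * (p * p)
  shuffle₁ = solve-∀
  shuffle₂ : ∀ m c → 4 * (c * c * (4 * m)) ≡ 8 * (m + m) * (c * c)
  shuffle₂ = solve-∀

-- Subfamilies

subfamilies : Family n → List (Family n)
subfamilies {zero}  D = if D [] then (λ _ → false) ∷ (λ _ → true) ∷ [] else (λ _ → false) ∷ []
subfamilies {suc n} D = cartesianProductWith join (subfamilies (D ∘ (outside ∷_))) (subfamilies (D ∘ (inside ∷_)))

length-cartesianProductWith : ∀ {B C : Set} (f : A → B → C) xs ys →
  length (cartesianProductWith f xs ys) ≡ length xs * length ys
length-cartesianProductWith f []       ys = refl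
length-cartesianProductWith f (x ∷ xs) ys = trans (List.length-++ (map (f x) ys))
  (cong₂ _+_ (List.length-map (f x) ys) (length-cartesianProductWith f xs ys))

length-subfamilies : ∀ (D : Family n) → length (subfamilies D) ≡ 2 ^ size D
length-subfamilies {zero} D with D []
... | false = refl
... | true  = refl
length-subfamilies {suc n} D = begin
  length (subfamilies D)
    ≡⟨ length-cartesianProductWith join (subfamilies D₀) (subfamilies D₁) ⟩
  length (subfamilies D₀) * length (subfamilies D₁)
    ≡⟨ cong₂ _*_ (length-subfamilies D₀) (length-subfamilies D₁) ⟩
  2 ^ size D₀ * 2 ^ size D₁
    ≡⟨ ^-distribˡ-+-* 2 (size D₀) (size D₁) ⟨
  2 ^ (size D₀ + size D₁)
    ≡⟨ cong (2 ^_) (∑-subsets (𝟙 ∘ D)) ⟨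
  2 ^ size D ∎
  where
  open ≡-Reasoning
  D₀ = D ∘ (outside ∷_)
  D₁ = D ∘ (inside ∷_)

subfamilies-unique : ∀ (D : Family n) → UniqueS.Unique (familySetoid n) (subfamilies D)
subfamilies-unique {zero} D with D []
... | false = [] ∷ []
... | true  = ((λ f≗t → contradiction (f≗t []) λ ()) ∷ []) ∷ [] ∷ []
subfamilies-unique {suc n} D = UniqueSP.cartesianProductWith⁺
  (familySetoid n) (familySetoid n) (familySetoid (suc n)) join
  (λ eq → (λ X → eq (outside ∷ X)) , (λ X → eq (inside ∷ X)))
  (subfamilies-unique (D ∘ (outside ∷_))) (subfamilies-unique (D ∘ (inside ∷_)))

subfamilies-⊆ : ∀ (D : Family n) {E} → E ∈ₗ subfamilies D → ∀ X → T (E X) → T (D X)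
subfamilies-⊆ {zero} D E∈ [] EX with D []
subfamilies-⊆ {zero} D (here refl) [] () | false
subfamilies-⊆ {zero} D E∈          [] EX | true = _
subfamilies-⊆ {suc n} D E∈ X EX
  with F , G , F∈ , G∈ , refl ← ∈ₗ.∈-cartesianProductWith⁻ join
         (subfamilies (D ∘ (outside ∷_))) (subfamilies (D ∘ (inside ∷_))) E∈
  with X
... | outside ∷ X′ = subfamilies-⊆ (D ∘ (outside ∷_)) F∈ X′ EX
... | inside  ∷ X′ = subfamilies-⊆ (D ∘ (inside ∷_)) G∈ X′ EX

module _ {P : Pred (Family n) 0ℓ} (P? : Decidable P) where
  open ∈S (familySetoid n) using () renaming (_∈_ to _∈ˢ_)

  count≤length : ∀ {ys} → (∀ {F} → P F → F ∈ˢ ys) → count P? ≤ length ys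
  count≤length P⇒∈ = unique-length-≤ (familySetoid n)
    (UniqueSP.filter⁺ (familySetoid n) P? (families-unique n))
    (λ F∈ → P⇒∈ (proj₂ (∈ₗ.∈-filter⁻ P? {xs = families n} F∈)))

  -- An injection from `xs` into the counted families, given by its left inverse `g`. The list
  -- contains only a function pointwise equal to the image `G` of `E`, hence the quantification over
  -- all such `F`.
  length≤count : ∀ {xs} (g : Family n → Family n) → UniqueS.Unique (familySetoid n) xs →
    (∀ {E} → E ∈ₗ xs → ∃ λ G → ∀ F → (∀ X → G X ≡ F X) → P F × (∀ X → E X ≡ g F X)) →
    length xs ≤ count P?
  length≤count {xs} g unique preimage = subst (length xs ≤_) (List.length-map g (filter P? (families n)))
    (unique-length-≤ (familySetoid n) unique found)
    where
    found : ∀ {E} → E ∈ₗ xs → E ∈ˢ map g (filter P? (families n))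
    found E∈ with G , spec ← preimage E∈ with F , F∈ , G≗F ← find (families-complete n G) =
      AnyP.map⁺ (Any.map (λ { refl → proj₂ (spec F G≗F) }) (∈ₗ.∈-filter⁺ P? F∈ (proj₁ (spec F G≗F))))

-- Graham–Sloane codes

-- Subfamilies of a stable family are stable, so each yields a sparse paving matroid, whose
-- dependent r-sets give the subfamily back.
2^size≤s : ∀ {r} → 0 < r → r < n → (D : Family n) → (∀ X → T (D X) → ∣ X ∣ ≡ r) →
           Stable D → 2 ^ size D ≤ s n
2^size≤s {n} {r} 0<r r<n D ∣D∣ stable = subst (_≤ s n) (length-subfamilies D)
  (length≤count isSparsePavingMatroid? nonbases (subfamilies-unique D) recover)
  where
  nonbases : Family n → Family n
  nonbases F X = does (∣ X ∣ ≟ r) ∧ not (F X)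

  matroid : Family n → Family n
  matroid E X = does (∣ X ∣ ≤? r) ∧ not (E X)

  recover : ∀ {E} → E ∈ₗ subfamilies D →
            ∃ λ G → ∀ F → (∀ X → G X ≡ F X) → IsSparsePavingMatroid F × (∀ X → E X ≡ nonbases F X)
  recover {E} E∈ = matroid E , λ F E≗F →
    isSparsePavingMatroid 0<r r<n E (λ X EX → ∣D∣ X (E⊆D X EX))
      (λ X e f e∉ f∉ Ee Ef → stable X e f e∉ f∉ (E⊆D _ Ee) (E⊆D _ Ef))
      F (λ X ≤r ¬EX → subst T (E≗F X) (matroid⁺ X ≤r ¬EX))
      (λ X FX → proj₁ (matroid⁻ X (subst T (sym (E≗F X)) FX)))
      (λ X FX → proj₂ (matroid⁻ X (subst T (sym (E≗F X)) FX)))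
    , λ X → nonbases-matroid X (E≗F X)
    where
    E⊆D = subfamilies-⊆ D E∈
    matroid⁺ : ∀ X → ∣ X ∣ ≤ r → ¬ T (E X) → T (matroid E X)
    matroid⁺ X ≤r ¬EX = does⁺ (∣ X ∣ ≤? r ×-dec ¬? (T? (E X))) (≤r , ¬EX)
    matroid⁻ : ∀ X → T (matroid E X) → ∣ X ∣ ≤ r × ¬ T (E X)
    matroid⁻ X = does⁻ (∣ X ∣ ≤? r ×-dec ¬? (T? (E X)))
    complement : ∀ {c} (c≡? : Dec (c ≡ r)) (c≤? : Dec (c ≤ r)) b → (T b → c ≡ r) →
                 b ≡ does c≡? ∧ not (does c≤? ∧ not b)
    complement (yes _)  (yes _)  false _  = refl
    complement (yes ≡r) (no ≰r)  false _  = contradiction (≤-reflexive ≡r) ≰r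
    complement (no _)   _        false _  = refl
    complement (yes _)  (yes _)  true  _  = refl
    complement (yes _)  (no _)   true  _  = refl
    complement (no ≢r)  _        true  b⇒ = contradiction (b⇒ _) ≢r
    nonbases-matroid : ∀ X {b} → matroid E X ≡ b → E X ≡ does (∣ X ∣ ≟ r) ∧ not b
    nonbases-matroid X refl = complement (∣ X ∣ ≟ r) (∣ X ∣ ≤? r) (E X) (∣D∣ X ∘ E⊆D X)

∈⇒≤∑ : ∀ {xs : List A} {x} → x ∈ₗ xs → ∀ f → f x ≤ ∑ xs f
∈⇒≤∑ (here refl) f = m≤m+n _ _
∈⇒≤∑ (there x∈)  f = ≤-trans (∈⇒≤∑ x∈ f) (m≤n+m _ _)

^-∑-≤ : ∀ (xs : List A) f q x → (∀ i → q ^ f i ≤ x) → q ^ ∑ xs f ≤ x ^ length xs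
^-∑-≤ []       f q x le = ≤-refl
^-∑-≤ (i ∷ xs) f q x le = ≤-trans (≤-reflexive (^-distribˡ-+-* q (f i) (∑ xs f)))
  (*-mono-≤ (le i) (^-∑-≤ xs f q x le))

-- Equal remainders with a larger quotient put a + f at least `m` above a + e.
+-%-wraps : ∀ m .{{_ : NonZero m}} a {e f} → (a + e) % m ≡ (a + f) % m → (a + e) / m < (a + f) / m → m ≤ f
+-%-wraps m a {e} {f} eq q< = +-cancelˡ-≤ (a + e) _ _ (begin
  a + e + m                              ≡⟨ cong (_+ m) (m≡m%n+[m/n]*n (a + e) m) ⟩
  (a + e) % m + (a + e) / m * m + m      ≡⟨ shuffle ((a + e) % m) ((a + e) / m) m ⟩
  (a + e) % m + suc ((a + e) / m) * m    ≤⟨ +-mono-≤ (≤-reflexive eq) (*-monoˡ-≤ m q<) ⟩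
  (a + f) % m + (a + f) / m * m          ≡⟨ m≡m%n+[m/n]*n (a + f) m ⟨
  a + f                                  ≤⟨ +-monoˡ-≤ f (m≤m+n a e) ⟩
  a + e + f                              ∎)
  where
  open ≤-Reasoning
  shuffle : ∀ r q m → r + q * m + m ≡ r + (1 + q) * m
  shuffle = solve-∀

+-%-injective : ∀ m .{{_ : NonZero m}} a {e f} → e < m → f < m → (a + e) % m ≡ (a + f) % m → e ≡ f
+-%-injective m a {e} {f} e<m f<m eq with <-cmp ((a + e) / m) ((a + f) / m)
... | tri< q< _ _ = contradiction (+-%-wraps m a eq q<) (<⇒≱ f<m)
... | tri> _ _ q> = contradiction (+-%-wraps m a (sym eq) q>) (<⇒≱ e<m)
... | tri≈ _ q≡ _ = +-cancelˡ-≡ a e f (begin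
  a + e                                ≡⟨ m≡m%n+[m/n]*n (a + e) m ⟩
  (a + e) % m + (a + e) / m * m        ≡⟨ cong₂ (λ x y → x + y * m) eq q≡ ⟩
  (a + f) % m + (a + f) / m * m        ≡⟨ m≡m%n+[m/n]*n (a + f) m ⟨
  a + f                                ∎)
  where open ≡-Reasoning

labelSum : ℕ → Subset n → ℕ
labelSum k []      = 0
labelSum k (b ∷ X) = 𝟙 b * k + labelSum (suc k) X

labelSum-∪⁅⁆ : ∀ k (X : Subset n) e → e ∉ X → labelSum k (X ∪ ⁅ e ⁆) ≡ labelSum k X + (k + toℕ e)
labelSum-∪⁅⁆ k (inside  ∷ X) zero    e∉ = contradiction here e∉
labelSum-∪⁅⁆ k (outside ∷ X) zero    e∉ = trans (cong (λ Y → 1 * k + labelSum (suc k) Y) (∪-identityʳ X)) (shuffle k (labelSum (suc k) X))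
  where
  shuffle : ∀ k x → 1 * k + x ≡ x + (k + 0)
  shuffle = solve-∀
labelSum-∪⁅⁆ k (inside  ∷ X) (suc e) e∉ = trans (cong (1 * k +_) (labelSum-∪⁅⁆ (suc k) X e (e∉ ∘ there)))
  (shuffle k (labelSum (suc k) X) (toℕ e))
  where
  shuffle : ∀ k x e → 1 * k + (x + (1 + k + e)) ≡ 1 * k + x + (k + (1 + e))
  shuffle = solve-∀
labelSum-∪⁅⁆ k (outside ∷ X) (suc e) e∉ = trans (labelSum-∪⁅⁆ (suc k) X e (e∉ ∘ there))
  (cong (labelSum (suc k) X +_) (sym (+-suc k (toℕ e))))

-- Members X + e and X + f of one code have e and f congruent modulo `n`, hence equal. Multiplying
-- the bounds for all `n` codes, instead of selecting the largest code, avoids a division by `n`.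
s-large : ∀ {r} → 0 < r → r < n → 2 ^ layer n r ≤ s n ^ n
s-large {n} {r} 0<r r<n = begin
  2 ^ layer n r                  ≤⟨ ^-monoʳ-≤ 2 layer≤ ⟩
  2 ^ ∑ (upTo n) (size ∘ code)   ≤⟨ ^-∑-≤ (upTo n) (size ∘ code) 2 (s n) (λ i → 2^size≤s 0<r r<n (code i) (∣code∣ i) (stable i)) ⟩
  s n ^ length (upTo n)          ≡⟨ cong (s n ^_) (List.length-upTo n) ⟩
  s n ^ n                        ∎
  where
  open ≤-Reasoning
  instance
    n≢0 : NonZero n
    n≢0 = >-nonZero (≤-trans (s≤s z≤n) r<n)

  code : ℕ → Family n
  code i X = does (∣ X ∣ ≟ r) ∧ does (labelSum 0 X % n ≟ i)

  code⁻ : ∀ i X → T (code i X) → ∣ X ∣ ≡ r × labelSum 0 X % n ≡ i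
  code⁻ i X = does⁻ (∣ X ∣ ≟ r ×-dec labelSum 0 X % n ≟ i)

  ∣code∣ : ∀ i X → T (code i X) → ∣ X ∣ ≡ r
  ∣code∣ i X c = proj₁ (code⁻ i X c)

  stable : ∀ i → Stable (code i)
  stable i X e f e∉ f∉ ce cf = Fin.toℕ-injective (+-%-injective n (labelSum 0 X) (Fin.toℕ<n e) (Fin.toℕ<n f)
    (begin-equality
      (labelSum 0 X + toℕ e) % n      ≡⟨ cong (_% n) (labelSum-∪⁅⁆ 0 X e e∉) ⟨
      labelSum 0 (X ∪ ⁅ e ⁆) % n      ≡⟨ proj₂ (code⁻ i (X ∪ ⁅ e ⁆) ce) ⟩
      i                               ≡⟨ proj₂ (code⁻ i (X ∪ ⁅ f ⁆) cf) ⟨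
      labelSum 0 (X ∪ ⁅ f ⁆) % n      ≡⟨ cong (_% n) (labelSum-∪⁅⁆ 0 X f f∉) ⟩
      (labelSum 0 X + toℕ f) % n      ∎))

  layer≤ : layer n r ≤ ∑ (upTo n) (size ∘ code)
  layer≤ = ≤-trans (∑-mono (subsets n) hit) (≤-reflexive (∑-swap (subsets n) (upTo n) (λ X i → 𝟙 (code i X))))
    where
    hit : ∀ X → 𝟙 (does (∣ X ∣ ≟ r)) ≤ ∑ (upTo n) (λ i → 𝟙 (code i X))
    hit X = ≤-trans (≤-reflexive own) (∈⇒≤∑ (∈ₗ.∈-upTo⁺ (m%n<n (labelSum 0 X) n)) (λ i → 𝟙 (code i X)))
      where
      own : 𝟙 (does (∣ X ∣ ≟ r)) ≡ 𝟙 (code (labelSum 0 X % n) X)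
      own rewrite dec-true (labelSum 0 X % n ≟ labelSum 0 X % n) refl with does (∣ X ∣ ≟ r)
      ... | true  = refl
      ... | false = refl

T-ext : ∀ {a b} → (T a → T b) → (T b → T a) → a ≡ b
T-ext {false} {false} _ _ = refl
T-ext {true}  {true}  _ _ = refl
T-ext {false} {true}  _ g = ⊥-elim (g _)
T-ext {true}  {false} f _ = ⊥-elim (f _)

-- Three lines in rank 3 forming a triangle

pair : Fin n → Fin n → Subset n
pair x y = ⁅ x ⁆ ∪ ⁅ y ⁆

triple : Fin n → Fin n → Fin n → Subset n
triple x y z = pair x y ∪ ⁅ z ⁆

∈-triple⁻ : ∀ {x y z i : Fin n} → i ∈ triple x y z → i ≡ x ⊎ i ≡ y ⊎ i ≡ z
∈-triple⁻ {x = x} i∈ with ∈-∪⁅⁆⁻ i∈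
... | inj₂ i≡z = inj₂ (inj₂ i≡z)
... | inj₁ i∈xy with ∈-∪⁅⁆⁻ i∈xy
...   | inj₂ i≡y = inj₂ (inj₁ i≡y)
...   | inj₁ i∈x = inj₁ (x∈⁅y⁆⇒x≡y x i∈x)

x∈pair : ∀ (x y : Fin n) → x ∈ pair x y
x∈pair x y = p⊆p∪q ⁅ y ⁆ (x∈⁅x⁆ x)

y∈pair : ∀ (x y : Fin n) → y ∈ pair x y
y∈pair x y = q⊆p∪q ⁅ x ⁆ ⁅ y ⁆ (x∈⁅x⁆ y)

-- The corners of the triangle are 0, 2 and 4.
line₁ line₂ line₃ : Subset 6
line₁ = triple 0F 1F 2F
line₂ = triple 2F 3F 4F
line₃ = triple 4F 5F 0F

-- Decided on all 64 subsets, this reduces R ≗ N for a family N of rank at most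
-- 3 to the values of N on Bs and Ls.
Tabulated : Family 6 → (Bs Ls : List (Subset 6)) → Subset 6 → Set
Tabulated R Bs Ls X = (T (R X) × Any (X ⊆_) Bs) ⊎ (¬ T (R X) × (3 < ∣ X ∣ ⊎ Any (X ≡_) Ls))

tabulated? : ∀ R Bs Ls X → Dec (Tabulated R Bs Ls X)
tabulated? R Bs Ls X = (T? (R X) ×-dec any? (X ⊆?_) Bs) ⊎-dec
                       (¬? (T? (R X)) ×-dec (3 <? ∣ X ∣ ⊎-dec X ∈Sets? Ls))

-- The `distinct` hypotheses express that two of the lines together have rank above 2, in the form
-- in which this is used: a pair on the first line extends inside the union.
module Triangle (N : Family 6)
  (hereditary : ∀ X Y → X ⊆ Y → T (N Y) → T (N X))
  (augment : ∀ X Y → T (N X) → T (N Y) → ∣ X ∣ < ∣ Y ∣ → ∃ λ e → e ∈ Y × e ∉ X × T (N (X ∪ ⁅ e ⁆)))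
  (dep₁ : ¬ T (N line₁)) (dep₂ : ¬ T (N line₂)) (dep₃ : ¬ T (N line₃))
  (proper₁ : ∀ X → X ⊂ line₁ → T (N X))
  (proper₂ : ∀ X → X ⊂ line₂ → T (N X))
  (proper₃ : ∀ X → X ⊂ line₃ → T (N X))
  (distinct₁₂ : ∀ P → P ⊂ line₁ → ∣ P ∣ ≡ 2 → ∃ λ e → e ∈ line₁ ∪ line₂ × e ∉ P × T (N (P ∪ ⁅ e ⁆)))
  (distinct₂₃ : ∀ P → P ⊂ line₂ → ∣ P ∣ ≡ 2 → ∃ λ e → e ∈ line₂ ∪ line₃ × e ∉ P × T (N (P ∪ ⁅ e ⁆)))
  (distinct₁₃ : ∀ P → P ⊂ line₁ → ∣ P ∣ ≡ 2 → ∃ λ e → e ∈ line₁ ∪ line₃ × e ∉ P × T (N (P ∪ ⁅ e ⁆)))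
  where

  private
    -- The lines {c, x, x′} and {c, y, y′} share c. The pair {c, x} extends by y or y′, as x′
    -- completes a line. In the case of y′, augmenting {c, y} from {c, x, y′} can only add x, as y′
    -- completes the other line.
    cross : ∀ c x x′ y y′ → T (N (pair c y)) →
            ¬ T (N (triple c x x′)) → ¬ T (N (triple c y y′)) →
            ∣ pair c y ∣ < ∣ triple c x y′ ∣ →
            (∃ λ e → e ∈ triple c x x′ ∪ triple c y y′ × e ∉ pair c x × T (N (pair c x ∪ ⁅ e ⁆))) →
            T (N (triple c x y))
    cross c x x′ y y′ Ncy ¬Nx ¬Ny lt (e , e∈ , e∉ , Nt) with x∈p∪q⁻ (triple c x x′) (triple c y y′) e∈
    ... | inj₁ e∈x with ∈-triple⁻ e∈x
    ...   | inj₁ refl        = contradiction (x∈pair c x) e∉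
    ...   | inj₂ (inj₁ refl) = contradiction (y∈pair c x) e∉
    ...   | inj₂ (inj₂ refl) = contradiction Nt ¬Nx
    cross c x x′ y y′ Ncy ¬Nx ¬Ny lt (e , e∈ , e∉ , Nt) | inj₂ e∈y with ∈-triple⁻ e∈y
    ...   | inj₁ refl        = contradiction (x∈pair c x) e∉
    ...   | inj₂ (inj₁ refl) = Nt
    ...   | inj₂ (inj₂ refl) with augment (pair c y) (triple c x y′) Ncy Nt lt
    ...     | f , f∈ , f∉ , Nf with ∈-triple⁻ f∈
    ...       | inj₁ refl        = contradiction (x∈pair c y) f∉
    ...       | inj₂ (inj₁ refl) = hereditary _ (triple c y x) (∪⁅⁆-least
                  (∪⁅⁆-least (p⊆p∪q ⁅ x ⁆ ∘ p⊆p∪q ⁅ y ⁆) (e∈X∪⁅e⁆ (pair c y) x))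
                  (p⊆p∪q ⁅ x ⁆ (y∈pair c y))) Nf
    ...       | inj₂ (inj₂ refl) = contradiction Nf ¬Ny

    -- Augmenting {x, m} from {x, y, z} cannot add y, which completes a dependent triple, so it adds
    -- z.
    extend : ∀ x m y z → T (N (pair x m)) → T (N (triple x y z)) → ¬ T (N (triple x m y)) →
             ∣ pair x m ∣ < ∣ triple x y z ∣ → T (N (triple x m z))
    extend x m y z Nxm Nt ¬N lt with augment (pair x m) (triple x y z) Nxm Nt lt
    ... | f , f∈ , f∉ , Nf with ∈-triple⁻ f∈
    ...   | inj₁ refl        = contradiction (x∈pair x m) f∉
    ...   | inj₂ (inj₁ refl) = contradiction Nf ¬N
    ...   | inj₂ (inj₂ refl) = Nf

    p₁ : ∀ X {_ : True (X ⊂? line₁)} → T (N X)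
    p₁ X {X⊂} = proper₁ X (toWitness X⊂)
    p₂ : ∀ X {_ : True (X ⊂? line₂)} → T (N X)
    p₂ X {X⊂} = proper₂ X (toWitness X⊂)
    p₃ : ∀ X {_ : True (X ⊂? line₃)} → T (N X)
    p₃ X {X⊂} = proper₃ X (toWitness X⊂)
    d₁₂ : ∀ P {_ : True (P ⊂? line₁)} → ∣ P ∣ ≡ 2 → ∃ λ e → e ∈ line₁ ∪ line₂ × e ∉ P × T (N (P ∪ ⁅ e ⁆))
    d₁₂ P {P⊂} = distinct₁₂ P (toWitness P⊂)
    d₂₃ : ∀ P {_ : True (P ⊂? line₂)} → ∣ P ∣ ≡ 2 → ∃ λ e → e ∈ line₂ ∪ line₃ × e ∉ P × T (N (P ∪ ⁅ e ⁆))
    d₂₃ P {P⊂} = distinct₂₃ P (toWitness P⊂)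
    d₁₃ : ∀ P {_ : True (P ⊂? line₁)} → ∣ P ∣ ≡ 2 → ∃ λ e → e ∈ line₁ ∪ line₃ × e ∉ P × T (N (P ∪ ⁅ e ⁆))
    d₁₃ P {P⊂} = distinct₁₃ P (toWitness P⊂)

    -- These ten triples consist of a corner and one further point on each line through it.
    N024 : T (N (triple 0F 2F 4F))
    N024 = cross 2F 0F 1F 4F 3F (p₂ _) dep₁ dep₂ ≤-refl (d₁₂ _ refl)
    N023 : T (N (triple 0F 2F 3F))
    N023 = cross 2F 0F 1F 3F 4F (p₂ _) dep₁ dep₂ ≤-refl (d₁₂ _ refl)
    N124 : T (N (triple 1F 2F 4F))
    N124 = cross 2F 1F 0F 4F 3F (p₂ _) dep₁ dep₂ ≤-refl (d₁₂ _ refl)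
    N123 : T (N (triple 1F 2F 3F))
    N123 = cross 2F 1F 0F 3F 4F (p₂ _) dep₁ dep₂ ≤-refl (d₁₂ _ refl)
    N025 : T (N (triple 0F 2F 5F))
    N025 = cross 0F 2F 1F 5F 4F (p₃ _) dep₁ dep₃ ≤-refl (d₁₃ _ refl)
    N014 : T (N (triple 0F 1F 4F))
    N014 = cross 0F 1F 2F 4F 5F (p₃ _) dep₁ dep₃ ≤-refl (d₁₃ _ refl)
    N015 : T (N (triple 0F 1F 5F))
    N015 = cross 0F 1F 2F 5F 4F (p₃ _) dep₁ dep₃ ≤-refl (d₁₃ _ refl)
    N245 : T (N (triple 2F 4F 5F))
    N245 = cross 4F 2F 3F 5F 0F (p₃ _) dep₂ dep₃ ≤-refl (d₂₃ _ refl)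
    N034 : T (N (triple 0F 3F 4F))
    N034 = cross 4F 3F 2F 0F 5F (p₃ _) dep₂ dep₃ ≤-refl (d₂₃ _ refl)
    N345 : T (N (triple 3F 4F 5F))
    N345 = cross 4F 3F 2F 5F 0F (p₃ _) dep₂ dep₃ ≤-refl (d₂₃ _ refl)
    -- These six consist of a corner, the non-corner point of the opposite line and one more
    -- non-corner point.
    N013 : T (N (triple 0F 1F 3F))
    N013 = extend 0F 1F 2F 3F (p₁ _) N023 dep₁ ≤-refl
    N035 : T (N (triple 0F 3F 5F))
    N035 = extend 0F 5F 4F 3F (p₃ _) N034 dep₃ ≤-refl
    N125 : T (N (triple 1F 2F 5F))
    N125 = extend 2F 1F 0F 5F (p₁ _) N025 dep₁ ≤-refl
    N235 : T (N (triple 2F 3F 5F))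
    N235 = extend 2F 3F 4F 5F (p₂ _) N245 dep₂ ≤-refl
    N134 : T (N (triple 1F 3F 4F))
    N134 = extend 4F 3F 2F 1F (p₂ _) N124 dep₂ ≤-refl
    N145 : T (N (triple 1F 4F 5F))
    N145 = extend 4F 5F 0F 1F (p₃ _) N014 dep₃ ≤-refl

    bases : List (Subset 6)
    bases = triple 0F 2F 4F ∷ triple 0F 2F 3F ∷ triple 1F 2F 4F ∷ triple 1F 2F 3F ∷
            triple 0F 2F 5F ∷ triple 0F 1F 4F ∷ triple 0F 1F 5F ∷ triple 2F 4F 5F ∷
            triple 0F 3F 4F ∷ triple 3F 4F 5F ∷ triple 0F 1F 3F ∷ triple 0F 3F 5F ∷
            triple 1F 2F 5F ∷ triple 2F 3F 5F ∷ triple 1F 3F 4F ∷ triple 1F 4F 5F ∷ []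

    bases-indep : All (T ∘ N) bases
    bases-indep = N024 ∷ N023 ∷ N124 ∷ N123 ∷ N025 ∷ N014 ∷ N015 ∷ N245 ∷
                  N034 ∷ N345 ∷ N013 ∷ N035 ∷ N125 ∷ N235 ∷ N134 ∷ N145 ∷ []

    -- {0, 2, 4} is a maximal independent set, since every other element completes a line with two
    -- of the corners.
    rank≤3 : ∀ X → T (N X) → ∣ X ∣ ≤ 3
    rank≤3 X NX = ≮⇒≥ λ 3<∣X∣ → go (augment (triple 0F 2F 4F) X N024 NX 3<∣X∣)
      where
      go : ¬ (∃ λ e → e ∈ X × e ∉ triple 0F 2F 4F × T (N (triple 0F 2F 4F ∪ ⁅ e ⁆)))
      go (0F , _ , e∉ , _) = e∉ here
      go (1F , _ , _ , Ne) = dep₁ (hereditary _ _ (toWitness {a? = line₁ ⊆? (triple 0F 2F 4F ∪ ⁅ 1F ⁆)} _) Ne)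
      go (2F , _ , e∉ , _) = e∉ (there (there here))
      go (3F , _ , _ , Ne) = dep₂ (hereditary _ _ (toWitness {a? = line₂ ⊆? (triple 0F 2F 4F ∪ ⁅ 3F ⁆)} _) Ne)
      go (4F , _ , e∉ , _) = e∉ (there (there (there (there here))))
      go (5F , _ , _ , Ne) = dep₃ (hereditary _ _ (toWitness {a? = line₃ ⊆? (triple 0F 2F 4F ∪ ⁅ 5F ⁆)} _) Ne)

    tabulated⇒≗ : ∀ R {Bs Ls} → All (T ∘ N) Bs → All (¬_ ∘ T ∘ N) Ls → (∀ X → Tabulated R Bs Ls X) → ∀ X → R X ≡ N X
    tabulated⇒≗ R Bs-indep Ls-dep table X with table X
    ... | inj₁ (RX , X⊆B) with B , B∈ , X⊆B ← find X⊆B =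
            T-ext (λ _ → hereditary X B X⊆B (All.lookup Bs-indep B∈)) λ _ → RX
    ... | inj₂ (¬RX , big) = T-ext (λ RX → contradiction RX ¬RX) λ NX → contradiction NX (dep big)
      where
      dep : 3 < ∣ X ∣ ⊎ Any (X ≡_) _ → ¬ T (N X)
      dep (inj₁ 3<∣X∣) NX = <⇒≱ 3<∣X∣ (rank≤3 X NX)
      dep (inj₂ X∈Ls)  = All.lookup Ls-dep X∈Ls

  -- {1, 3, 5} is the only triple that the hypotheses leave open, and it is what separates the two
  -- matroids.
  ≗W³⊎≗MK₄ : (∀ X → W³ X ≡ N X) ⊎ (∀ X → MK₄ X ≡ N X)
  ≗W³⊎≗MK₄ with T? (N (triple 1F 3F 5F))
  ... | yes N135 = inj₁ (tabulated⇒≗ W³ (N135 ∷ bases-indep) (dep₁ ∷ dep₂ ∷ dep₃ ∷ [])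
          (toWitness {a? = allSubset? (tabulated? W³ _ _)} _))
  ... | no ¬N135 = inj₂ (tabulated⇒≗ MK₄ bases-indep (dep₁ ∷ dep₂ ∷ dep₃ ∷ ¬N135 ∷ [])
          (toWitness {a? = allSubset? (tabulated? MK₄ _ _)} _))

-- Images of subsets under an injection

T⇒≡true : ∀ {b} → T b → b ≡ true
T⇒≡true {true} _ = refl

∈-tabulate⁺ : ∀ (f : Fin n → Bool) {x} → T (f x) → x ∈ tabulate f
∈-tabulate⁺ f {x} fx = Vec.lookup⇒[]= x (tabulate f) (trans (Vec.lookup∘tabulate f x) (T⇒≡true fx))

∈-tabulate⁻ : ∀ (f : Fin n → Bool) {x} → x ∈ tabulate f → T (f x)
∈-tabulate⁻ f {x} x∈ = subst T (trans (sym (Vec.[]=⇒lookup x∈)) (Vec.lookup∘tabulate f x)) _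

∈-image⁺ : ∀ {k} (φ : Vec (Fin n) k) {X i} → i ∈ X → lookup φ i ∈ image φ X
∈-image⁺ φ {X} {i} i∈X = ∈-tabulate⁺ _
  (does⁺ (Fin.any? λ j → j ∈? X ×-dec lookup φ j Fin.≟ lookup φ i) (i , i∈X , refl))

∈-image⁻ : ∀ {k} (φ : Vec (Fin n) k) X {y} → y ∈ image φ X → ∃ λ i → i ∈ X × lookup φ i ≡ y
∈-image⁻ φ X {y} y∈ = does⁻ (Fin.any? λ j → j ∈? X ×-dec lookup φ j Fin.≟ y) (∈-tabulate⁻ _ y∈)

x∈p─q⇒x∉q : ∀ (p q : Subset n) {x} → x ∈ p ─ q → x ∉ q
x∈p─q⇒x∉q (_ ∷ p) (inside  ∷ q) {zero}  () 
x∈p─q⇒x∉q (_ ∷ p) (outside ∷ q) {zero}  _          ()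
x∈p─q⇒x∉q (_ ∷ p) (_ ∷ q)       {suc x} (there x∈) (there x∈q) = x∈p─q⇒x∉q p q x∈ x∈q

∣∪image∣ : ∀ {k} (S : Subset n) (φ : Vec (Fin n) k) X → (∀ i j → lookup φ i ≡ lookup φ j → i ≡ j) →
           (∀ i → lookup φ i ∉ S) → ∣ S ∪ image φ X ∣ ≡ ∣ S ∣ + ∣ X ∣
∣∪image∣ S [] [] inj ∉S = trans (cong ∣_∣ (⊆-antisym S∪⊆S (p⊆p∪q _))) (sym (+-identityʳ ∣ S ∣))
  where
  S∪⊆S : S ∪ image [] [] ⊆ S
  S∪⊆S z∈ with x∈p∪q⁻ S _ z∈
  ... | inj₁ z∈S = z∈S
  ... | inj₂ z∈i with () , _ ← ∈-image⁻ [] [] z∈i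
∣∪image∣ {n} {suc k} S (y ∷ φ) (b ∷ X) inj ∉S = go b
  where
  IH : ∣ S ∪ image φ X ∣ ≡ ∣ S ∣ + ∣ X ∣
  IH = ∣∪image∣ S φ X (λ i j → Fin.suc-injective ∘ inj (suc i) (suc j)) (∉S ∘ suc)
  ⊆₁ : ∀ b → S ∪ image φ X ⊆ S ∪ image (y ∷ φ) (b ∷ X)
  ⊆₁ b z∈ with x∈p∪q⁻ S _ z∈
  ... | inj₁ z∈S = p⊆p∪q _ z∈S
  ... | inj₂ z∈i with i , i∈X , refl ← ∈-image⁻ φ X z∈i = q⊆p∪q S _ (∈-image⁺ (y ∷ φ) (there i∈X))
  go : ∀ b → ∣ S ∪ image (y ∷ φ) (b ∷ X) ∣ ≡ ∣ S ∣ + ∣ b ∷ X ∣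
  go outside = trans (cong ∣_∣ (⊆-antisym ⊆₂ (⊆₁ outside))) IH
    where
    ⊆₂ : S ∪ image (y ∷ φ) (outside ∷ X) ⊆ S ∪ image φ X
    ⊆₂ z∈ with x∈p∪q⁻ S _ z∈
    ... | inj₁ z∈S = p⊆p∪q _ z∈S
    ... | inj₂ z∈i with suc i , there i∈X , refl ← ∈-image⁻ (y ∷ φ) (outside ∷ X) z∈i = q⊆p∪q S _ (∈-image⁺ φ i∈X)
  go inside = begin
    ∣ S ∪ image (y ∷ φ) (inside ∷ X) ∣  ≡⟨ cong ∣_∣ (⊆-antisym ⊆₂ (∪⁅⁆-least (⊆₁ inside) (q⊆p∪q S _ (∈-image⁺ (y ∷ φ) {inside ∷ X} here)))) ⟩
    ∣ (S ∪ image φ X) ∪ ⁅ y ⁆ ∣         ≡⟨ ∣∪⁅⁆∣ (S ∪ image φ X) y y∉ ⟩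
    suc ∣ S ∪ image φ X ∣               ≡⟨ cong suc IH ⟩
    suc (∣ S ∣ + ∣ X ∣)                 ≡⟨ +-suc ∣ S ∣ ∣ X ∣ ⟨
    ∣ S ∣ + suc ∣ X ∣                   ∎
    where
    open ≡-Reasoning
    ⊆₂ : S ∪ image (y ∷ φ) (inside ∷ X) ⊆ (S ∪ image φ X) ∪ ⁅ y ⁆
    ⊆₂ z∈ with x∈p∪q⁻ S _ z∈
    ... | inj₁ z∈S = p⊆p∪q _ (p⊆p∪q _ z∈S)
    ... | inj₂ z∈i with ∈-image⁻ (y ∷ φ) (inside ∷ X) z∈i
    ...   | zero  , _         , refl = e∈X∪⁅e⁆ _ y
    ...   | suc i , there i∈X , refl = p⊆p∪q _ (q⊆p∪q S _ (∈-image⁺ φ i∈X))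
    y∉ : y ∉ S ∪ image φ X
    y∉ y∈ with x∈p∪q⁻ S _ y∈
    ... | inj₁ y∈S = ∉S zero y∈S
    ... | inj₂ y∈i with i , i∈X , φi≡y ← ∈-image⁻ φ X y∈i = contradiction (inj (suc i) zero φi≡y) λ ()

-- Minors pulled back to a small ground set

module _ {F : Family n} (matroid : IsMatroid (onAll F)) where
  open IsMatroid matroid

  private
    M = onAll F

  -- The independent sets of the minor M / S restricted to the elements of φ,
  -- pulled back along φ.
  module Pullback {k} (S : Subset n) (φ : Vec (Fin n) k)
    (inj : ∀ i j → lookup φ i ≡ lookup φ j → i ≡ j) (∉S : ∀ i → lookup φ i ∉ S) where

    push : Subset k → Subset n
    push X = S ∪ image φ X

    pullback : Family k
    pullback X = F (push X)

    ∈-push⁺ : ∀ {X i} → i ∈ X → lookup φ i ∈ push X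
    ∈-push⁺ i∈X = q⊆p∪q S _ (∈-image⁺ φ i∈X)

    ∈-push⁻ : ∀ {X z} → z ∈ push X → z ∈ S ⊎ ∃ λ i → i ∈ X × lookup φ i ≡ z
    ∈-push⁻ z∈ with x∈p∪q⁻ S _ z∈
    ... | inj₁ z∈S = inj₁ z∈S
    ... | inj₂ z∈i = inj₂ (∈-image⁻ φ _ z∈i)

    lookup∈push⁻ : ∀ {X i} → lookup φ i ∈ push X → i ∈ X
    lookup∈push⁻ {X} {i} φi∈ with ∈-push⁻ φi∈
    ... | inj₁ φi∈S = contradiction φi∈S (∉S i)
    ... | inj₂ (j , j∈X , φj≡φi) = subst (_∈ X) (inj j i φj≡φi) j∈X

    push-mono : ∀ {X Y} → X ⊆ Y → push X ⊆ push Y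
    push-mono X⊆Y z∈ with ∈-push⁻ z∈
    ... | inj₁ z∈S              = p⊆p∪q _ z∈S
    ... | inj₂ (i , i∈X , refl) = ∈-push⁺ (X⊆Y i∈X)

    push-⊂ : ∀ {X Y} → X ⊂ Y → push X ⊂ push Y
    push-⊂ (X⊆Y , e , e∈Y , e∉X) = push-mono X⊆Y , lookup φ e , ∈-push⁺ e∈Y , e∉X ∘ lookup∈push⁻

    ∣push∣ : ∀ X → ∣ push X ∣ ≡ ∣ S ∣ + ∣ X ∣
    ∣push∣ X = ∣∪image∣ S φ X inj ∉S

    ∣image∣ : ∀ X → ∣ image φ X ∣ ≡ ∣ X ∣
    ∣image∣ X = trans (cong ∣_∣ (sym (∪-identityˡ (image φ X))))
      (trans (∣∪image∣ ⊥ φ X inj (λ _ → ∉⊥)) (cong (_+ ∣ X ∣) (∣⊥∣≡0 n)))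

    pullback-hereditary : ∀ X Y → X ⊆ Y → T (pullback Y) → T (pullback X)
    pullback-hereditary X Y X⊆Y = hereditary _ _ (push-mono X⊆Y)

    push-∪⁅⁆ : ∀ X i → push (X ∪ ⁅ i ⁆) ⊆ push X ∪ ⁅ lookup φ i ⁆
    push-∪⁅⁆ X i z∈ with ∈-push⁻ z∈
    ... | inj₁ z∈S = p⊆p∪q _ (p⊆p∪q _ z∈S)
    ... | inj₂ (j , j∈ , refl) with ∈-∪⁅⁆⁻ j∈
    ...   | inj₁ j∈X  = p⊆p∪q _ (∈-push⁺ j∈X)
    ...   | inj₂ refl = e∈X∪⁅e⁆ _ _

    -- Augmentation of an independent set containing S stays within φ.
    push-augment : ∀ X J Y → T (pullback X) → T (F J) → ∣ push X ∣ < ∣ J ∣ → J ⊆ push Y →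
                   ∃ λ e → e ∈ Y × e ∉ X × T (pullback (X ∪ ⁅ e ⁆))
    push-augment X J Y FX FJ lt J⊆Y with augment (push X) J FX FJ lt
    ... | z , z∈J , z∉X , Fz with ∈-push⁻ (J⊆Y z∈J)
    ...   | inj₁ z∈S = contradiction (p⊆p∪q _ z∈S) z∉X
    ...   | inj₂ (e , e∈Y , refl) = e , e∈Y , z∉X ∘ ∈-push⁺ , hereditary _ _ (push-∪⁅⁆ X e) Fz

    pullback-augment : ∀ X Y → T (pullback X) → T (pullback Y) → ∣ X ∣ < ∣ Y ∣ →
                       ∃ λ e → e ∈ Y × e ∉ X × T (pullback (X ∪ ⁅ e ⁆))
    pullback-augment X Y FX FY lt = push-augment X (push Y) Y FX FY
      (subst₂ _<_ (sym (∣push∣ X)) (sym (∣push∣ Y)) (+-monoʳ-< ∣ S ∣ lt)) id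

    -- Contract S and delete everything outside `push ⊤`. As S is independent, the rank condition in
    -- the contraction says that the rank of `push X` is its size, that is, that `push X` is
    -- independent.
    hasMinor : T (F S) → (R : Family k) → (∀ X → R X ≡ pullback X) → HasMinor F R
    hasMinor FS R R≗ = S , D , S∩D≡∅ , φ , record
      { injective = inj
      ; onto      = λ y → mk⇔ onto⁻ λ { (i , refl) → φ∈ground i }
      ; preserves = λ X → trans (R≗ X) (T-ext (indep⁺ X) (indep⁻ X))
      }
      where
      D = ∁ (push ⊤)
      S∩D≡∅ : Empty (S ∩ D)
      S∩D≡∅ (z , z∈) with z∈S , z∈D ← x∈p∩q⁻ S D z∈ = x∈∁p⇒x∉p z∈D (p⊆p∪q _ z∈S)
      φ∈⊤─S : ∀ i → lookup φ i ∈ ⊤ ─ S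
      φ∈⊤─S i = x∈p∧x∉q⇒x∈p─q ∈⊤ (∉S i)
      φ∈ground : ∀ i → lookup φ i ∈ (⊤ ─ S) ─ D
      φ∈ground i = x∈p∧x∉q⇒x∈p─q (φ∈⊤─S i) λ φi∈D → x∈∁p⇒x∉p φi∈D (∈-push⁺ {⊤} ∈⊤)
      onto⁻ : ∀ {y} → y ∈ (⊤ ─ S) ─ D → ∃ λ i → lookup φ i ≡ y
      onto⁻ {y} y∈ with ∈-push⁻ (x∉∁p⇒x∈p (x∈p─q⇒x∉q (⊤ ─ S) D y∈))
      ... | inj₁ y∈S          = contradiction y∈S (x∈p─q⇒x∉q ⊤ S (p─q⊆p (⊤ ─ S) D y∈))
      ... | inj₂ (i , _ , φi) = i , φi
      image⊆ : ∀ {Z} X → (∀ i → lookup φ i ∈ Z) → image φ X ⊆ Z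
      image⊆ X φ∈Z z∈ with i , _ , refl ← ∈-image⁻ φ X z∈ = φ∈Z i
      contracted? : ∀ X → Dec (image φ X ⊆ ⊤ ─ S × rank M (image φ X ∪ S) ≡ ∣ image φ X ∣ + rank M S)
      contracted? X = image φ X ⊆? (⊤ ─ S) ×-dec (rank M (image φ X ∪ S) ≟ ∣ image φ X ∣ + rank M S)
      size≡ : ∀ X → ∣ image φ X ∣ + rank M S ≡ ∣ push X ∣
      size≡ X = trans (cong₂ _+_ (∣image∣ X) (indep⇒rank≡∣∣ M FS)) (trans (+-comm ∣ X ∣ ∣ S ∣) (sym (∣push∣ X)))
      indep⁺ : ∀ X → T (pullback X) → T (indep (delete (contract M S) D) (image φ X))
      indep⁺ X FX = does⁺ (image φ X ⊆? ((⊤ ─ S) ─ D) ×-dec T? (does (contracted? X)))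
        (image⊆ X φ∈ground , does⁺ (contracted? X) (image⊆ X φ∈⊤─S ,
          trans (cong (rank M) (∪-comm (image φ X) S)) (trans (indep⇒rank≡∣∣ M FX) (sym (size≡ X)))))
      indep⁻ : ∀ X → T (indep (delete (contract M S) D) (image φ X)) → T (pullback X)
      indep⁻ X i with does⁻ (image φ X ⊆? ((⊤ ─ S) ─ D) ×-dec T? (does (contracted? X))) i
      ... | _ , c with does⁻ (contracted? X) c
      ...   | _ , rank≡ = decidable-stable (T? (pullback X)) λ dX →
                <⇒≢ (dep⇒rank<∣∣ M empty dX)
                    (trans (cong (rank M) (∪-comm S (image φ X))) (trans rank≡ (size≡ X)))

  -- Circuits and the flats that they span

  Circuit : Subset n → Set
  Circuit = IsCircuit M

  -- A circuit C has rank |C| - 1, so for circuits this says that adding e does not raise the rank.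
  Spanned : Subset n → Fin n → Set
  Spanned C e = ∀ J → J ⊆ C ∪ ⁅ e ⁆ → T (F J) → ∣ J ∣ < ∣ C ∣

  spanned? : ∀ C e → Dec (Spanned C e)
  spanned? C e = allSubset? λ J → J ⊆? (C ∪ ⁅ e ⁆) →-dec (T? (F J) →-dec ∣ J ∣ <? ∣ C ∣)

  abstract
    -- The closure of a circuit C; for other sets this need not be the closure.
    cl : Subset n → Subset n
    cl C = tabulate (does ∘ spanned? C)

    ∈-cl⁺ : ∀ C {e} → Spanned C e → e ∈ cl C
    ∈-cl⁺ C {e} sp = ∈-tabulate⁺ _ (does⁺ (spanned? C e) sp)

    ∈-cl⁻ : ∀ C {e} → e ∈ cl C → Spanned C e
    ∈-cl⁻ C {e} e∈ = does⁻ (spanned? C e) (∈-tabulate⁻ _ e∈)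

  dependent⇒circuit : ∀ X → ¬ T (F X) → ∃ λ C → C ⊆ X × Circuit C
  dependent⇒circuit X = go ∣ X ∣ X ≤-refl
    where
    go : ∀ m X → ∣ X ∣ ≤ m → ¬ T (F X) → ∃ λ C → C ⊆ X × Circuit C
    go m X ∣X∣≤m dX with Fin.any? (λ e → e ∈? X ×-dec ¬? (T? (F (X - e))))
    ... | no minimal = X , id , ⊆⊤ , dX , λ { Y (Y⊆X , e , e∈X , e∉Y) →
            hereditary Y (X - e) (λ {z} z∈Y → x∈p∧x≢y⇒x∈p-y (Y⊆X z∈Y) λ { refl → e∉Y z∈Y })
              (decidable-stable (T? (F (X - e))) λ dX-e → minimal (e , e∈X , dX-e)) }
    go zero    X ∣X∣≤m dX | yes (e , e∈X , _) = contradiction (≤-trans (≤-reflexive (∣-∣ X e∈X)) ∣X∣≤m) λ ()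
    go (suc m) X ∣X∣≤m dX | yes (e , e∈X , dX-e)
      with C , C⊆X-e , circ ← go m (X - e) (s≤s⁻¹ (≤-trans (≤-reflexive (∣-∣ X e∈X)) ∣X∣≤m)) dX-e =
      C , p─q⊆p X ⁅ e ⁆ ∘ C⊆X-e , circ

  circuit-nonempty : ∀ {C} → Circuit C → ∃ λ p → p ∈ C
  circuit-nonempty {C} (_ , dC , _) with ∃∈∖ {X = ⊥} {C} (λ C⊆⊥ → dC (hereditary C ⊥ C⊆⊥ empty))
  ... | p , p∈C , _ = p , p∈C

  -- If J had |C| or more elements, it would augment the independent set C - p by some e in `cl C`.
  -- The result has |C| elements and lies in C + e, so e would not be spanned.
  indep⊆cl⇒∣∣< : ∀ {C J} → Circuit C → J ⊆ cl C → T (F J) → ∣ J ∣ < ∣ C ∣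
  indep⊆cl⇒∣∣< {C} {J} circ@(_ , _ , proper) J⊆ FJ with circuit-nonempty circ
  ... | p , p∈C = ≰⇒> λ ∣C∣≤∣J∣ →
    exceeds (augment (C - p) J (proper _ (x∈p⇒p-x⊂p p∈C)) FJ (≤-trans (≤-reflexive (∣-∣ C p∈C)) ∣C∣≤∣J∣))
    where
    exceeds : ¬ (∃ λ e → e ∈ J × e ∉ C - p × T (F ((C - p) ∪ ⁅ e ⁆)))
    exceeds (e , e∈J , e∉ , Fe) = <⇒≱
      (∈-cl⁻ C (J⊆ e∈J) ((C - p) ∪ ⁅ e ⁆) (∪⁅⁆-least (p⊆p∪q _ ∘ p─q⊆p C ⁅ p ⁆) (e∈X∪⁅e⁆ C e)) Fe)
      (≤-reflexive (trans (sym (∣-∣ C p∈C)) (sym (∣∪⁅⁆∣ (C - p) e e∉))))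

  circuit⊆cl : ∀ {C} → Circuit C → C ⊆ cl C
  circuit⊆cl {C} (_ , dC , _) e∈C = ∈-cl⁺ C λ J J⊆ FJ → ≰⇒> λ ∣C∣≤∣J∣ →
    dC (subst (T ∘ F) (⊆∧∣∣≤⇒≡ (∪⁅⁆-least id e∈C ∘ J⊆) ∣C∣≤∣J∣) FJ)

  -- For e in `cl C` the set B + e stays inside `cl C`, whose independent sets have fewer than |C| =
  -- |B| elements.
  cl-antitone : ∀ {C B} → Circuit C → ∣ C ∣ ≡ ∣ B ∣ → B ⊆ cl C → cl C ⊆ cl B
  cl-antitone {C} {B} circ ∣C∣≡∣B∣ B⊆ e∈ = ∈-cl⁺ B λ J J⊆ FJ →
    subst (∣ J ∣ <_) ∣C∣≡∣B∣ (indep⊆cl⇒∣∣< circ (∪⁅⁆-least B⊆ e∈ ∘ J⊆) FJ)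

  -- B - p is independent in a set of rank |C| - 1. This is why the largest chosen circuit inside a
  -- flat reveals its rank.
  circuit⊆cl⇒∣∣≤ : ∀ {C B} → Circuit C → Circuit B → B ⊆ cl C → ∣ B ∣ ≤ ∣ C ∣
  circuit⊆cl⇒∣∣≤ {C} {B} circC circB@(_ , _ , proper) B⊆ with circuit-nonempty circB
  ... | p , p∈B = ≤-trans (≤-reflexive (sym (∣-∣ B p∈B)))
    (indep⊆cl⇒∣∣< circC (B⊆ ∘ p─q⊆p B ⁅ p ⁆) (proper (B - p) (x∈p⇒p-x⊂p p∈B)))

  -- If C ∪ B has rank |C| − 1 then C and B span the same flat.
  cl≢⇒independent : ∀ {C B} → Circuit C → Circuit B → ∣ C ∣ ≡ ∣ B ∣ → cl C ≢ cl B →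
                    ∃ λ J → J ⊆ C ∪ B × T (F J) × ∣ C ∣ ≤ ∣ J ∣
  cl≢⇒independent {C} {B} circC circB ∣C∣≡∣B∣ cl≢
    with anySubset? (λ J → J ⊆? (C ∪ B) ×-dec (T? (F J) ×-dec ∣ C ∣ ≤? ∣ J ∣))
  ... | yes found = found
  ... | no  none  = contradiction (⊆-antisym (cl-antitone circC ∣C∣≡∣B∣ B⊆) (cl-antitone circB (sym ∣C∣≡∣B∣) C⊆)) cl≢
    where
    small : ∀ J → J ⊆ C ∪ B → T (F J) → ∣ J ∣ < ∣ C ∣
    small J J⊆ FJ = ≰⇒> λ le → none (J , (λ {x} → J⊆ {x}) , FJ , le)
    B⊆ : B ⊆ cl C
    B⊆ e∈B = ∈-cl⁺ C λ J J⊆ → small J (∪⁅⁆-least (p⊆p∪q B) (q⊆p∪q C B e∈B) ∘ J⊆)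
    C⊆ : C ⊆ cl B
    C⊆ e∈C = ∈-cl⁺ B λ J J⊆ FJ → subst (∣ J ∣ <_) ∣C∣≡∣B∣
      (small J (∪⁅⁆-least (q⊆p∪q C B) (p⊆p∪q B e∈C) ∘ J⊆) FJ)

  -- Were the closures different, the independent set Z could be augmented from within Z + e + f,
  -- making Z + e or Z + f independent.
  adjacent⇒cl≡ : ∀ Z {e f} → e ∉ Z → f ∉ Z → Circuit (Z ∪ ⁅ e ⁆) → Circuit (Z ∪ ⁅ f ⁆) →
                 cl (Z ∪ ⁅ e ⁆) ≡ cl (Z ∪ ⁅ f ⁆)
  adjacent⇒cl≡ Z {e} {f} e∉ f∉ circe@(_ , de , proper) circf@(_ , df , _)
    with Vec.≡-dec Bool._≟_ (cl (Z ∪ ⁅ e ⁆)) (cl (Z ∪ ⁅ f ⁆))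
  ... | yes cl≡ = cl≡
  ... | no  cl≢ with cl≢⇒independent circe circf (trans (∣∪⁅⁆∣ Z e e∉) (sym (∣∪⁅⁆∣ Z f f∉))) cl≢
  ...   | J , J⊆ , FJ , le with augment Z J (proper Z (p⊆p∪q _ , e , e∈X∪⁅e⁆ Z e , e∉)) FJ
                                  (≤-trans (≤-reflexive (sym (∣∪⁅⁆∣ Z e e∉))) le)
  ...     | g , g∈J , g∉Z , Fg with x∈p∪q⁻ (Z ∪ ⁅ e ⁆) (Z ∪ ⁅ f ⁆) (J⊆ g∈J)
  ...       | inj₁ g∈ with ∈-∪⁅⁆⁻ g∈
  ...         | inj₁ g∈Z  = contradiction g∈Z g∉Z
  ...         | inj₂ refl = contradiction Fg de
  adjacent⇒cl≡ Z {e} {f} e∉ f∉ circe@(_ , de , proper) circf@(_ , df , _)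
      | no  cl≢ | J , J⊆ , FJ , le | g , g∈J , g∉Z , Fg | inj₂ g∈ with ∈-∪⁅⁆⁻ g∈
  ...         | inj₁ g∈Z  = contradiction g∈Z g∉Z
  ...         | inj₂ refl = contradiction Fg df

  -- Contracting Z − x₁ − x₂ − x₃ turns the three circuits into the lines
  -- x₂y₁x₃, x₃y₂x₁ and x₁y₃x₂.
  triangle⇒minor : ∀ Z {x₁ x₂ x₃ y₁ y₂ y₃} → x₁ ∈ Z → x₂ ∈ Z → x₃ ∈ Z → y₁ ∉ Z → y₂ ∉ Z → y₃ ∉ Z →
    x₁ ≢ x₂ → x₁ ≢ x₃ → x₂ ≢ x₃ → y₁ ≢ y₂ → y₁ ≢ y₃ → y₂ ≢ y₃ →
    let A₁ = (Z - x₁) ∪ ⁅ y₁ ⁆ ; A₂ = (Z - x₂) ∪ ⁅ y₂ ⁆ ; A₃ = (Z - x₃) ∪ ⁅ y₃ ⁆ in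
    Circuit A₁ → Circuit A₂ → Circuit A₃ → cl A₁ ≢ cl A₂ → cl A₁ ≢ cl A₃ → cl A₂ ≢ cl A₃ →
    HasMinor F W³ ⊎ HasMinor F MK₄
  triangle⇒minor Z {x₁} {x₂} {x₃} {y₁} {y₂} {y₃} x₁∈ x₂∈ x₃∈ y₁∉ y₂∉ y₃∉
    x₁≢x₂ x₁≢x₃ x₂≢x₃ y₁≢y₂ y₁≢y₃ y₂≢y₃ circ₁ circ₂ circ₃ cl₁₂ cl₁₃ cl₂₃ =
    [ inj₁ ∘ hasMinor FS W³ , inj₂ ∘ hasMinor FS MK₄ ]′
      (Triangle.≗W³⊎≗MK₄ pullback pullback-hereditary pullback-augment
        (dep line₁ circuit₁) (dep line₂ circuit₂) (dep line₃ circuit₃)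
        (proper line₁ circuit₁) (proper line₂ circuit₂) (proper line₃ circuit₃)
        (distinct line₁ line₂ circuit₁ circuit₂ (λ eq → cl₁₃ (sym (subst₂ (λ A B → cl A ≡ cl B) push₁ push₂ eq))) refl)
        (distinct line₂ line₃ circuit₂ circuit₃ (λ eq → cl₁₂ (subst₂ (λ A B → cl A ≡ cl B) push₂ push₃ eq)) refl)
        (distinct line₁ line₃ circuit₁ circuit₃ (λ eq → cl₂₃ (sym (subst₂ (λ A B → cl A ≡ cl B) push₁ push₃ eq))) refl))
    where
    S = ((Z - x₁) - x₂) - x₃
    -- The corners take the even positions. Thus `line₁`, `line₂` and `line₃` come from A₃, A₁ and
    -- A₂, which explains the permuted indices.
    φ : Vec (Fin n) 6
    φ = x₁ ∷ y₃ ∷ x₂ ∷ y₁ ∷ x₃ ∷ y₂ ∷ []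

    ∈≢∉ : ∀ {x y} → x ∈ Z → y ∉ Z → x ≢ y
    ∈≢∉ x∈ y∉ refl = y∉ x∈
    ∉≢∈ : ∀ {x y} → x ∈ Z → y ∉ Z → y ≢ x
    ∉≢∈ x∈ y∉ refl = y∉ x∈

    unique : VecUnique φ
    unique =
      (∈≢∉ x₁∈ y₃∉ VecAll.∷ x₁≢x₂ VecAll.∷ ∈≢∉ x₁∈ y₁∉ VecAll.∷ x₁≢x₃ VecAll.∷ ∈≢∉ x₁∈ y₂∉ VecAll.∷ VecAll.[]) VecAllPairs.∷
      (∉≢∈ x₂∈ y₃∉ VecAll.∷ (y₁≢y₃ ∘ sym) VecAll.∷ ∉≢∈ x₃∈ y₃∉ VecAll.∷ (y₂≢y₃ ∘ sym) VecAll.∷ VecAll.[]) VecAllPairs.∷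
      (∈≢∉ x₂∈ y₁∉ VecAll.∷ x₂≢x₃ VecAll.∷ ∈≢∉ x₂∈ y₂∉ VecAll.∷ VecAll.[]) VecAllPairs.∷
      (∉≢∈ x₃∈ y₁∉ VecAll.∷ y₁≢y₂ VecAll.∷ VecAll.[]) VecAllPairs.∷
      (∈≢∉ x₃∈ y₂∉ VecAll.∷ VecAll.[]) VecAllPairs.∷
      VecAll.[] VecAllPairs.∷ VecAllPairs.[]

    S⊆Z-x₁ : S ⊆ Z - x₁
    S⊆Z-x₁ = p─q⊆p (Z - x₁) ⁅ x₂ ⁆ ∘ p─q⊆p ((Z - x₁) - x₂) ⁅ x₃ ⁆
    S⊆Z : S ⊆ Z
    S⊆Z = p─q⊆p Z ⁅ x₁ ⁆ ∘ S⊆Z-x₁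
    S≢x₁ : ∀ {z} → z ∈ S → z ≢ x₁
    S≢x₁ z∈ = proj₂ (x∈X-e⁻ Z (S⊆Z-x₁ z∈))
    S≢x₂ : ∀ {z} → z ∈ S → z ≢ x₂
    S≢x₂ z∈ = proj₂ (x∈X-e⁻ (Z - x₁) (p─q⊆p ((Z - x₁) - x₂) ⁅ x₃ ⁆ z∈))
    S≢x₃ : ∀ {z} → z ∈ S → z ≢ x₃
    S≢x₃ z∈ = proj₂ (x∈X-e⁻ ((Z - x₁) - x₂) z∈)

    ∉S : ∀ i → lookup φ i ∉ S
    ∉S 0F x₁∈S = S≢x₁ x₁∈S refl
    ∉S 1F y₃∈S = y₃∉ (S⊆Z y₃∈S)
    ∉S 2F x₂∈S = S≢x₂ x₂∈S refl
    ∉S 3F y₁∈S = y₁∉ (S⊆Z y₁∈S)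
    ∉S 4F x₃∈S = S≢x₃ x₃∈S refl
    ∉S 5F y₂∈S = y₂∉ (S⊆Z y₂∈S)

    open Pullback S φ (lookup-injective unique) ∉S

    ∈Z⁻ : ∀ {z} → z ∈ Z → z ∈ S ⊎ z ≡ x₁ ⊎ z ≡ x₂ ⊎ z ≡ x₃
    ∈Z⁻ {z} z∈ with z Fin.≟ x₁ | z Fin.≟ x₂ | z Fin.≟ x₃
    ... | yes z≡x₁ | _ | _ = inj₂ (inj₁ z≡x₁)
    ... | no _ | yes z≡x₂ | _ = inj₂ (inj₂ (inj₁ z≡x₂))
    ... | no _ | no _ | yes z≡x₃ = inj₂ (inj₂ (inj₂ z≡x₃))
    ... | no z≢x₁ | no z≢x₂ | no z≢x₃ =
      inj₁ (x∈p∧x≢y⇒x∈p-y (x∈p∧x≢y⇒x∈p-y (x∈p∧x≢y⇒x∈p-y z∈ z≢x₁) z≢x₂) z≢x₃)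

    push-triple : ∀ i j k c → (∀ {z} → z ∈ S → z ≢ c) →
      lookup φ i ∈ Z - c → lookup φ k ∈ Z - c →
      (∀ {z} → z ∈ Z → z ≢ c → z ∈ S ⊎ z ≡ lookup φ i ⊎ z ≡ lookup φ k) →
      push (triple i j k) ≡ (Z - c) ∪ ⁅ lookup φ j ⁆
    push-triple i j k c S≢c i∈ k∈ cover = ⊆-antisym ⊆₁ (∪⁅⁆-least ⊆₂ (∈-push⁺ (p⊆p∪q ⁅ k ⁆ (y∈pair i j))))
      where
      ⊆₁ : push (triple i j k) ⊆ (Z - c) ∪ ⁅ lookup φ j ⁆
      ⊆₁ z∈ with ∈-push⁻ {triple i j k} z∈
      ... | inj₁ z∈S = p⊆p∪q _ (x∈p∧x≢y⇒x∈p-y (S⊆Z z∈S) (S≢c z∈S))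
      ... | inj₂ (l , l∈ , refl) with ∈-triple⁻ {x = i} {j} {k} l∈
      ...   | inj₁ refl        = p⊆p∪q _ i∈
      ...   | inj₂ (inj₁ refl) = e∈X∪⁅e⁆ (Z - c) _
      ...   | inj₂ (inj₂ refl) = p⊆p∪q _ k∈
      ⊆₂ : Z - c ⊆ push (triple i j k)
      ⊆₂ z∈ with z∈Z , z≢c ← x∈X-e⁻ Z z∈ with cover z∈Z z≢c
      ... | inj₁ z∈S         = p⊆p∪q _ z∈S
      ... | inj₂ (inj₁ refl) = ∈-push⁺ (p⊆p∪q ⁅ k ⁆ (x∈pair i j))
      ... | inj₂ (inj₂ refl) = ∈-push⁺ (e∈X∪⁅e⁆ (pair i j) k)

    push₁ : push line₁ ≡ (Z - x₃) ∪ ⁅ y₃ ⁆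
    push₁ = push-triple 0F 1F 2F x₃ S≢x₃ (x∈p∧x≢y⇒x∈p-y x₁∈ x₁≢x₃) (x∈p∧x≢y⇒x∈p-y x₂∈ x₂≢x₃) cover
      where
      cover : ∀ {z} → z ∈ Z → z ≢ x₃ → z ∈ S ⊎ z ≡ x₁ ⊎ z ≡ x₂
      cover z∈ z≢ with ∈Z⁻ z∈
      ... | inj₁ z∈S                = inj₁ z∈S
      ... | inj₂ (inj₁ z≡)          = inj₂ (inj₁ z≡)
      ... | inj₂ (inj₂ (inj₁ z≡))   = inj₂ (inj₂ z≡)
      ... | inj₂ (inj₂ (inj₂ z≡x₃)) = contradiction z≡x₃ z≢
    push₂ : push line₂ ≡ (Z - x₁) ∪ ⁅ y₁ ⁆
    push₂ = push-triple 2F 3F 4F x₁ S≢x₁ (x∈p∧x≢y⇒x∈p-y x₂∈ (x₁≢x₂ ∘ sym)) (x∈p∧x≢y⇒x∈p-y x₃∈ (x₁≢x₃ ∘ sym)) cover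
      where
      cover : ∀ {z} → z ∈ Z → z ≢ x₁ → z ∈ S ⊎ z ≡ x₂ ⊎ z ≡ x₃
      cover z∈ z≢ with ∈Z⁻ z∈
      ... | inj₁ z∈S         = inj₁ z∈S
      ... | inj₂ (inj₁ z≡x₁) = contradiction z≡x₁ z≢
      ... | inj₂ (inj₂ z≡)   = inj₂ z≡
    push₃ : push line₃ ≡ (Z - x₂) ∪ ⁅ y₂ ⁆
    push₃ = push-triple 4F 5F 0F x₂ S≢x₂ (x∈p∧x≢y⇒x∈p-y x₃∈ (x₂≢x₃ ∘ sym)) (x∈p∧x≢y⇒x∈p-y x₁∈ x₁≢x₂) cover
      where
      cover : ∀ {z} → z ∈ Z → z ≢ x₂ → z ∈ S ⊎ z ≡ x₃ ⊎ z ≡ x₁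
      cover z∈ z≢ with ∈Z⁻ z∈
      ... | inj₁ z∈S                = inj₁ z∈S
      ... | inj₂ (inj₁ z≡)          = inj₂ (inj₂ z≡)
      ... | inj₂ (inj₂ (inj₁ z≡x₂)) = contradiction z≡x₂ z≢
      ... | inj₂ (inj₂ (inj₂ z≡))   = inj₂ (inj₁ z≡)

    circuit₁ : Circuit (push line₁)
    circuit₁ = subst Circuit (sym push₁) circ₃
    circuit₂ : Circuit (push line₂)
    circuit₂ = subst Circuit (sym push₂) circ₁
    circuit₃ : Circuit (push line₃)
    circuit₃ = subst Circuit (sym push₃) circ₂

    dep : ∀ L → Circuit (push L) → ¬ T (pullback L)
    dep _ (_ , dL , _) = dL

    proper : ∀ L → Circuit (push L) → ∀ X → X ⊂ L → T (pullback X)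
    proper _ (_ , _ , proper) X X⊂L = proper (push X) (push-⊂ X⊂L)

    -- Distinct closures give an independent set in the union at least as large as `push L`, hence
    -- larger than `push P`.
    distinct : ∀ L L′ → Circuit (push L) → Circuit (push L′) → cl (push L) ≢ cl (push L′) → ∣ L ∣ ≡ ∣ L′ ∣ →
               ∀ P → P ⊂ L → ∣ P ∣ ≡ 2 → ∃ λ e → e ∈ L ∪ L′ × e ∉ P × T (pullback (P ∪ ⁅ e ⁆))
    distinct L L′ circ circ′ cl≢ ∣L∣≡∣L′∣ P P⊂L _
      with J , J⊆ , FJ , le ← cl≢⇒independent circ circ′
             (trans (∣push∣ L) (trans (cong (∣ S ∣ +_) ∣L∣≡∣L′∣) (sym (∣push∣ L′)))) cl≢ =
      push-augment P J (L ∪ L′) (proper L circ P P⊂L) FJ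
        (<-≤-trans (p⊂q⇒∣p∣<∣q∣ (push-⊂ P⊂L)) le)
        (λ z∈J → [ push-mono {L} (p⊆p∪q L′) , push-mono {L′} (q⊆p∪q L L′) ]′ (x∈p∪q⁻ (push L) (push L′) (J⊆ z∈J)))

    FS : T (F S)
    FS = hereditary S (push ⊥) (p⊆p∪q _) (proper line₁ circuit₁ ⊥ (⊥⊆ , 0F , here , λ ()))

-- Counting neighbours in Johnson graphs

∑-allFin : ∀ (f : Fin (suc n) → ℕ) → ∑ (allFin (suc n)) f ≡ f zero + ∑ (allFin n) (f ∘ suc)
∑-allFin {n} f = cong (f zero +_) (trans (cong (λ xs → ∑ xs f) (sym (List.map-tabulate id suc))) (∑-map suc (allFin n) f))

∑-lookup : ∀ (X : Subset n) → ∑ (allFin n) (λ x → 𝟙 (lookup X x)) ≡ ∣ X ∣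
∑-lookup []            = refl
∑-lookup (inside  ∷ X) = trans (∑-allFin (λ x → 𝟙 (lookup (inside ∷ X) x))) (cong suc (∑-lookup X))
∑-lookup (outside ∷ X) = trans (∑-allFin (λ x → 𝟙 (lookup (outside ∷ X) x))) (∑-lookup X)

∑-lookup-∁ : ∀ (X : Subset n) → ∑ (allFin n) (λ x → 𝟙 (not (lookup X x))) ≡ ∣ ∁ X ∣
∑-lookup-∁ {n} X = trans (∑-cong (allFin n) (λ x → cong 𝟙 (sym (Vec.lookup-map x not X)))) (∑-lookup (∁ X))

flip-flip : ∀ (X : Subset n) x → (X [ x ]%= not) [ x ]%= not ≡ X
flip-flip (b ∷ X) zero    = cong (_∷ X) (not-involutive b)
flip-flip (b ∷ X) (suc x) = cong (b ∷_) (flip-flip X x)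

-- Toggling is a bijection on all subsets, so sums can be reindexed by it; on sets that contain x
-- but not y it is the exchange of x for y.
swap : Fin n → Fin n → Subset n → Subset n
swap x y X = (X [ x ]%= not) [ y ]%= not

swap-swap : ∀ (X : Subset n) x y → swap x y (swap y x X) ≡ X
swap-swap X x y = trans (cong (_[ y ]%= not) (flip-flip (X [ y ]%= not) x)) (flip-flip X y)

isNeighbour : Family n → Subset n → Fin n × Fin n → Bool
isNeighbour A Z (x , y) = lookup Z x ∧ not (lookup Z y) ∧ A (swap x y Z)

pairs : ∀ n → List (Fin n × Fin n)
pairs n = cartesianProduct (allFin n) (allFin n)

pairs-unique : ∀ n → Unique (pairs n)
pairs-unique n = Unique.cartesianProduct⁺ (Unique.allFin⁺ n) (Unique.allFin⁺ n)

-- For x ≠ y the toggles turn C back into its neighbour C - y + x. For x = y both sides vanish, so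
-- `pairs` may include the diagonal.
isNeighbour-swap : ∀ (A : Family n) C x y →
  𝟙 (isNeighbour A (swap y x C) (x , y)) ≡ 𝟙 (A C) * (𝟙 (not (lookup C x)) * 𝟙 (lookup C y))
isNeighbour-swap A C x y with x Fin.≟ y
... | yes refl rewrite flip-flip C x with lookup C x
...   | true  = sym (*-zeroʳ (𝟙 (A C)))
...   | false = sym (*-zeroʳ (𝟙 (A C)))
isNeighbour-swap A C x y | no x≢y rewrite
    swap-swap C x y
  | Vec.lookup∘updateAt x {not} (C [ y ]%= not)
  | Vec.lookup∘updateAt′ x y {not} x≢y C
  | Vec.lookup∘updateAt′ y x {not} (x≢y ∘ sym) (C [ y ]%= not)
  | Vec.lookup∘updateAt y {not} C
  with lookup C x | lookup C y | A C
... | true  | _     | a = sym (*-zeroʳ (𝟙 a))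
... | false | false | a = sym (*-zeroʳ (𝟙 a))
... | false | true  | a = sym (*-identityʳ (𝟙 a))

-- Adjacent pairs (Z, C) with C in `A`, counted from Z and from C; the reindexing by `swap` passes
-- between the two.
∑-neighbours : ∀ (A : Family n) → ∑ (subsets n) (λ Z → ∑ (pairs n) (𝟙 ∘ isNeighbour A Z)) ≡
                                   ∑ (subsets n) (λ C → 𝟙 (A C) * (∣ ∁ C ∣ * ∣ C ∣))
∑-neighbours {n} A = begin
  ∑ (subsets n) (λ Z → ∑ (pairs n) (𝟙 ∘ isNeighbour A Z))
    ≡⟨ ∑-swap (subsets n) (pairs n) (λ Z → 𝟙 ∘ isNeighbour A Z) ⟩
  ∑ (pairs n) (λ p → ∑ (subsets n) (λ Z → 𝟙 (isNeighbour A Z p)))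
    ≡⟨ ∑-cong (pairs n) (λ p → sym (reindex p)) ⟩
  ∑ (pairs n) (λ p → ∑ (subsets n) (λ C → weight C p))
    ≡⟨ ∑-swap (pairs n) (subsets n) (λ p C → weight C p) ⟩
  ∑ (subsets n) (λ C → ∑ (pairs n) (weight C))
    ≡⟨ ∑-cong (subsets n) total ⟩
  ∑ (subsets n) (λ C → 𝟙 (A C) * (∣ ∁ C ∣ * ∣ C ∣)) ∎
  where
  open ≡-Reasoning
  weight : Subset n → Fin n × Fin n → ℕ
  weight C (x , y) = 𝟙 (A C) * (𝟙 (not (lookup C x)) * 𝟙 (lookup C y))
  reindex : ∀ p → ∑ (subsets n) (λ C → weight C p) ≡ ∑ (subsets n) (λ Z → 𝟙 (isNeighbour A Z p))
  reindex (x , y) = trans (∑-cong (subsets n) (λ C → sym (isNeighbour-swap A C x y)))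
    (trans (∑-subsets-flip y (λ X → 𝟙 (isNeighbour A (X [ x ]%= not) (x , y))))
           (∑-subsets-flip x (λ X → 𝟙 (isNeighbour A X (x , y)))))
  total : ∀ C → ∑ (pairs n) (weight C) ≡ 𝟙 (A C) * (∣ ∁ C ∣ * ∣ C ∣)
  total C = begin
    ∑ (pairs n) (weight C)
      ≡⟨ ∑-*ˡ (pairs n) (𝟙 (A C)) _ ⟩
    𝟙 (A C) * ∑ (pairs n) (λ (x , y) → 𝟙 (not (lookup C x)) * 𝟙 (lookup C y))
      ≡⟨ cong (𝟙 (A C) *_) (∑-cartesianProductWith _,_ (allFin n) (allFin n) _) ⟩
    𝟙 (A C) * ∑ (allFin n) (λ x → ∑ (allFin n) (λ y → 𝟙 (not (lookup C x)) * 𝟙 (lookup C y)))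
      ≡⟨ cong (𝟙 (A C) *_) (∑-cong (allFin n) (λ x → ∑-*ˡ (allFin n) (𝟙 (not (lookup C x))) _)) ⟩
    𝟙 (A C) * ∑ (allFin n) (λ x → 𝟙 (not (lookup C x)) * ∑ (allFin n) (λ y → 𝟙 (lookup C y)))
      ≡⟨ cong (𝟙 (A C) *_) (∑-*ʳ (allFin n) _ _) ⟩
    𝟙 (A C) * (∑ (allFin n) (λ x → 𝟙 (not (lookup C x))) * ∑ (allFin n) (λ y → 𝟙 (lookup C y)))
      ≡⟨ cong₂ (λ a b → 𝟙 (A C) * (a * b)) (∑-lookup-∁ C) (∑-lookup C) ⟩
    𝟙 (A C) * (∣ ∁ C ∣ * ∣ C ∣) ∎

-- Sets far from the middle layers

∑-3^∣∣ : ∀ n → ∑ (subsets n) (λ X → 3 ^ ∣ X ∣) ≡ 2 ^ n * 2 ^ n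
∑-3^∣∣ zero    = refl
∑-3^∣∣ (suc n) = begin
  ∑ (subsets (suc n)) (λ X → 3 ^ ∣ X ∣)
    ≡⟨ ∑-subsets {n} (λ X → 3 ^ ∣ X ∣) ⟩
  ∑ (subsets n) (λ X → 3 ^ ∣ X ∣) + ∑ (subsets n) (λ X → 3 * 3 ^ ∣ X ∣)
    ≡⟨ cong₂ _+_ (∑-3^∣∣ n) (trans (∑-*ˡ (subsets n) 3 _) (cong (3 *_) (∑-3^∣∣ n))) ⟩
  2 ^ n * 2 ^ n + 3 * (2 ^ n * 2 ^ n)
    ≡⟨ four (2 ^ n) ⟩
  2 * 2 ^ n * (2 * 2 ^ n) ∎
  where
  open ≡-Reasoning
  four : ∀ p → p * p + 3 * (p * p) ≡ 2 * p * (2 * p)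
  four = solve-∀

∑-3^∣∁∣ : ∀ n → ∑ (subsets n) (λ X → 3 ^ ∣ ∁ X ∣) ≡ 2 ^ n * 2 ^ n
∑-3^∣∁∣ zero    = refl
∑-3^∣∁∣ (suc n) = begin
  ∑ (subsets (suc n)) (λ X → 3 ^ ∣ ∁ X ∣)
    ≡⟨ ∑-subsets {n} (λ X → 3 ^ ∣ ∁ X ∣) ⟩
  ∑ (subsets n) (λ X → 3 * 3 ^ ∣ ∁ X ∣) + ∑ (subsets n) (λ X → 3 ^ ∣ ∁ X ∣)
    ≡⟨ cong₂ _+_ (trans (∑-*ˡ (subsets n) 3 _) (cong (3 *_) (∑-3^∣∁∣ n))) (∑-3^∣∁∣ n) ⟩
  3 * (2 ^ n * 2 ^ n) + 2 ^ n * 2 ^ n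
    ≡⟨ four (2 ^ n) ⟩
  2 * 2 ^ n * (2 * 2 ^ n) ∎
  where
  open ≡-Reasoning
  four : ∀ p → 3 * (p * p) + p * p ≡ 2 * p * (2 * p)
  four = solve-∀

-- Ensures that m = ⌊N/8⌋ is positive and large enough for 256 m² ≤ 2^m, where 256 = 16² stems from
-- N ≤ 16m.
unbalanced-threshold : ℕ
unbalanced-threshold = suc (proj₁ (square≤2^ 256)) * 8

-- Here a is at least 7/8 of N = a + b. Since 3⁷ = 2187 exceeds 2⁹ = 512, the power 3^a beats 2^N by
-- a further factor 2^⌊N/8⌋, which absorbs N².
unbalanced : ∀ a b → unbalanced-threshold ≤ a + b → b * 8 ≤ a + b → (a + b) * (a + b) * 2 ^ (a + b) ≤ 3 ^ a
unbalanced a b N≤ 8b≤ = begin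
  N * N * 2 ^ N                                ≤⟨ *-monoˡ-≤ (2 ^ N) N²≤2^m ⟩
  2 ^ m * 2 ^ N                                ≡⟨ cong (λ k → 2 ^ m * 2 ^ k) N≡ ⟩
  2 ^ m * 2 ^ (ρ + m * 8)                      ≡⟨ ^-distribˡ-+-* 2 m (ρ + m * 8) ⟨
  2 ^ (m + (ρ + m * 8))                        ≡⟨ cong (2 ^_) (regroup m ρ) ⟩
  2 ^ (ρ + 9 * m)                              ≡⟨ ^-distribˡ-+-* 2 ρ (9 * m) ⟩
  2 ^ ρ * 2 ^ (9 * m)                          ≡⟨ cong (2 ^ ρ *_) (^-*-assoc 2 9 m) ⟨
  2 ^ ρ * 512 ^ m                              ≤⟨ *-mono-≤ (^-monoˡ-≤ ρ (n≤1+n 2)) (^-monoˡ-≤ m (m≤m+n 512 1675)) ⟩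
  3 ^ ρ * 2187 ^ m                             ≡⟨ cong (3 ^ ρ *_) (^-*-assoc 3 7 m) ⟩
  3 ^ ρ * 3 ^ (7 * m)                          ≡⟨ ^-distribˡ-+-* 3 ρ (7 * m) ⟨
  3 ^ (ρ + 7 * m)                              ≤⟨ ^-monoʳ-≤ 3 a≥ ⟩
  3 ^ a                                        ∎
  where
  open ≤-Reasoning
  N = a + b
  m = N / 8
  ρ = N % 8
  N≡ : N ≡ ρ + m * 8
  N≡ = m≡m%n+[m/n]*n N 8
  regroup : ∀ m ρ → m + (ρ + m * 8) ≡ ρ + 9 * m
  regroup = solve-∀
  m≥ : suc (proj₁ (square≤2^ 256)) ≤ m
  m≥ = m*n≤o⇒m≤o/n _ 8 N N≤
  N≤16m : N ≤ 16 * m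
  N≤16m = begin
    N               ≡⟨ N≡ ⟩
    ρ + m * 8       ≤⟨ +-monoˡ-≤ (m * 8) (<⇒≤ (m%n<n N 8)) ⟩
    8 + m * 8       ≤⟨ +-monoˡ-≤ (m * 8) (*-monoˡ-≤ 8 (≤-trans (s≤s z≤n) m≥)) ⟩
    m * 8 + m * 8   ≡⟨ sixteen m ⟩
    16 * m          ∎
    where
    sixteen : ∀ m → m * 8 + m * 8 ≡ 16 * m
    sixteen = solve-∀
  N²≤2^m : N * N ≤ 2 ^ m
  N²≤2^m = begin
    N * N                ≤⟨ *-mono-≤ N≤16m N≤16m ⟩
    16 * m * (16 * m)    ≡⟨ square m ⟩
    256 * (m * m)        ≤⟨ proj₂ (square≤2^ 256) m (<⇒≤ m≥) ⟩
    2 ^ m                ∎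
    where
    square : ∀ m → 16 * m * (16 * m) ≡ 256 * (m * m)
    square = solve-∀
  b≤m : b ≤ m
  b≤m = m*n≤o⇒m≤o/n b 8 N 8b≤
  a≥ : ρ + 7 * m ≤ a
  a≥ = +-cancelʳ-≤ m _ _ (begin
    ρ + 7 * m + m    ≡⟨ eight ρ m ⟩
    ρ + m * 8        ≡⟨ N≡ ⟨
    a + b            ≤⟨ +-monoʳ-≤ a b≤m ⟩
    a + m            ∎)
    where
    eight : ∀ ρ m → ρ + 7 * m + m ≡ ρ + m * 8
    eight = solve-∀

-- If a and b both exceed N/8, then N² ≤ 64ab; otherwise `unbalanced` applies. Adding the two bounds
-- gives one inequality that can be summed over all sets.
balanced⊎extreme : ∀ a b → unbalanced-threshold ≤ a + b →
  (a + b) * (a + b) * 2 ^ (a + b) ≤ 64 * (a * b) * 2 ^ (a + b) + (3 ^ a + 3 ^ b)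
balanced⊎extreme a b N≤ with b * 8 ≤? a + b | a * 8 ≤? a + b
... | yes 8b≤ | _       = ≤-trans (unbalanced a b N≤ 8b≤) (≤-trans (m≤m+n (3 ^ a) (3 ^ b)) (m≤n+m _ (64 * (a * b) * 2 ^ (a + b))))
... | no _    | yes 8a≤ rewrite +-comm a b = ≤-trans (unbalanced b a N≤ 8a≤) (≤-trans (m≤n+m (3 ^ b) (3 ^ a)) (m≤n+m _ (64 * (a * b) * 2 ^ (b + a))))
... | no 8b≰  | no 8a≰  = ≤-trans (*-monoˡ-≤ (2 ^ (a + b)) (begin
  (a + b) * (a + b)   ≤⟨ *-mono-≤ (<⇒≤ (≰⇒> 8a≰)) (<⇒≤ (≰⇒> 8b≰)) ⟩
  a * 8 * (b * 8)     ≡⟨ product a b ⟩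
  64 * (a * b)        ∎)) (m≤m+n _ (3 ^ a + 3 ^ b))
  where
  open ≤-Reasoning
  product : ∀ a b → a * 8 * (b * 8) ≡ 64 * (a * b)
  product = solve-∀

∣X∣+∣∁X∣ : ∀ (X : Subset n) → ∣ X ∣ + ∣ ∁ X ∣ ≡ n
∣X∣+∣∁X∣ X = trans (cong (∣ X ∣ +_) (∣∁p∣≡n∸∣p∣ X)) (m+[n∸m]≡n (∣p∣≤n X))

-- Since Σ 3^|X| = 4ⁿ, at most 2 · 2ⁿ / n² sets have n² 2ⁿ ≤ 3^|X| + 3^|∁X|. Any
-- other C has n² ≤ 64 |C| |∁C|, and double counting its |C| |∁C| neighbours
-- bounds the number of such C in A by 64 · 2 · 2ⁿ / n².
size-bound : ∀ n → unbalanced-threshold ≤ n → (A : Family n) →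
  (∀ Z → ∑ (pairs n) (𝟙 ∘ isNeighbour A Z) ≤ 2) → size A * (n * n) ≤ 130 * 2 ^ n
size-bound n N≤n A ≤2 = *-cancelʳ-≤ _ _ (2 ^ n) {{m^n≢0 2 n}} (begin
  size A * (n * n) * 2 ^ n
    ≡⟨ *-assoc (size A) (n * n) (2 ^ n) ⟩
  size A * (n * n * 2 ^ n)
    ≡⟨ ∑-*ʳ (subsets n) (n * n * 2 ^ n) (𝟙 ∘ A) ⟨
  ∑ (subsets n) (λ C → 𝟙 (A C) * (n * n * 2 ^ n))
    ≤⟨ ∑-mono (subsets n) term ⟩
  ∑ (subsets n) (λ C → 𝟙 (A C) * (∣ ∁ C ∣ * ∣ C ∣) * (64 * 2 ^ n) + (3 ^ ∣ C ∣ + 3 ^ ∣ ∁ C ∣))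
    ≡⟨ ∑-+ (subsets n) _ _ ⟩
  ∑ (subsets n) (λ C → 𝟙 (A C) * (∣ ∁ C ∣ * ∣ C ∣) * (64 * 2 ^ n)) + ∑ (subsets n) (λ C → 3 ^ ∣ C ∣ + 3 ^ ∣ ∁ C ∣)
    ≡⟨ cong₂ _+_ (∑-*ʳ (subsets n) (64 * 2 ^ n) _) (trans (∑-+ (subsets n) _ _) (cong₂ _+_ (∑-3^∣∣ n) (∑-3^∣∁∣ n))) ⟩
  ∑ (subsets n) (λ C → 𝟙 (A C) * (∣ ∁ C ∣ * ∣ C ∣)) * (64 * 2 ^ n) + (2 ^ n * 2 ^ n + 2 ^ n * 2 ^ n)
    ≤⟨ +-monoˡ-≤ _ (*-monoˡ-≤ (64 * 2 ^ n) pairs≤) ⟩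
  2 ^ n * 2 * (64 * 2 ^ n) + (2 ^ n * 2 ^ n + 2 ^ n * 2 ^ n)
    ≡⟨ collect (2 ^ n) ⟩
  130 * 2 ^ n * 2 ^ n ∎)
  where
  open ≤-Reasoning
  collect : ∀ p → p * 2 * (64 * p) + (p * p + p * p) ≡ 130 * p * p
  collect = solve-∀
  pairs≤ : ∑ (subsets n) (λ C → 𝟙 (A C) * (∣ ∁ C ∣ * ∣ C ∣)) ≤ 2 ^ n * 2
  pairs≤ = begin
    ∑ (subsets n) (λ C → 𝟙 (A C) * (∣ ∁ C ∣ * ∣ C ∣))           ≡⟨ ∑-neighbours A ⟨
    ∑ (subsets n) (λ Z → ∑ (pairs n) (𝟙 ∘ isNeighbour A Z))     ≤⟨ ∑-mono (subsets n) ≤2 ⟩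
    ∑ (subsets n) (λ _ → 2)                                      ≡⟨ ∑-const (subsets n) 2 ⟩
    length (subsets n) * 2                                       ≡⟨ cong (_* 2) (length-subsets n) ⟩
    2 ^ n * 2                                                    ∎
  term : ∀ C → 𝟙 (A C) * (n * n * 2 ^ n) ≤
               𝟙 (A C) * (∣ ∁ C ∣ * ∣ C ∣) * (64 * 2 ^ n) + (3 ^ ∣ C ∣ + 3 ^ ∣ ∁ C ∣)
  term C with A C
  ... | false = z≤n
  ... | true  = begin
    1 * (n * n * 2 ^ n)
      ≡⟨ *-identityˡ _ ⟩
    n * n * 2 ^ n
      ≤⟨ subst (λ m → unbalanced-threshold ≤ m → m * m * 2 ^ m ≤ 64 * (∣ C ∣ * ∣ ∁ C ∣) * 2 ^ m + (3 ^ ∣ C ∣ + 3 ^ ∣ ∁ C ∣))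
           (∣X∣+∣∁X∣ C) (balanced⊎extreme ∣ C ∣ ∣ ∁ C ∣) N≤n ⟩
    64 * (∣ C ∣ * ∣ ∁ C ∣) * 2 ^ n + (3 ^ ∣ C ∣ + 3 ^ ∣ ∁ C ∣)
      ≡⟨ cong (_+ (3 ^ ∣ C ∣ + 3 ^ ∣ ∁ C ∣)) (shuffle ∣ C ∣ ∣ ∁ C ∣ (2 ^ n)) ⟩
    1 * (∣ ∁ C ∣ * ∣ C ∣) * (64 * 2 ^ n) + (3 ^ ∣ C ∣ + 3 ^ ∣ ∁ C ∣) ∎
    where
    shuffle : ∀ a b p → 64 * (a * b) * p ≡ 1 * (b * a) * (64 * p)
    shuffle = solve-∀

_≟ˢ_ : (X Y : Subset n) → Dec (X ≡ Y)
_≟ˢ_ = Vec.≡-dec Bool._≟_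

∈-flip⁺ : ∀ (X : Subset n) x → lookup X x ≡ outside → X [ x ]%= not ≡ X ∪ ⁅ x ⁆
∈-flip⁺ (outside ∷ X) zero    _  = cong (inside ∷_) (sym (∪-identityʳ X))
∈-flip⁺ (b ∷ X)       (suc x) eq = cong₂ _∷_ (sym (Bool.∨-identityʳ b)) (∈-flip⁺ X x eq)

∈-flip⁻ : ∀ (X : Subset n) x → lookup X x ≡ inside → X [ x ]%= not ≡ X - x
∈-flip⁻ (inside ∷ X) zero    _  = cong (outside ∷_) (sym (p─⊥≡p X))
∈-flip⁻ (b ∷ X)      (suc x) eq = cong (b ∷_) (∈-flip⁻ X x eq)

swap≡ : ∀ (Z : Subset n) {x y} → x ∈ Z → y ∉ Z → swap x y Z ≡ (Z - x) ∪ ⁅ y ⁆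
swap≡ Z {x} {y} x∈ y∉ = trans (cong (_[ y ]%= not) (∈-flip⁻ Z x (Vec.[]=⇒lookup x∈)))
  (∈-flip⁺ (Z - x) y (Bool.¬-not λ eq → y∉ (p─q⊆p Z ⁅ x ⁆ (Vec.lookup⇒[]= y (Z - x) eq))))

isNeighbour⁻ : ∀ (A : Family n) Z {x y} → T (isNeighbour A Z (x , y)) →
               x ∈ Z × y ∉ Z × T (A ((Z - x) ∪ ⁅ y ⁆))
isNeighbour⁻ A Z {x} {y} nb
  with Zx , nb′ ← Equivalence.to T-∧ nb
  with Zy , Axy ← Equivalence.to T-∧ nb′ = x∈ , y∉ , subst (T ∘ A) (swap≡ Z x∈ y∉) Axy
  where
  x∈ : x ∈ Z
  x∈ = Vec.lookup⇒[]= x Z (T⇒≡true Zx)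
  y∉ : y ∉ Z
  y∉ y∈ = contradiction (subst (T ∘ not) (Vec.[]=⇒lookup y∈) Zy) id

-- One circuit for each flat spanned by a circuit

module _ {F : Family n} (matroid : IsMatroid (onAll F)) where
  open IsMatroid matroid

  spanningCircuit? : ∀ Y C → Dec (Circuit matroid C × cl matroid C ≡ Y)
  spanningCircuit? Y C = isCircuit? (onAll F) C ×-dec cl matroid C ≟ˢ Y

  spanningCircuits : Subset n → List (Subset n)
  spanningCircuits Y = filter (spanningCircuit? Y) (subsets n)

  -- The default `⊥` is reached only for sets that are not the closure of a circuit.
  pick : Subset n → Subset n
  pick Y = fromMaybe ⊥ (head (spanningCircuits Y))

  pick-spec : ∀ {C} → Circuit matroid C →
              Circuit matroid (pick (cl matroid C)) × cl matroid (pick (cl matroid C)) ≡ cl matroid C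
  pick-spec {C} circ = first (AllP.all-filter (spanningCircuit? Y) (subsets n))
    (∈ₗ.∈-filter⁺ (spanningCircuit? Y) (∈-subsets C) (circ , refl))
    where
    Y = cl matroid C
    first : ∀ {Cs} → All (λ C → Circuit matroid C × cl matroid C ≡ Y) Cs → C ∈ₗ Cs →
            Circuit matroid (fromMaybe ⊥ (head Cs)) × cl matroid (fromMaybe ⊥ (head Cs)) ≡ Y
    first (spec ∷ _) _ = spec

  abstract
    picked : Family n
    picked C = does (isCircuit? (onAll F) C ×-dec pick (cl matroid C) ≟ˢ C)

    picked⁺ : ∀ {C} → Circuit matroid C → pick (cl matroid C) ≡ C → T (picked C)
    picked⁺ {C} circ pick≡ = does⁺ (isCircuit? (onAll F) C ×-dec pick (cl matroid C) ≟ˢ C) (circ , pick≡)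

    picked⁻ : ∀ {C} → T (picked C) → Circuit matroid C × pick (cl matroid C) ≡ C
    picked⁻ {C} = does⁻ (isCircuit? (onAll F) C ×-dec pick (cl matroid C) ≟ˢ C)

  picked⇒circuit : ∀ {C} → T (picked C) → Circuit matroid C
  picked⇒circuit = proj₁ ∘ picked⁻

  picked-cl-injective : ∀ {C B} → T (picked C) → T (picked B) → cl matroid C ≡ cl matroid B → C ≡ B
  picked-cl-injective pC pB cl≡ = trans (sym (proj₂ (picked⁻ pC))) (trans (cong pick cl≡) (proj₂ (picked⁻ pB)))

  picked-stable : Stable picked
  picked-stable Z e f e∉ f∉ pe pf with ∈-∪⁅⁆⁻ (subst (e ∈_)
      (picked-cl-injective pe pf (adjacent⇒cl≡ matroid Z e∉ f∉ (picked⇒circuit pe) (picked⇒circuit pf)))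
      (e∈X∪⁅e⁆ Z e))
  ... | inj₁ e∈Z = contradiction e∈Z e∉
  ... | inj₂ e≡f = e≡f

  module _ (¬W³ : ¬ HasMinor F W³) (¬MK₄ : ¬ HasMinor F MK₄) where

    picked-neighbours : ∀ Z → ∑ (pairs n) (𝟙 ∘ isNeighbour picked Z) ≤ 2
    picked-neighbours Z = at-most-two (pairs-unique n) (isNeighbour picked Z) three
      where
      Neighbour : Fin n × Fin n → Set
      Neighbour (x , y) = x ∈ Z × y ∉ Z × T (picked ((Z - x) ∪ ⁅ y ⁆))

      -- Exchanges sharing x give two sets over Z - x, and exchanges sharing y give two sets over W
      -- = Z - x - x′ + y. Stability forbids both adjacencies.
      different : ∀ {x y x′ y′} → Neighbour (x , y) → Neighbour (x′ , y′) → (x , y) ≢ (x′ , y′) → x ≢ x′ × y ≢ y′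
      different {x} {y} {x′} {y′} (x∈ , y∉ , p) (x′∈ , y′∉ , p′) pair≢ = x≢x′ , y≢y′
        where
        x≢x′ : x ≢ x′
        x≢x′ refl = pair≢ (cong (x ,_) (picked-stable (Z - x) y y′
          (y∉ ∘ p─q⊆p Z ⁅ x ⁆) (y′∉ ∘ p─q⊆p Z ⁅ x ⁆) p p′))
        y≢y′ : y ≢ y′
        y≢y′ refl = x≢x′ (sym (picked-stable W x′ x
          (W∌ x′ (λ x′∈ → proj₂ (x∈X-e⁻ (Z - x) x′∈) refl) x′∈)
          (W∌ x (λ x∈ → proj₂ (x∈X-e⁻ Z (p─q⊆p (Z - x) ⁅ x′ ⁆ x∈)) refl) x∈)
          (subst (T ∘ picked) eq p) (subst (T ∘ picked) eq′ p′)))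
          where
          W = ((Z - x) - x′) ∪ ⁅ y ⁆
          W∌ : ∀ z → z ∉ (Z - x) - x′ → z ∈ Z → z ∉ W
          W∌ z z∉ z∈ z∈W with ∈-∪⁅⁆⁻ z∈W
          ... | inj₁ z∈′  = z∉ z∈′
          ... | inj₂ refl = y∉ z∈
          restore : ∀ X z → z ∈ X → X ∪ ⁅ y ⁆ ≡ ((X - z) ∪ ⁅ y ⁆) ∪ ⁅ z ⁆
          restore X z z∈X = ⊆-antisym
            (∪⁅⁆-least X⊆ (p⊆p∪q ⁅ z ⁆ (e∈X∪⁅e⁆ (X - z) y)))
            (∪⁅⁆-least (∪⁅⁆-least (p⊆p∪q ⁅ y ⁆ ∘ p─q⊆p X ⁅ z ⁆) (e∈X∪⁅e⁆ X y)) (p⊆p∪q ⁅ y ⁆ z∈X))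
            where
            X⊆ : X ⊆ ((X - z) ∪ ⁅ y ⁆) ∪ ⁅ z ⁆
            X⊆ {v} v∈X with v Fin.≟ z
            ... | yes refl = e∈X∪⁅e⁆ ((X - z) ∪ ⁅ y ⁆) z
            ... | no  v≢z  = p⊆p∪q ⁅ z ⁆ (p⊆p∪q ⁅ y ⁆ (x∈p∧x≢y⇒x∈p-y v∈X v≢z))
          eq : (Z - x) ∪ ⁅ y ⁆ ≡ W ∪ ⁅ x′ ⁆
          eq = restore (Z - x) x′ (x∈p∧x≢y⇒x∈p-y x′∈ (x≢x′ ∘ sym))
          eq′ : (Z - x′) ∪ ⁅ y ⁆ ≡ W ∪ ⁅ x ⁆
          eq′ = trans (restore (Z - x′) x (x∈p∧x≢y⇒x∈p-y x∈ x≢x′))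
                  (cong (λ X → (X ∪ ⁅ y ⁆) ∪ ⁅ x ⁆) (p─x─y≡p─y─x Z x′ x))

      cl-different : ∀ {x y x′ y′} → Neighbour (x , y) → Neighbour (x′ , y′) → y ≢ y′ →
                     cl matroid ((Z - x) ∪ ⁅ y ⁆) ≢ cl matroid ((Z - x′) ∪ ⁅ y′ ⁆)
      cl-different {x} {y} {x′} (_ , y∉ , p) (_ , _ , p′) y≢y′ cl≡
        with ∈-∪⁅⁆⁻ (subst (y ∈_) (picked-cl-injective p p′ cl≡) (e∈X∪⁅e⁆ (Z - x) y))
      ... | inj₁ y∈  = y∉ (p─q⊆p Z ⁅ x′ ⁆ y∈)
      ... | inj₂ y≡y′ = y≢y′ y≡y′

      circuit : ∀ {x y} → Neighbour (x , y) → Circuit matroid ((Z - x) ∪ ⁅ y ⁆)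
      circuit {x} {y} (_ , _ , p) = picked⇒circuit p

      three : ∀ p₁ p₂ p₃ → p₁ ≢ p₂ → p₁ ≢ p₃ → p₂ ≢ p₃ → T (isNeighbour picked Z p₁) →
              T (isNeighbour picked Z p₂) → ¬ T (isNeighbour picked Z p₃)
      three p₁ p₂ p₃ ≢₁₂ ≢₁₃ ≢₂₃ nb₁ nb₂ nb₃
        with n₁@(x₁∈ , y₁∉ , _) ← isNeighbour⁻ picked Z nb₁
        with n₂@(x₂∈ , y₂∉ , _) ← isNeighbour⁻ picked Z nb₂
        with n₃@(x₃∈ , y₃∉ , _) ← isNeighbour⁻ picked Z nb₃
        with x₁≢x₂ , y₁≢y₂ ← different n₁ n₂ ≢₁₂
        with x₁≢x₃ , y₁≢y₃ ← different n₁ n₃ ≢₁₃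
        with x₂≢x₃ , y₂≢y₃ ← different n₂ n₃ ≢₂₃ =
        [ ¬W³ , ¬MK₄ ]′ (triangle⇒minor matroid Z x₁∈ x₂∈ x₃∈ y₁∉ y₂∉ y₃∉
          x₁≢x₂ x₁≢x₃ x₂≢x₃ y₁≢y₂ y₁≢y₃ y₂≢y₃ (circuit n₁) (circuit n₂) (circuit n₃)
          (cl-different n₁ n₂ y₁≢y₂) (cl-different n₁ n₃ y₁≢y₃) (cl-different n₂ n₃ y₂≢y₃))

  abstract
    spannedFlat : Family n
    spannedFlat Y = does (anySubset? λ C → T? (picked C) ×-dec cl matroid C ≟ˢ Y)

    spannedFlat⁺ : ∀ {C} → T (picked C) → T (spannedFlat (cl matroid C))
    spannedFlat⁺ {C} pC = does⁺ (anySubset? λ B → T? (picked B) ×-dec cl matroid B ≟ˢ cl matroid C) (C , pC , refl)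

    spannedFlat⁻ : ∀ {Y} → T (spannedFlat Y) → ∃ λ C → T (picked C) × cl matroid C ≡ Y
    spannedFlat⁻ {Y} = does⁻ (anySubset? λ C → T? (picked C) ×-dec cl matroid C ≟ˢ Y)

  size-spannedFlat : size spannedFlat ≤ size picked
  size-spannedFlat = begin
    size spannedFlat                                          ≡⟨ size≡length spannedFlat ⟩
    length (filter (T? ∘ spannedFlat) (subsets n))            ≤⟨ unique-length-≤ (setoid (Subset n))
                                                                   (Unique.filter⁺ (T? ∘ spannedFlat) (subsets-unique n)) flat∈ ⟩
    length (map (cl matroid) (filter (T? ∘ picked) (subsets n)))  ≡⟨ List.length-map (cl matroid) (filter (T? ∘ picked) (subsets n)) ⟩
    length (filter (T? ∘ picked) (subsets n))                 ≡⟨ size≡length picked ⟨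
    size picked                                               ∎
    where
    open ≤-Reasoning
    flat∈ : ∀ {Y} → Y ∈ₗ filter (T? ∘ spannedFlat) (subsets n) → Y ∈ₗ map (cl matroid) (filter (T? ∘ picked) (subsets n))
    flat∈ {Y} Y∈ with C , pC , refl ← spannedFlat⁻ (proj₂ (∈ₗ.∈-filter⁻ (T? ∘ spannedFlat) {xs = subsets n} Y∈)) =
      ∈ₗ.∈-map⁺ (cl matroid) (∈ₗ.∈-filter⁺ (T? ∘ picked) (∈-subsets C) pC)

-- Recovering the matroid from its flats and chosen circuits

Covered : (P A : Family n) → Subset n → Set
Covered P A X = ∃ λ Y → T (P Y) × (∀ C → T (A C) → C ⊆ Y → ∣ C ∣ ≤ ∣ X ∩ Y ∣)

abstract
  -- The rank of a flat Y of P is one less than the largest size of a member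
  -- of A contained in Y.
  decode : (P A : Family n) → Family n
  decode P A X = does (¬? (anySubset? λ Y → T? (P Y) ×-dec
    allSubset? λ C → T? (A C) →-dec (C ⊆? Y →-dec ∣ C ∣ ≤? ∣ X ∩ Y ∣)))

  decode⁺ : ∀ (P A : Family n) X → ¬ Covered P A X → T (decode P A X)
  decode⁺ P A X = does⁺ (¬? (anySubset? λ Y → T? (P Y) ×-dec
    allSubset? λ C → T? (A C) →-dec (C ⊆? Y →-dec ∣ C ∣ ≤? ∣ X ∩ Y ∣)))

  decode⁻ : ∀ (P A : Family n) X → T (decode P A X) → ¬ Covered P A X
  decode⁻ P A X = does⁻ (¬? (anySubset? λ Y → T? (P Y) ×-dec
    allSubset? λ C → T? (A C) →-dec (C ⊆? Y →-dec ∣ C ∣ ≤? ∣ X ∩ Y ∣)))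

module _ {F : Family n} (matroid : IsMatroid (onAll F)) where
  open IsMatroid matroid

  -- If X is independent and Y = `cl C` with C chosen, then X ∩ Y has fewer than |C| elements, and C
  -- itself lies in Y. If X contains a circuit C, take Y = `cl C`: then C ⊆ X ∩ Y, and no circuit
  -- inside Y is larger than C.
  decode-picked : ∀ P A → (∀ Y → spannedFlat matroid Y ≡ P Y) → (∀ C → picked matroid C ≡ A C) →
                  ∀ X → F X ≡ decode P A X
  decode-picked P A P≗ A≗ X = T-ext
    (λ FX → decode⁺ P A X (indep⇒¬covered FX))
    (λ d → decidable-stable (T? (F X)) λ ¬FX → decode⁻ P A X d (dep⇒covered ¬FX))
    where
    indep⇒¬covered : T (F X) → ¬ Covered P A X
    indep⇒¬covered FX (Y , PY , large) with spannedFlat⁻ matroid (subst T (sym (P≗ Y)) PY)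
    ... | C , pC , refl =
      <⇒≱ (indep⊆cl⇒∣∣< matroid (picked⇒circuit matroid pC) (p∩q⊆q X Y) (hereditary (X ∩ Y) X (p∩q⊆p X Y) FX))
          (large C (subst T (A≗ C) pC) (circuit⊆cl matroid (picked⇒circuit matroid pC)))

    dep⇒covered : ¬ T (F X) → Covered P A X
    dep⇒covered ¬FX with dependent⇒circuit matroid X ¬FX
    ... | C , C⊆X , circ = cl matroid C , subst T (trans (cong (spannedFlat matroid) cl≡) (P≗ (cl matroid C))) (spannedFlat⁺ matroid pD)
      , λ B AB B⊆ → ≤-trans
          (circuit⊆cl⇒∣∣≤ matroid circ (picked⇒circuit matroid (subst T (sym (A≗ B)) AB)) B⊆)
          (p⊆q⇒∣p∣≤∣q∣ λ {x} x∈C → x∈p∩q⁺ (C⊆X x∈C , circuit⊆cl matroid circ x∈C))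
      where
      cl≡ = proj₂ (pick-spec matroid circ)
      pD = picked⁺ matroid (proj₁ (pick-spec matroid circ)) (cong (pick matroid) cl≡)

-- The upper bound and the final comparison

mX≤ : ∀ n k → unbalanced-threshold ≤ n → (∀ x → x * (n * n) ≤ 130 * 2 ^ n → x ≤ k) →
      mX n ≤ length (smallFamilies n k) * length (smallFamilies n k)
mX≤ n k N≤n ≤k = subst (mX n ≤_) (length-cartesianProductWith decode (smallFamilies n k) (smallFamilies n k))
  (count≤length isXFreeMatroid? encode)
  where
  open ∈S (familySetoid n) using () renaming (_∈_ to _∈ˢ_)

  small : ∀ (A : Family n) → size A ≤ k → ∃ λ A′ → A′ ∈ₗ smallFamilies n k × (∀ X → A X ≡ A′ X)
  small A ∣A∣≤k with A′ , A′∈ , A≗A′ ← find (families-complete n A) =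
    A′ , ∈ₗ.∈-filter⁺ (λ A → size A ≤? k) A′∈
           (≤-trans (≤-reflexive (∑-cong (subsets n) (λ X → cong 𝟙 (sym (A≗A′ X))))) ∣A∣≤k) , A≗A′

  ∣picked∣≤k : ∀ {F} (free : IsXFreeMatroid F) → size (picked (proj₁ free)) ≤ k
  ∣picked∣≤k (matroid , ¬W³ , ¬MK₄) = ≤k _ (size-bound n N≤n (picked matroid) (picked-neighbours matroid ¬W³ ¬MK₄))

  encode : ∀ {F} → IsXFreeMatroid F → F ∈ˢ cartesianProductWith decode (smallFamilies n k) (smallFamilies n k)
  encode free@(matroid , _) = pair-small
    (small (spannedFlat matroid) (≤-trans (size-spannedFlat matroid) (∣picked∣≤k free)))
    (small (picked matroid) (∣picked∣≤k free))
    where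
    pair-small : (∃ λ P → P ∈ₗ smallFamilies n k × (∀ Y → spannedFlat matroid Y ≡ P Y)) →
                 (∃ λ A → A ∈ₗ smallFamilies n k × (∀ C → picked matroid C ≡ A C)) →
                 _ ∈ˢ cartesianProductWith decode (smallFamilies n k) (smallFamilies n k)
    pair-small (P , P∈ , P≗) (A , A∈ , A≗) =
      Any.map (λ { refl → decode-picked matroid P A P≗ A≗ }) (∈ₗ.∈-cartesianProductWith⁺ decode P∈ A∈)

-- Kept abstract since the threshold has a huge normal form.
abstract
  labels-win : ∀ K t → ∃ λ N → ∀ n k x s b → N ≤ n → k * (n * n) ≤ K * 2 ^ n →
    (∀ a → a ≤ n → x ≤ 2 ^ (2 ^ (n ∸ a) + suc a * k)) →
    2 ^ b ≤ s ^ n → 2 ^ n * 2 ^ n ≤ 8 * n * (b * b) → t * (x * x) ≤ s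
  labels-win K t = threshold K t (3 + 6 * K) refl , code≤labels K t (3 + 6 * K) refl

eventually-smaller : ∀ K N₀ {f g : ℕ → ℕ} →
  (∀ n k → N₀ ≤ n → (∀ x → x * (n * n) ≤ K * 2 ^ n → x ≤ k) →
    f n ≤ length (smallFamilies n k) * length (smallFamilies n k)) →
  (∀ {n r} → 0 < r → r < n → 2 ^ layer n r ≤ g n ^ n) →
  ∀ t → ∃ λ N → ∀ n → N ≤ n → t * f n ≤ g n
eventually-smaller K N₀ {f} {g} f≤ g-large t = N , bound
  where
  N₁ = proj₁ (labels-win K t)
  N  = 2 + (N₀ + N₁)
  bound : ∀ n → N ≤ n → t * f n ≤ g n
  bound n N≤n with r , 0<r , r<n , layer-large ← large-layer n (≤-trans (m≤m+n 2 (N₀ + N₁)) N≤n) = begin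
    t * f n      ≤⟨ *-monoʳ-≤ t (f≤ n k (≤-trans (≤-trans (m≤m+n N₀ N₁) (m≤n+m (N₀ + N₁) 2)) N≤n)
                      (λ x → m*n≤o⇒m≤o/n x (n * n) (K * 2 ^ n))) ⟩
    t * (L * L)  ≤⟨ proj₂ (labels-win K t) n k L (g n) (layer n r)
                      (≤-trans (≤-trans (m≤n+m N₁ N₀) (m≤n+m (N₀ + N₁) 2)) N≤n)
                      (m/n*n≤m (K * 2 ^ n) (n * n)) (length-smallFamilies n k) (g-large 0<r r<n) layer-large ⟩
    g n          ∎
    where
    open ≤-Reasoning
    instance
      n*n≢0 : NonZero (n * n)
      n*n≢0 = m*n≢0 n n {{>-nonZero (≤-trans (s≤s z≤n) N≤n)}} {{>-nonZero (≤-trans (s≤s z≤n) N≤n)}}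
    k = K * 2 ^ n / (n * n)
    L = length (smallFamilies n k)

-- A positive rational with denominator d is at least 1/d, so the factor t = d suffices for ε.
/1≤*/1 : ∀ ε .{{_ : ℚ.Positive ε}} x y → ℚ.denominatorℕ ε * x ≤ y →
         (ℤ.+ x) ℚ./ 1 ℚ.≤ ε ℚ.* ((ℤ.+ y) ℚ./ 1)
/1≤*/1 ε@(ℚ.mkℚ (ℤ.+ suc a) d _) x y dx≤y = ℚ.toℚᵘ-cancel-≤ (begin
  ℚ.toℚᵘ ((ℤ.+ x) ℚ./ 1)                ≃⟨ ℚ.toℚᵘ-fromℚᵘ (ℚᵘ.mkℚᵘ (ℤ.+ x) 0) ⟩
  ℚᵘ.mkℚᵘ (ℤ.+ x) 0                     ≤⟨ ℚᵘ.*≤* (subst₂ ℤ._≤_ (ℤ.pos-* x (suc d * 1))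
                                              (trans (ℤ.pos-* (suc a * y) 1) (cong (ℤ._* (ℤ.+ 1)) (ℤ.pos-* (suc a) y)))
                                              (ℤ.+≤+ xd≤ay)) ⟩
  ℚ.toℚᵘ ε ℚᵘ.* ℚᵘ.mkℚᵘ (ℤ.+ y) 0       ≃⟨ ℚᵘ.*-congˡ {ℚ.toℚᵘ ε} (ℚ.toℚᵘ-fromℚᵘ (ℚᵘ.mkℚᵘ (ℤ.+ y) 0)) ⟨
  ℚ.toℚᵘ ε ℚᵘ.* ℚ.toℚᵘ ((ℤ.+ y) ℚ./ 1)  ≃⟨ ℚ.toℚᵘ-homo-* ε ((ℤ.+ y) ℚ./ 1) ⟨
  ℚ.toℚᵘ (ε ℚ.* ((ℤ.+ y) ℚ./ 1))        ∎)
  where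
  open ℚᵘ.≤-Reasoning
  xd≤ay : x * (suc d * 1) ≤ suc a * y * 1
  xd≤ay = subst₂ _≤_ (trans (*-comm (suc d) x) (cong (x *_) (sym (*-identityʳ (suc d))))) (sym (*-identityʳ (suc a * y)))
    (≤-trans dx≤y (m≤m+n y (a * y)))

=o⁺ : ∀ {f g} → (∀ t → ∃ λ N → ∀ n → N ≤ n → t * f n ≤ g n) → f =o g
=o⁺ {f} {g} eventually ε 0<ε with eventually (ℚ.denominatorℕ ε)
... | N , bound = N , λ n N≤n → /1≤*/1 ε {{ℚ.positive 0<ε}} (f n) (g n) (bound n N≤n)

theorem13 : mX =o s
theorem13 = =o⁺ (eventually-smaller 130 unbalanced-threshold mX≤ s-large)
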